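{- Let $(G,\sigma)$ be a signed graph with ${\rm mad}(G)<\frac{14}{5}$. Then $(G,\sigma)$ admits an edge-sign preserving homomorphism to ${\rm DSG}(K_6,M)$.
   Context: A signed graph $(G,\sigma)$ is a finite simple graph with a signature $\sigma:E(G)\to\{+,-\}$. An edge-sign preserving homomorphism of $(G,\sigma)$ to $(H,\pi)$ is a map $\phi:V(G)\to V(H)$ such that for every edge $uv$ of $G$, $\phi(u)\phi(v)$ is an edge of $H$ and $\pi(\phi(u)\phi(v))=\sigma(uv)$. ${\rm DSG}(K_6,M)$ is the signed graph with vertex set $\{i^+,i^-: 1\le i\le 6\}$ in which, for $i\ne j$ and $\alpha\in\{+,-\}$: $i^\alpha j^\alpha$ is an edge which is negative if $\{i,j\}\in\{\{1,2\},\{3,4\},\{5,6\}\}$ and positive otherwise; $i^\alpha j^{ -\alpha}$ is an edge which is positive if $\{i,j\}\in\{\{1,2\},\{3,4\},\{5,6\}\}$ and negative otherwise; and $i^+$, $i^-$ are non-adjacent. ${\rm mad}(G)$ is the maximum of $2|E(H)|/|V(H)|$ over nonempty subgraphs $H$ of $G$. -}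

module Defs where

open import Data.Nat using (ℕ; zero; suc; _+_; _*_; _<_; _<ᵇ_)
open import Data.Fin using (Fin; toℕ) renaming (zero to f0; suc to fs)
open import Data.Fin.Properties using (_≟_)
open import Data.Bool using (Bool; true; false; if_then_else_; _∧_; _xor_; not)
open import Data.Maybe using (Maybe; just; nothing)
open import Data.Product using (_×_; _,_; Σ; ∃)
open import Data.List using (List; map; allFin; length; filterᵇ)
open import Data.Nat.ListAction using (sum)
open import Relation.Nullary using (does)
open import Relation.Binary.PropositionalEquality using (_≡_)

data Sign : Set where
  plus minus : Sign

record SignedGraph : Set where
  field
    n      : ℕ
    sgn    : Fin n → Fin n → Maybe Sign
    noLoop : ∀ u → sgn u u ≡ nothing
    symm   : ∀ u v → sgn u v ≡ sgn v u
open SignedGraph public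

isEdge : Maybe Sign → Bool
isEdge (just _) = true
isEdge nothing  = false

count : {n : ℕ} → (Fin n → Bool) → ℕ
count {n} p = length (filterᵇ p (allFin n))

-- A subgraph H of G: a vertex subset S and a set of kept edges
-- (an edge uv with toℕ u < toℕ v is in H iff it is an edge of G, both ends in S,
-- and keep u v = true).  Every subgraph of G arises this way.
record Subgraph (G : SignedGraph) : Set where
  field
    S    : Fin (n G) → Bool
    keep : Fin (n G) → Fin (n G) → Bool
open Subgraph public

vH : {G : SignedGraph} → Subgraph G → ℕ
vH H = count (S H)

-- |E(H)|  (each unordered edge counted once, via toℕ u < toℕ v)
eH : {G : SignedGraph} → Subgraph G → ℕ
eH {G} H = sum (map (λ u → count (λ v →
   (toℕ u <ᵇ toℕ v) ∧ isEdge (sgn G u v) ∧ S H u ∧ S H v ∧ keep H u v))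
   (allFin (n G)))

-- mad(G) < 14/5 : every nonempty subgraph H has 2|E(H)|/|V(H)| < 14/5,
-- i.e. 5 * (2|E(H)|) < 14 * |V(H)|.
madLt14/5 : SignedGraph → Set
madLt14/5 G = (H : Subgraph G) → 0 < vH H → 5 * (2 * eH H) < 14 * vH H

-- DSG(K_6, M).  Vertices i^α are pairs (i , α) with i : Fin 6 (0-indexed,
-- so paper's vertex k is Fin index k-1) and α : Sign.
-- M = {{1,2},{3,4},{5,6}} becomes {{0,1},{2,3},{4,5}}.
partner : Fin 6 → Fin 6
partner f0                          = fs f0
partner (fs f0)                     = f0
partner (fs (fs f0))                = fs (fs (fs f0))
partner (fs (fs (fs f0)))           = fs (fs f0)
partner (fs (fs (fs (fs f0))))      = fs (fs (fs (fs (fs f0))))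
partner (fs (fs (fs (fs (fs f0))))) = fs (fs (fs (fs f0)))

inM : Fin 6 → Fin 6 → Bool
inM i j = does (j ≟ partner i)

sameSign : Sign → Sign → Bool
sameSign plus  plus  = true
sameSign minus minus = true
sameSign _     _     = false

DSGVertex : Set
DSGVertex = Fin 6 × Sign

-- Sign of the edge between two vertices of DSG(K_6,M), or nothing if non-adjacent.
--  i ≠ j, same α : negative iff {i,j} ∈ M
--  i ≠ j, opposite α : positive iff {i,j} ∈ M
--  i = j : non-adjacent (covers both i^α i^α and i^+ i^-)
dsgSign : DSGVertex → DSGVertex → Maybe Sign
dsgSign (i , α) (j , β) =
  if does (i ≟ j) then nothing
  else (if inM i j xor not (sameSign α β) then just minus else just plus)

IsHom : (G : SignedGraph) → (Fin (n G) → DSGVertex) → Set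
IsHom G φ = ∀ u v s → sgn G u v ≡ just s → dsgSign (φ u) (φ v) ≡ just s

HasHomToDSG : SignedGraph → Set
HasHomToDSG G = Σ (Fin (n G) → DSGVertex) (IsHom G)

{-# OPTIONS --safe #-}
{-
A minimal non-colourable induced subgraph has minimum degree 2 and no two adjacent vertices of degree 2.
Call a 2-vertex a Z-vertex and the others V-vertices.  Write a colour i^α of DSG(K₆,M) as a class (the pair of M
containing i, with the sign α) and a bit; a Z-vertex only forbids one of the six classes at one neighbour when the
other one is coloured.  So a V-vertex has hard neighbours (in V) and soft ones (across a Z-vertex).

Let a U-vertex have two hard and one soft neighbours, and a W-vertex three hard ones only.  Once the class
of one hard neighbour of a U-vertex is fixed, at most two classes are excluded at the other one, and two different
classes never exclude the same two.  Hence a colouring of everything but one U-vertex u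
in which the far end p of u has a choice of two classes can be pushed forward along a path alternating between
U-vertices and W-vertices with exactly two U-neighbours, recolouring only locally, until it meets a U-vertex or a
W-vertex with three U-neighbours, and there it can be completed.  Two adjacent U-vertices, or a
W-vertex with three U-neighbours, provide such a start.

Discharging: a V-vertex with h hard and s soft neighbours has charge 10h + 6s − 28, which is −2 for a U-vertex.
Every U-vertex gets 2 from its non-U neighbours; a neighbour w pays 0, 1 or 2 according to whether the
alternating paths leaving u towards w and away from w reach an end as above.  Since no such end can be joined to a start,
no vertex is left with a negative charge, so the average degree is at least 14/5.
-}
module Submission where

open import Defs
open import Data.Bool using (Bool; true; false; T; _∧_; _∨_; not; if_then_else_)
open import Data.Bool.Properties using (∧-identityʳ; ∧-zeroʳ)
open import Data.Empty using (⊥; ⊥-elim)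
open import Data.Fin using (Fin; toℕ) renaming (zero to f0; suc to fs)
open import Data.Fin.Properties using (_≟_; toℕ-injective; all?)
open import Data.List using (List; []; _∷_; length; filterᵇ; allFin; tabulate; map)
open import Data.List.Membership.DecPropositional using (_∈?_)
open import Data.List.Membership.Propositional using (_∈_; _∉_)
open import Data.List.Properties using (map-cong; map-tabulate)
open import Data.List.Relation.Unary.Any using (here; there)
open import Data.Maybe using (Maybe; just; nothing)
open import Data.Nat using (ℕ; zero; suc; _+_; _*_; _≤_; _<_; _<ᵇ_; _≤ᵇ_; _≡ᵇ_; z≤n; s≤s)
open import Data.Nat.ListAction using () renaming (sum to sumL)
open import Data.Nat.Properties hiding (_≟_)
open import Data.Nat.Tactic.RingSolver using (solve-∀)
open import Data.Product using (Σ; ∃; ∃₂; _×_; _,_; proj₁; proj₂)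
open import Data.Sum using (_⊎_; inj₁; inj₂)
open import Function using (_∘_; id; case_of_)
open import Relation.Binary using (tri<; tri≈; tri>)
open import Relation.Binary.PropositionalEquality
  using (_≡_; _≢_; refl; sym; trans; cong; cong₂; subst; module ≡-Reasoning)
open import Relation.Nullary using (¬_; Dec; yes; no; does; proof; _because_; ofʸ; ofⁿ; invert)
open import Relation.Nullary.Decidable using (map′; _×-dec_; _⊎-dec_; _→-dec_; ¬?)
open import Algebra.Properties.CommutativeMonoid.Sum +-0-commutativeMonoid
  using (sum; sum-cong-≗; ∑-distrib-+; ∑-comm)

-- Dropping the bit turns every local question into one about six classes. A vertex with at most one
-- coloured hard neighbour can always adapt its bit; with two it can, unless both show it the same
-- class and it takes the opposite one. So the extension lemmas are finite statements about classes
-- and signs, settled by enumeration.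
--
-- The obstacle is coincidence. The soft neighbour of a U-vertex may itself be open or recoloured,
-- so that the forbidden class is not known beforehand. Hence most configurations have a free and a
-- linked version; on U-vertices `soft` is a partial matching, which bounds the number of cases. A
-- path may also meet its own recent past: triangles, two threads between the same W-vertices, two
-- stars with crossed soft links, and chords each get their own colouring.
--
-- The weights come from 10 deg - 28, which is twice 5 deg - 14. A Z-vertex starts with -8 and takes
-- 4 along each of its two edges, which leaves 10h + 6s - 28 at a V-vertex.

-- Colours

-- The class of a colour i^α: the pair of the matching M containing i (a, b or c) together with the sign α.
-- Whether a 2-vertex can be coloured depends only on the classes of its neighbours.
data K : Set where
  a⁺ a⁻ b⁺ b⁻ c⁺ c⁻ : K

Colour : Set
Colour = K × Bool

cls : Colour → K
cls = proj₁

vertex : Colour → DSGVertex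
vertex (a⁺ , false) = f0 , plus
vertex (a⁺ , true)  = fs f0 , plus
vertex (a⁻ , false) = f0 , minus
vertex (a⁻ , true)  = fs f0 , minus
vertex (b⁺ , false) = fs (fs f0) , plus
vertex (b⁺ , true)  = fs (fs (fs f0)) , plus
vertex (b⁻ , false) = fs (fs f0) , minus
vertex (b⁻ , true)  = fs (fs (fs f0)) , minus
vertex (c⁺ , false) = fs (fs (fs (fs f0))) , plus
vertex (c⁺ , true)  = fs (fs (fs (fs (fs f0)))) , plus
vertex (c⁻ , false) = fs (fs (fs (fs f0))) , minus
vertex (c⁻ , true)  = fs (fs (fs (fs (fs f0)))) , minus

opp : K → K
opp a⁺ = a⁻
opp a⁻ = a⁺
opp b⁺ = b⁻
opp b⁻ = b⁺
opp c⁺ = c⁻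
opp c⁻ = c⁺

infixr 8 _·_
_·_ : Sign → K → K
plus  · k = k
minus · k = opp k

_⊗_ : Sign → Sign → Sign
plus  ⊗ t = t
minus ⊗ plus = minus
minus ⊗ minus = plus

neg : Sign → Sign
neg plus  = minus
neg minus = plus

eqK : K → K → Bool
eqK a⁺ a⁺ = true
eqK a⁻ a⁻ = true
eqK b⁺ b⁺ = true
eqK b⁻ b⁻ = true
eqK c⁺ c⁺ = true
eqK c⁻ c⁻ = true
eqK _ _ = false

-- Classes containing the ends of a positive edge of DSG(K₆,M); between a class and its opposite
-- the two colours must moreover have different bits.
hc⁺ : K → K → Bool
hc⁺ a⁺ a⁻ = true
hc⁺ a⁺ b⁺ = true
hc⁺ a⁺ c⁺ = true
hc⁺ a⁻ a⁺ = true
hc⁺ a⁻ b⁻ = true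
hc⁺ a⁻ c⁻ = true
hc⁺ b⁺ b⁻ = true
hc⁺ b⁺ a⁺ = true
hc⁺ b⁺ c⁺ = true
hc⁺ b⁻ b⁺ = true
hc⁺ b⁻ a⁻ = true
hc⁺ b⁻ c⁻ = true
hc⁺ c⁺ c⁻ = true
hc⁺ c⁺ a⁺ = true
hc⁺ c⁺ b⁺ = true
hc⁺ c⁻ c⁺ = true
hc⁺ c⁻ a⁻ = true
hc⁺ c⁻ b⁻ = true
hc⁺ _ _ = false

hc : Sign → K → K → Bool
hc s a b = hc⁺ a (s · b)

xorB : Bool → Bool → Bool
xorB true  y = not y
xorB false y = y

E⁺ : Colour → Colour → Bool
E⁺ (a , i) (b , j) = hc⁺ a b ∧ (not (eqK a (opp b)) ∨ xorB i j)

actC : Sign → Colour → Colour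
actC s (a , i) = (s · a , i)

E : Sign → Colour → Colour → Bool
E s α β = E⁺ α (actC s β)

-- A vertex with positive edges to any colours of classes a and b can get some colour of class k.
fits : K → K → K → Bool
fits a b k = hc⁺ k a ∧ hc⁺ k b ∧ not (eqK a b ∧ eqK k (opp a))

-- The class of the sign of a and b in the third pair, if a and b have the same sign and lie in different pairs:
-- then it is the only class that fits.
third : K → K → Maybe K
third a⁺ b⁺ = just c⁺
third b⁺ a⁺ = just c⁺
third a⁺ c⁺ = just b⁺
third c⁺ a⁺ = just b⁺
third b⁺ c⁺ = just a⁺
third c⁺ b⁺ = just a⁺
third a⁻ b⁻ = just c⁻
third b⁻ a⁻ = just c⁻
third a⁻ c⁻ = just b⁻
third c⁻ a⁻ = just b⁻
third b⁻ c⁻ = just a⁻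
third c⁻ b⁻ = just a⁻
third _ _ = nothing

isJust : Maybe K → K → Bool
isJust (just k) q = eqK k q
isJust nothing  q = false

-- Some class other than q fits a and b.
R0 : K → K → K → Bool
R0 a b q = not (eqK b (opp a)) ∧ not (isJust (third a b) q)


-- Deciding statements about classes, signs and bits by enumeration

by : ∀ {A : Set} (d : Dec A) → does d ≡ true → A
by (true because r) refl = invert r

is? : ∀ b → Dec (b ≡ true)
does  (is? b)     = b
proof (is? true)  = ofʸ refl
proof (is? false) = ofⁿ λ ()

eqK-refl : ∀ k → eqK k k ≡ true
eqK-refl a⁺ = refl
eqK-refl a⁻ = refl
eqK-refl b⁺ = refl
eqK-refl b⁻ = refl
eqK-refl c⁺ = refl
eqK-refl c⁻ = refl

eqK-sound : ∀ a b → eqK a b ≡ true → a ≡ b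
eqK-sound a⁺ a⁺ _ = refl
eqK-sound a⁻ a⁻ _ = refl
eqK-sound b⁺ b⁺ _ = refl
eqK-sound b⁻ b⁻ _ = refl
eqK-sound c⁺ c⁺ _ = refl
eqK-sound c⁻ c⁻ _ = refl

infix 4 _≟K_
_≟K_ : (a b : K) → Dec (a ≡ b)
a ≟K b = map′ (eqK-sound a b) (λ { refl → eqK-refl a }) (is? (eqK a b))

infix 4 _≢?_
_≢?_ : (a b : K) → Dec (a ≢ b)
a ≢? b = ¬? (a ≟K b)

allK? : {P : K → Set} → (∀ k → Dec (P k)) → Dec (∀ k → P k)
allK? d = map′ (λ { (pa , pb , pc , pd , pe , pf) → λ { a⁺ → pa ; a⁻ → pb ; b⁺ → pc ; b⁻ → pd ; c⁺ → pe ; c⁻ → pf } })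
               (λ f → f a⁺ , f a⁻ , f b⁺ , f b⁻ , f c⁺ , f c⁻)
               (d a⁺ ×-dec d a⁻ ×-dec d b⁺ ×-dec d b⁻ ×-dec d c⁺ ×-dec d c⁻)

anyK? : {P : K → Set} → (∀ k → Dec (P k)) → Dec (∃ P)
anyK? d = map′ (λ { (inj₁ p) → a⁺ , p ; (inj₂ (inj₁ p)) → a⁻ , p ; (inj₂ (inj₂ (inj₁ p))) → b⁺ , p
                  ; (inj₂ (inj₂ (inj₂ (inj₁ p)))) → b⁻ , p ; (inj₂ (inj₂ (inj₂ (inj₂ (inj₁ p))))) → c⁺ , p
                  ; (inj₂ (inj₂ (inj₂ (inj₂ (inj₂ p))))) → c⁻ , p })
               (λ { (a⁺ , p) → inj₁ p ; (a⁻ , p) → inj₂ (inj₁ p) ; (b⁺ , p) → inj₂ (inj₂ (inj₁ p))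
                  ; (b⁻ , p) → inj₂ (inj₂ (inj₂ (inj₁ p))) ; (c⁺ , p) → inj₂ (inj₂ (inj₂ (inj₂ (inj₁ p))))
                  ; (c⁻ , p) → inj₂ (inj₂ (inj₂ (inj₂ (inj₂ p)))) })
               (d a⁺ ⊎-dec d a⁻ ⊎-dec d b⁺ ⊎-dec d b⁻ ⊎-dec d c⁺ ⊎-dec d c⁻)

allS? : {P : Sign → Set} → (∀ s → Dec (P s)) → Dec (∀ s → P s)
allS? d = map′ (λ { (p , m) → λ { plus → p ; minus → m } }) (λ f → f plus , f minus) (d plus ×-dec d minus)

allB? : {P : Bool → Set} → (∀ i → Dec (P i)) → Dec (∀ i → P i)
allB? d = map′ (λ { (p , m) → λ { true → p ; false → m } }) (λ f → f true , f false) (d true ×-dec d false)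

anyB? : {P : Bool → Set} → (∀ i → Dec (P i)) → Dec (∃ P)
anyB? d = map′ (λ { (inj₁ p) → true , p ; (inj₂ p) → false , p }) (λ { (true , p) → inj₁ p ; (false , p) → inj₂ p })
               (d true ⊎-dec d false)

abstract
  opp-invol : ∀ k → opp (opp k) ≡ k
  opp-invol = by (allK? λ k → opp (opp k) ≟K k) refl

·-invol : ∀ s k → s · s · k ≡ k
·-invol plus  k = refl
·-invol minus k = opp-invol k

·-inj : ∀ s {k l} → s · k ≡ s · l → k ≡ l
·-inj s {k} {l} p = trans (sym (·-invol s k)) (trans (cong (s ·_) p) (·-invol s l))

·-≢ : ∀ s {k l} → k ≢ l → s · k ≢ s · l
·-≢ s p q = p (·-inj s q)

⊗-act : ∀ s t k → (s ⊗ t) · k ≡ s · t · k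
⊗-act plus  t     k = refl
⊗-act minus plus  k = refl
⊗-act minus minus k = sym (opp-invol k)

⊗-comm : ∀ s t → s ⊗ t ≡ t ⊗ s
⊗-comm plus  plus  = refl
⊗-comm plus  minus = refl
⊗-comm minus plus  = refl
⊗-comm minus minus = refl

-- Classes left to a vertex with two coloured hard neighbours

Free : K → K → K → Set
Free a b k = fits a b k ≡ true

Avail : K → K → K → Set
Avail a b q = ∃ λ k → fits a b k ≡ true × k ≢ q

-- Two vertices with a common 2-neighbour can be coloured compatibly; e is the sign in the constraint of that 2-vertex.
Pairs : K → K → K → K → Sign → Set
Pairs a b a' b' e = ∃ λ k → fits a b k ≡ true × ∃ λ k' → fits a' b' k' ≡ true × k ≢ e · k'

Pairs? : ∀ a b a' b' e → Dec (Pairs a b a' b' e)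
Pairs? a b a' b' e = anyK? λ k → is? (fits a b k) ×-dec anyK? λ k' → is? (fits a' b' k') ×-dec k ≢? e · k'

R : K → K → K → Set
R a b q = R0 a b q ≡ true

R? : ∀ a b q → Dec (R a b q)
R? a b q = is? (R0 a b q)

H : K → K → Set
H a b = hc⁺ a b ≡ true

H? : ∀ a b → Dec (H a b)
H? a b = is? (hc⁺ a b)

Two : (K → Set) → Set
Two P = ∃ λ y → P y × ∃ λ y' → P y' × y ≢ y'

Two? : {P : K → Set} → (∀ k → Dec (P k)) → Dec (Two P)
Two? d = anyK? λ y → d y ×-dec anyK? λ y' → d y' ×-dec y ≢? y'

avoid : ∀ {P} → Two P → ∀ r → ∃ λ y → P y × y ≢ r
avoid (y , py , y' , py' , ne) r with y ≟K r
... | yes refl = y' , py' , λ e → ne (sym e)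
... | no p = y , py , p

abstract
  -- Nothing fits if `b` is `opp a`; only the third pair fits for equal signs in different pairs; in
  -- all other cases two classes fit, so one of them differs from `q`.
  R-avail : ∀ a b q → R a b q → Avail a b q
  R-avail = by (allK? λ a → allK? λ b → allK? λ q → R? a b q →-dec anyK? λ k → is? (fits a b k) ×-dec k ≢? q) refl

abstract
  -- Acting by one sign on all three arguments preserves `fits`, and acting twice is the identity.
  -- So a sign at one neighbour can be traded for signs at the other neighbour and at the vertex.
  fits-shift : ∀ r a b k → fits (r · a) b k ≡ true → fits a (r · b) (r · k) ≡ true
  fits-shift = by (allS? λ r → allK? λ a → allK? λ b → allK? λ k → is? (fits (r · a) b k) →-dec is? (fits a (r · b) (r · k))) refl

abstract
  -- A neighbour constrains the bit only if `k` is opposite to its class. Two neighbours do so at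
  -- once only if they share this class, and `fits` rules that out.
  colour-fits : ∀ a i b j k → fits a b k ≡ true → ∃ λ l → E⁺ (k , l) (a , i) ≡ true × E⁺ (k , l) (b , j) ≡ true
  colour-fits = by (allK? λ a → allB? λ i → allK? λ b → allB? λ j → allK? λ k → is? (fits a b k) →-dec
    anyB? λ l → is? (E⁺ (k , l) (a , i)) ×-dec is? (E⁺ (k , l) (b , j))) refl

abstract
  colour-H : ∀ a i k → H k a → ∃ λ l → E⁺ (k , l) (a , i) ≡ true
  colour-H = by (allK? λ a → allB? λ i → allK? λ k → H? k a →-dec anyB? λ l → is? (E⁺ (k , l) (a , i))) refl

abstract
  E-sym′ : ∀ s a i b j → E s (a , i) (b , j) ≡ true → E s (b , j) (a , i) ≡ true
  E-sym′ = by (allS? λ s → allK? λ a → allB? λ i → allK? λ b → allB? λ j →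
    is? (E s (a , i) (b , j)) →-dec is? (E s (b , j) (a , i))) refl

E-sym : ∀ s α β → E s α β ≡ true → E s β α ≡ true
E-sym s (a , i) (b , j) = E-sym′ s a i b j

eqSign : Sign → Maybe Sign → Bool
eqSign plus  (just plus)  = true
eqSign minus (just minus) = true
eqSign _     _            = false

eqSign-sound : ∀ s m → eqSign s m ≡ true → m ≡ just s
eqSign-sound plus  (just plus)  _ = refl
eqSign-sound minus (just minus) _ = refl

abstract
  E-vertex′ : ∀ s a i b j → E s (a , i) (b , j) ≡ true → eqSign s (dsgSign (vertex (a , i)) (vertex (b , j))) ≡ true
  E-vertex′ = by (allS? λ s → allK? λ a → allB? λ i → allK? λ b → allB? λ j →
    is? (E s (a , i) (b , j)) →-dec is? (eqSign s (dsgSign (vertex (a , i)) (vertex (b , j))))) refl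

E-vertex : ∀ s α β → E s α β ≡ true → dsgSign (vertex α) (vertex β) ≡ just s
E-vertex s (a , i) (b , j) p = eqSign-sound s _ (E-vertex′ s a i b j p)

-- The class neg (s ⊗ t) · cls α is the one that a 2-vertex adjacent to α forbids at its other neighbour.
abstract
  two-class : ∀ s t a b → b ≢ neg (s ⊗ t) · a → ∃ λ k → fits (s · a) (t · b) k ≡ true
  two-class = by (allS? λ s → allS? λ t → allK? λ a → allK? λ b →
    (b ≢? neg (s ⊗ t) · a) →-dec anyK? λ k → is? (fits (s · a) (t · b) k)) refl

two-colour : ∀ s t α β → cls β ≢ neg (s ⊗ t) · cls α → ∃ λ γ → E s γ α ≡ true × E t γ β ≡ true
two-colour s t (a , i) (b , j) p with two-class s t a b p
... | k , g with colour-fits (s · a) i (t · b) j k g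
... | l , e , e' = (k , l) , e , e'

abstract
  colour-two′ : ∀ s t a i b j c l → E s (c , l) (a , i) ≡ true → E t (c , l) (b , j) ≡ true → b ≢ neg (s ⊗ t) · a
  colour-two′ = by (allS? λ s → allS? λ t → allK? λ a → allB? λ i → allK? λ b → allB? λ j → allK? λ c → allB? λ l →
    is? (E s (c , l) (a , i)) →-dec is? (E t (c , l) (b , j)) →-dec b ≢? neg (s ⊗ t) · a) refl

colour-two : ∀ s t α β γ → E s γ α ≡ true → E t γ β ≡ true → cls β ≢ neg (s ⊗ t) · cls α
colour-two s t (a , i) (b , j) (c , l) = colour-two′ s t a i b j c l

-- Signs on the common arguments can be moved to the other arguments, because fits commutes with the sign action.
Pairs-shift : ∀ s t s' t' e F x F' y → Pairs ((s ⊗ t) · F) x ((s' ⊗ t') · F') y ((s ⊗ t) ⊗ (e ⊗ (s' ⊗ t'))) →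
  Pairs F (s · t · x) F' (s' · t' · y) e
Pairs-shift s t s' t' e F x F' y (k , g , k' , g' , ne) =
  (s ⊗ t) · k , subst (λ z → Free F z ((s ⊗ t) · k)) (⊗-act s t x) (fits-shift (s ⊗ t) F x k g) ,
  (s' ⊗ t') · k' , subst (λ z → Free F' z ((s' ⊗ t') · k')) (⊗-act s' t' y) (fits-shift (s' ⊗ t') F' y k' g') ,
  λ q → ne (trans (sym (·-invol (s ⊗ t) k)) (trans (cong ((s ⊗ t) ·_) q)
          (sym (trans (⊗-act (s ⊗ t) (e ⊗ (s' ⊗ t')) k') (cong ((s ⊗ t) ·_) (⊗-act e (s' ⊗ t') k'))))))

pattern z0 = here refl
pattern z1 = there z0
pattern z2 = there z1
pattern z3 = there z2
pattern z4 = there z3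
pattern z5 = there z4
pattern z6 = there z5

abstract
  H-irrefl : ∀ x c → H x c → x ≢ c
  H-irrefl = by (allK? λ x → allK? λ c → H? x c →-dec x ≢? c) refl

abstract
  -- When the soft neighbour is the far end itself, the forbidden class lies in the pair of `x`,
  -- while `third` always lies in a pair different from those of its arguments. Only the opposite
  -- class is lost.
  loose-p : ∀ x s e z → z ≢ opp (s · x) → R (s · x) z (e · x)
  loose-p = by (allK? λ x → allS? λ s → allS? λ e → allK? λ z → (z ≢? opp (s · x)) →-dec R? (s · x) z (e · x)) refl

-- Local extension lemmas for classes, checked exhaustively

abstract
  -- For fixed `q`, at most one class `x` excludes two of the three classes compatible with `c`; so
  -- one of `x` and `x'` leaves two of them.
  step-class : ∀ x x' c q t → x ≢ x' →
    Two (λ y → H y c × R x (t · y) q) ⊎ Two (λ y → H y c × R x' (t · y) q)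
  step-class = by (allK? λ x → allK? λ x' → allK? λ c → allK? λ q → allS? λ t → (x ≢? x') →-dec
    ((Two? λ y → H? y c ×-dec R? x (t · y) q) ⊎-dec (Two? λ y → H? y c ×-dec R? x' (t · y) q))) refl

abstract
  step-class-p : ∀ x c s t e → Two (λ y → H y c × R (s · x) (t · y) (e · x))
  step-class-p = by (allK? λ x → allK? λ c → allS? λ s → allS? λ t → allS? λ e →
    Two? λ y → H? y c ×-dec R? (s · x) (t · y) (e · x)) refl

abstract
  -- Here the soft neighbour is the vertex of class `y`. The forbidden class lies in the pair of
  -- `y`, again out of reach of `third`.
  step-class-w : ∀ x c s t e → Two (λ y → H y c × R (s · x) (t · y) (e · y))
  step-class-w = by (allK? λ x → allK? λ c → allS? λ s → allS? λ t → allS? λ e →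
    Two? λ y → H? y c ×-dec R? (s · x) (t · y) (e · y)) refl

abstract
  -- For fixed `q` only two classes exclude a second value besides their opposite, and the two sets
  -- they exclude are disjoint. If `y` is excluded by both `x` and `x'`, then one of them excludes
  -- nothing else.
  exchange : ∀ x x' y q → x ≢ x' →
    R x y q ⊎ R x' y q ⊎ (∀ w → w ≢ y → R x w q) ⊎ (∀ w → w ≢ y → R x' w q)
  exchange = by (allK? λ x → allK? λ x' → allK? λ y → allK? λ q → (x ≢? x') →-dec
    (R? x y q ⊎-dec R? x' y q ⊎-dec (allK? λ w → (w ≢? y) →-dec R? x w q) ⊎-dec (allK? λ w → (w ≢? y) →-dec R? x' w q))) refl

abstract
  -- Of six classes, `f` excludes its opposite and at most one more for each of `q` and `q'`, and
  -- `g` excludes at most two: five in all.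
  common : ∀ f g q q' r t t' → ∃ λ y → R f (t · y) q × R f (t · y) q' × R g (t' · y) r
  common = by (allK? λ f → allK? λ g → allK? λ q → allK? λ q' → allK? λ r → allS? λ t → allS? λ t' →
    anyK? λ y → R? f (t · y) q ×-dec R? f (t · y) q' ×-dec R? g (t' · y) r) refl

abstract
  two-free : ∀ f g q r t t' → Two (λ y → R f (t · y) q × R g (t' · y) r)
  two-free = by (allK? λ f → allK? λ g → allK? λ q → allK? λ r → allS? λ t → allS? λ t' →
    Two? λ y → R? f (t · y) q ×-dec R? g (t' · y) r) refl

abstract
  -- A class fails if it gives the opposite of `f` or of `g`, or if a single class fits on either
  -- side and these clash. A single class fits beside `f` for only two values, so at most four of
  -- six fail.
  two-linked : ∀ f g t t' e → Two (λ y → Pairs f (t · y) g (t' · y) e)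
  two-linked = by (allK? λ f → allK? λ g → allS? λ t → allS? λ t' → allS? λ e →
    Two? λ y → Pairs? f (t · y) g (t' · y) e) refl

abstract
  linked-three : ∀ x f g q t t' t'' e → ∃ λ y → Pairs x (t · y) f (t' · y) e × R g (t'' · y) q
  linked-three = by (allK? λ x → allK? λ f → allK? λ g → allK? λ q → allS? λ t → allS? λ t' → allS? λ t'' → allS? λ e →
    anyK? λ y → Pairs? x (t · y) f (t' · y) e ×-dec R? g (t'' · y) q) refl

abstract
  linked-step : ∀ x x' c f t t' e → x ≢ x' →
    (∃ λ y → H y c × Pairs x (t · y) f (t' · y) e) ⊎ (∃ λ y → H y c × Pairs x' (t · y) f (t' · y) e)
  linked-step = by (allK? λ x → allK? λ x' → allK? λ c → allK? λ f → allS? λ t → allS? λ t' → allS? λ e → (x ≢? x') →-dec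
    ((anyK? λ y → H? y c ×-dec Pairs? x (t · y) f (t' · y) e) ⊎-dec (anyK? λ y → H? y c ×-dec Pairs? x' (t · y) f (t' · y) e))) refl

abstract
  chord : ∀ a q r σ t s s' → ∃ λ x → R a (t · x) q × Two (λ y → H y (σ · x) × R (s · x) (s' · y) r)
  chord = by (allK? λ a → allK? λ q → allK? λ r → allS? λ σ → allS? λ t → allS? λ s → allS? λ s' →
    anyK? λ x → R? a (t · x) q ×-dec Two? λ y → H? y (σ · x) ×-dec R? (s · x) (s' · y) r) refl

abstract
  chord-linked : ∀ a q f σ t s s' t' e →
    ∃ λ x → R a (t · x) q × ∃ λ y → H y (σ · x) × Pairs (s · x) (s' · y) f (t' · y) e
  chord-linked = by (allK? λ a → allK? λ q → allK? λ f → allS? λ σ → allS? λ t → allS? λ s → allS? λ s' → allS? λ t' → allS? λ e →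
    anyK? λ x → R? a (t · x) q ×-dec anyK? λ y → H? y (σ · x) ×-dec Pairs? (s · x) (s' · y) f (t' · y) e) refl

-- Choose `y` so that `t · y` loses only its opposite to `r`. The classes compatible with `c` lie in
-- three different pairs, and both opposites to be avoided lie in the pair of `y`, so together they
-- cost one class; `r'` costs at most one more. The quantifier on `r'` comes after `y` because it
-- may depend on a vertex coloured in between.
double : ∀ f q r c s t u v w → ∃ λ y → R f (s · y) q × (∀ r' → ∃ λ x → H x c × R (t · y) (u · x) r × R (v · y) (w · x) r')
double = λ f q r c s t u v w → let y , p , f = double-y f q r s t in y , p , λ r' → double-x y r r' c t u v w f
  where
  Loose : K → K → Set
  Loose y r = ∀ z → z ≢ opp y → R y z r
  Loose? : ∀ y r → Dec (Loose y r)
  Loose? y r = allK? λ z → (z ≢? opp y) →-dec R? y z r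
  abstract
    double-y : ∀ f q r s t → ∃ λ y → R f (s · y) q × Loose (t · y) r
    double-y = by (allK? λ f → allK? λ q → allK? λ r → allS? λ s → allS? λ t →
      anyK? λ y → R? f (s · y) q ×-dec Loose? (t · y) r) refl
    double-x : ∀ y r r' c t u v w → Loose (t · y) r → ∃ λ x → H x c × R (t · y) (u · x) r × R (v · y) (w · x) r'
    double-x = by (allK? λ y → allK? λ r → allK? λ r' → allK? λ c → allS? λ t → allS? λ u → allS? λ v → allS? λ w →
      Loose? (t · y) r →-dec anyK? λ x → H? x c ×-dec R? (t · y) (u · x) r ×-dec R? (v · y) (w · x) r') refl

abstract
  double-linked : ∀ f q c e s t u v w → ∃ λ y → R f (s · y) q × ∃ λ x → H x c × Pairs (t · y) (u · x) (v · y) (w · x) e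
  double-linked = by (allK? λ f → allK? λ q → allK? λ c → allS? λ e → allS? λ s → allS? λ t → allS? λ u → allS? λ v → allS? λ w →
    anyK? λ y → R? f (s · y) q ×-dec anyK? λ x → H? x c ×-dec Pairs? (t · y) (u · x) (v · y) (w · x) e) refl

abstract
  triple : ∀ q q' q'' s t u v w z →
    ∃ λ y → ∃ λ x → R (s · y) (t · x) q × R (u · y) (v · x) q' × R (w · y) (z · x) q''
  triple = by (allK? λ q → allK? λ q' → allK? λ q'' → allS? λ s → allS? λ t → allS? λ u → allS? λ v → allS? λ w → allS? λ z →
    anyK? λ y → anyK? λ x → R? (s · y) (t · x) q ×-dec R? (u · y) (v · x) q' ×-dec R? (w · y) (z · x) q'') refl

abstract
  triple-linked : ∀ q e s t u v w z →
    ∃ λ y → ∃ λ x → R (s · y) (t · x) q × Pairs (u · y) (v · x) (w · y) (z · x) e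
  triple-linked = by (allK? λ q → allS? λ e → allS? λ s → allS? λ t → allS? λ u → allS? λ v → allS? λ w → allS? λ z →
    anyK? λ y → anyK? λ x → R? (s · y) (t · x) q ×-dec Pairs? (u · y) (v · x) (w · y) (z · x) e) refl

abstract
  cross : ∀ q f g f' g' e e' → ∃ λ x → ∃ λ y → R x y q × Pairs f x f' y e × Pairs g x g' y e'
  cross = by (allK? λ q → allK? λ f → allK? λ g → allK? λ f' → allK? λ g' → allS? λ e → allS? λ e' →
    anyK? λ x → anyK? λ y → R? x y q ×-dec Pairs? f x f' y e ×-dec Pairs? g x g' y e') refl

abstract
  triangle : ∀ c q r σ s s' → ∃ λ x → H x c × ∃ λ k → H k (s · x) × k ≢ q × ∃ λ k' → fits (s' · x) (σ · k) k' ≡ true × k' ≢ r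
  triangle = by (allK? λ c → allK? λ q → allK? λ r → allS? λ σ → allS? λ s → allS? λ s' →
    anyK? λ x → H? x c ×-dec anyK? λ k → H? k (s · x) ×-dec k ≢? q ×-dec anyK? λ k' → is? (fits (s' · x) (σ · k) k') ×-dec k' ≢? r) refl

abstract
  triangle-linked : ∀ c e σ s s' → ∃ λ x → H x c × ∃ λ k → H k (s · x) × ∃ λ k' → fits (s' · x) (σ · k) k' ≡ true × k' ≢ e · k
  triangle-linked = by (allK? λ c → allS? λ e → allS? λ σ → allS? λ s → allS? λ s' →
    anyK? λ x → H? x c ×-dec anyK? λ k → H? k (s · x) ×-dec anyK? λ k' → is? (fits (s' · x) (σ · k) k') ×-dec k' ≢? e · k) refl

abstract
  triangle-apex : ∀ c e r σ s s' → ∃ λ x → H x c × ∃ λ k → H k (s · x) × k ≢ e · x × ∃ λ k' → fits (s' · x) (σ · k) k' ≡ true × k' ≢ r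
  triangle-apex = by (allK? λ c → allS? λ e → allK? λ r → allS? λ σ → allS? λ s → allS? λ s' →
    anyK? λ x → H? x c ×-dec anyK? λ k → H? k (s · x) ×-dec k ≢? e · x ×-dec anyK? λ k' → is? (fits (s' · x) (σ · k) k') ×-dec k' ≢? r) refl

abstract
  -- At least two classes `x` survive `r`. The three classes compatible with `σ · x` determine `x`,
  -- so three forbidden classes cannot exhaust the triples of both.
  three-two : ∀ c r σ q q' q'' → ∃ λ x → (H x c × x ≢ r) × ∃ λ k → H k (σ · x) × k ≢ q × k ≢ q' × k ≢ q''
  three-two = by (allK? λ c → allK? λ r → allS? λ σ → allK? λ q → allK? λ q' → allK? λ q'' →
    anyK? λ x → (H? x c ×-dec x ≢? r) ×-dec anyK? λ k → H? k (σ · x) ×-dec k ≢? q ×-dec k ≢? q' ×-dec k ≢? q'') refl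

abstract
  three-two-linked : ∀ c r σ e q' q'' → ∃ λ x → (H x c × x ≢ r) × ∃ λ k → H k (σ · x) × k ≢ e · x × k ≢ q' × k ≢ q''
  three-two-linked = by (allK? λ c → allK? λ r → allS? λ σ → allS? λ e → allK? λ q' → allK? λ q'' →
    anyK? λ x → (H? x c ×-dec x ≢? r) ×-dec anyK? λ k → H? k (σ · x) ×-dec k ≢? e · x ×-dec k ≢? q' ×-dec k ≢? q'') refl

abstract
  two-hard : ∀ c q → Two (λ y → H y c × y ≢ q)
  two-hard = by (allK? λ c → allK? λ q → Two? λ y → H? y c ×-dec y ≢? q) refl

abstract
  one-hard : ∀ c q r → ∃ λ y → H y c × y ≢ q × y ≢ r
  one-hard = by (allK? λ c → allK? λ q → allK? λ r → anyK? λ y → H? y c ×-dec y ≢? q ×-dec y ≢? r) refl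

abstract
  four-soft : ∀ (q r s t : K) → ∃ λ y → y ≢ q × y ≢ r × y ≢ s × y ≢ t
  four-soft = by (allK? λ q → allK? λ r → allK? λ s → allK? λ t → anyK? λ y → y ≢? q ×-dec y ≢? r ×-dec y ≢? s ×-dec y ≢? t) refl

abstract
  two-path : ∀ a b σ → ∃ λ k → H k a × ∃ λ k' → fits (σ · k) b k' ≡ true
  two-path = by (allK? λ a → allK? λ b → allS? λ σ → anyK? λ k → H? k a ×-dec anyK? λ k' → is? (fits (σ · k) b k')) refl
  

-- Counting in Fin n

b2n : Bool → ℕ
b2n true  = 1
b2n false = 0

# : ∀ {n} → (Fin n → Bool) → ℕ
# p = sum (λ i → b2n (p i))

t≢f : ∀ {b} → b ≡ true → b ≡ false → ⊥
t≢f refl ()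

∧₁ : ∀ {x y} → x ∧ y ≡ true → x ≡ true
∧₁ {true} {true} _ = refl

∧₂ : ∀ {x y} → x ∧ y ≡ true → y ≡ true
∧₂ {true} {true} _ = refl

∧ᵢ : ∀ {x y} → x ≡ true → y ≡ true → x ∧ y ≡ true
∧ᵢ refl refl = refl

not-true : ∀ {b} → not b ≡ true → b ≡ false
not-true {false} _ = refl

infix 5 _==_
_==_ : ∀ {n} → Fin n → Fin n → Bool
i == j = does (i ≟ j)

==-refl : ∀ {n} (i : Fin n) → (i == i) ≡ true
==-refl i with i ≟ i
... | yes _ = refl
... | no p  = ⊥-elim (p refl)

==-sound : ∀ {n} {i j : Fin n} → (i == j) ≡ true → i ≡ j
==-sound {i = i} {j} p with i ≟ j
... | yes q = q

≢-== : ∀ {n} {i j : Fin n} → i ≢ j → not (i == j) ≡ true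
≢-== {i = i} {j} p with i ≟ j
... | yes q = ⊥-elim (p q)
... | no _  = refl

==-≢ : ∀ {n} {i j : Fin n} → not (i == j) ≡ true → i ≢ j
==-≢ {i = i} p refl with i ≟ i
==-≢ () refl | yes _
... | no q = q refl

length-filter-tabulate : ∀ {A : Set} {n} (p : A → Bool) (f : Fin n → A) → length (filterᵇ p (tabulate f)) ≡ # (p ∘ f)
length-filter-tabulate {n = zero}  p f = refl
length-filter-tabulate {n = suc n} p f with p (f f0)
... | true  = cong suc (length-filter-tabulate p (f ∘ fs))
... | false = length-filter-tabulate p (f ∘ fs)

count-# : ∀ {n} (p : Fin n → Bool) → count p ≡ # p
count-# p = length-filter-tabulate p id

sumL-tabulate : ∀ {n} (f : Fin n → ℕ) → sumL (tabulate f) ≡ sum f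
sumL-tabulate {zero}  f = refl
sumL-tabulate {suc n} f = cong (f f0 +_) (sumL-tabulate (f ∘ fs))

sumL-allFin : ∀ {n} (f : Fin n → ℕ) → sumL (map f (allFin n)) ≡ sum f
sumL-allFin f = trans (cong sumL (map-tabulate id f)) (sumL-tabulate f)

sum-mono : ∀ {n} {f g : Fin n → ℕ} → (∀ i → f i ≤ g i) → sum f ≤ sum g
sum-mono {zero}  h = z≤n
sum-mono {suc n} h = +-mono-≤ (h f0) (sum-mono (h ∘ fs))

sum-mono-≡ : ∀ {n} {f g : Fin n → ℕ} → (∀ i → f i ≤ g i) → sum f ≡ sum g → ∀ i → f i ≡ g i
sum-mono-≡ {suc n} {f} {g} h e = go
  where
  p : f f0 ≡ g f0
  p = ≤-antisym (h f0) (+-cancelʳ-≤ (sum (f ∘ fs)) _ _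
        (≤-trans (+-monoʳ-≤ (g f0) (sum-mono (h ∘ fs))) (≤-reflexive (sym e))))
  go : ∀ i → f i ≡ g i
  go f0     = p
  go (fs i) = sum-mono-≡ (h ∘ fs) (+-cancelˡ-≡ (f f0) _ _ (trans e (cong (_+ sum (g ∘ fs)) (sym p)))) i

sum-zero : ∀ n → sum {n} (λ _ → 0) ≡ 0
sum-zero zero    = refl
sum-zero (suc n) = sum-zero n

sum-*ˡ : ∀ {n} c (f : Fin n → ℕ) → sum (λ i → c * f i) ≡ c * sum f
sum-*ˡ {zero}  c f = sym (*-zeroʳ c)
sum-*ˡ {suc n} c f = trans (cong (c * f f0 +_) (sum-*ˡ c (f ∘ fs))) (sym (*-distribˡ-+ c (f f0) (sum (f ∘ fs))))

b2n≤1 : ∀ b → b2n b ≤ 1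
b2n≤1 true  = ≤-refl
b2n≤1 false = z≤n

#≤n : ∀ {n} (p : Fin n → Bool) → # p ≤ n
#≤n {zero}  p = z≤n
#≤n {suc n} p = +-mono-≤ (b2n≤1 (p f0)) (#≤n (p ∘ fs))

opaque
  _∖_ : ∀ {n} → (Fin n → Bool) → Fin n → Fin n → Bool
  (p ∖ i) j = p j ∧ not (j == i)

  ∖-self : ∀ {n} (p : Fin n → Bool) i → (p ∖ i) i ≡ false
  ∖-self p i rewrite ==-refl i = ∧-zeroʳ (p i)

  ∖-other : ∀ {n} (p : Fin n → Bool) {i j} → j ≢ i → (p ∖ i) j ≡ p j
  ∖-other p {i} {j} q rewrite ≢-== q = ∧-identityʳ (p j)

  ∖-in : ∀ {n} {p : Fin n → Bool} {i j} → (p ∖ i) j ≡ true → p j ≡ true × j ≢ i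
  ∖-in {p = p} {i} {j} h = ∧₁ {p j} h , ==-≢ (∧₂ {p j} h)

  in-∖ : ∀ {n} {p : Fin n → Bool} {i j} → p j ≡ true → j ≢ i → (p ∖ i) j ≡ true
  in-∖ {p = p} {i} {j} h q = ∧ᵢ {p j} h (≢-== q)

sum-extract : ∀ {n} (f g : Fin n → ℕ) i → g i ≡ 0 → (∀ j → j ≢ i → f j ≡ g j) → sum f ≡ f i + sum g
sum-extract f g f0 z h =
  cong (f f0 +_) (trans (sum-cong-≗ (λ j → h (fs j) λ ())) (cong (_+ sum (g ∘ fs)) (sym z)))
sum-extract f g (fs i) z h = begin
  f f0 + sum (f ∘ fs)              ≡⟨ cong₂ _+_ (h f0 λ ()) (sum-extract (f ∘ fs) (g ∘ fs) i z (λ j p → h (fs j) λ { refl → p refl })) ⟩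
  g f0 + (f (fs i) + sum (g ∘ fs)) ≡⟨ sym (+-assoc (g f0) _ _) ⟩
  g f0 + f (fs i) + sum (g ∘ fs)   ≡⟨ cong (_+ sum (g ∘ fs)) (+-comm (g f0) _) ⟩
  f (fs i) + g f0 + sum (g ∘ fs)   ≡⟨ +-assoc (f (fs i)) _ _ ⟩
  f (fs i) + (g f0 + sum (g ∘ fs)) ∎
  where open ≡-Reasoning

One : ∀ {n} → (Fin n → Bool) → Fin n → Set
One p i = p i ≡ true × (∀ j → p j ≡ true → j ≡ i)

Duo : ∀ {n} → (Fin n → Bool) → Fin n → Fin n → Set
Duo p i j = p i ≡ true × p j ≡ true × i ≢ j × (∀ k → p k ≡ true → k ≡ i ⊎ k ≡ j)

Trio : ∀ {n} → (Fin n → Bool) → Fin n → Fin n → Fin n → Set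
Trio p i j k = p i ≡ true × p j ≡ true × p k ≡ true × i ≢ j × i ≢ k × j ≢ k × (∀ l → p l ≡ true → l ≡ i ⊎ l ≡ j ⊎ l ≡ k)

infix 4 _≟′_
_≟′_ : ∀ {n} (i j : Fin n) → i ≡ j ⊎ i ≢ j
i ≟′ j with i ≟ j
... | yes p = inj₁ p
... | no p  = inj₂ p

opaque
  #-remove : ∀ {n} (p : Fin n → Bool) i → p i ≡ true → # p ≡ suc (# (p ∖ i))
  #-remove p i e = trans
    (sum-extract (λ j → b2n (p j)) (λ j → b2n ((p ∖ i) j)) i (cong b2n (∖-self p i)) (λ j q → cong b2n (sym (∖-other p q))))
    (cong (λ b → b2n b + # (p ∖ i)) e)

  #-zero : ∀ {n} (p : Fin n → Bool) → # p ≡ 0 → ∀ i → p i ≡ true → ⊥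
  #-zero p e i q with () ← trans (sym e) (#-remove p i q)

  #-pos : ∀ {n} (p : Fin n → Bool) {k} → # p ≡ suc k → ∃ λ i → p i ≡ true × # (p ∖ i) ≡ k
  #-pos p {k} e = let i , q = pick p e in i , q , suc-injective (trans (sym (#-remove p i q)) e)
    where
    pick : ∀ {n k} (p : Fin n → Bool) → # p ≡ suc k → ∃ λ i → p i ≡ true
    pick {suc n} p e with p f0 in eq
    ... | true  = f0 , eq
    ... | false = let i , q = pick (p ∘ fs) e in fs i , q

  #-one : ∀ {n} (p : Fin n → Bool) → # p ≡ 1 → ∃ λ i → One p i
  #-one p e with #-pos p e
  ... | i , q , r = i , q , λ j s → case j s
    where
    case : ∀ j → p j ≡ true → j ≡ i
    case j s with j ≟′ i
    ... | inj₁ t = t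
    ... | inj₂ t = ⊥-elim (#-zero _ r j (in-∖ {p = p} s t))

  #-two : ∀ {n} (p : Fin n → Bool) → # p ≡ 2 → ∃₂ λ i j → Duo p i j
  #-two p e with #-pos p e
  ... | i , q , r with #-one _ r
  ... | j , s , h = i , j , q , proj₁ (∖-in {p = p} s) , (λ t → proj₂ (∖-in {p = p} s) (sym t)) , case
    where
    case : ∀ k → p k ≡ true → k ≡ i ⊎ k ≡ j
    case k s with k ≟′ i
    ... | inj₁ t = inj₁ t
    ... | inj₂ t = inj₂ (h k (in-∖ {p = p} s t))

  #-three : ∀ {n} (p : Fin n → Bool) → # p ≡ 3 → ∃₂ λ i j → ∃ λ k → Trio p i j k
  #-three p e with #-pos p e
  ... | i , q , r with #-two _ r
  ... | j , k , s , t , u , h = i , j , k , q , proj₁ (∖-in {p = p} s) , proj₁ (∖-in {p = p} t) , (λ t → proj₂ (∖-in {p = p} s) (sym t))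
      , (λ e → proj₂ (∖-in {p = p} t) (sym e)) , u , case
    where
    case : ∀ l → p l ≡ true → l ≡ i ⊎ l ≡ j ⊎ l ≡ k
    case l s with l ≟′ i
    ... | inj₁ t = inj₁ t
    ... | inj₂ t = inj₂ (h l (in-∖ {p = p} s t))

  -- A junk index when no index satisfies p.
  find : ∀ {n} → (Fin n → Bool) → Fin n → Fin n
  find {suc n} p d with p f0
  ... | true = f0
  find {suc (suc n)} p d | false = fs (find (p ∘ fs) f0)
  find {suc zero}    p d | false = d

  find-sound : ∀ {n} (p : Fin n → Bool) d i → p i ≡ true → p (find p d) ≡ true
  find-sound {suc n} p d i q with p f0 in eq
  ... | true = eq
  find-sound {suc zero}    p d f0     q | false = ⊥-elim (t≢f q eq)
  find-sound {suc (suc n)} p d f0     q | false = ⊥-elim (t≢f q eq)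
  find-sound {suc (suc n)} p d (fs i) q | false = find-sound (p ∘ fs) f0 i q

-- Increasing sequences of relations on a finite set

module _ {n} (D : ℕ → Fin n → Fin n → Bool) (mono : ∀ k u w → D k u w ≡ true → D (suc k) u w ≡ true) where

  private
    size : ℕ → ℕ
    size k = sum λ u → # (D k u)

    le : ∀ {b c} → (b ≡ true → c ≡ true) → b2n b ≤ b2n c
    le {true}  h rewrite h refl = ≤-refl
    le {false} h = z≤n

    b2n-inj : ∀ {b c} → b2n b ≡ b2n c → b ≡ c
    b2n-inj {true}  {true}  _ = refl
    b2n-inj {false} {false} _ = refl

    row : ∀ k u → # (D k u) ≤ # (D (suc k) u)
    row k u = sum-mono λ w → le (mono k u w)

    size≤ : ∀ k → size k ≤ n * n
    size≤ k = bound (λ u → # (D k u)) n (λ u → #≤n (D k u))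
      where
      bound : ∀ {m} (f : Fin m → ℕ) c → (∀ i → f i ≤ c) → sum f ≤ m * c
      bound {zero}  f c h = z≤n
      bound {suc m} f c h = +-mono-≤ (h f0) (bound (f ∘ fs) c (h ∘ fs))

    go : ∀ fuel k → n * n < fuel + size k → ∃ λ k → ∀ u w → D (suc k) u w ≡ D k u w
    go zero k h = ⊥-elim (<⇒≱ h (size≤ k))
    go (suc fuel) k h with Data.Nat.Properties._≟_ (size k) (size (suc k))
    ... | yes e = k , λ u w → sym (b2n-inj (sum-mono-≡ (λ w → le (mono k u w)) (sum-mono-≡ (row k) e u) w))
    ... | no ne = go fuel (suc k) (≤-trans h (≤-trans (≤-reflexive (sym (+-suc fuel (size k))))
                    (+-monoʳ-≤ fuel (≤∧≢⇒< (sum-mono (row k)) ne))))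

  opaque
   -- The number of related pairs never drops and is at most `n * n`, so two consecutive levels have
   -- equal size and, by monotonicity, coincide. For `reach` this gives a fixed point of its
   -- recursion.
   stabilises : ∃ λ k → ∀ u w → D (suc k) u w ≡ D k u w
   stabilises = go (suc (n * n)) 0 (s≤s (m≤m+n (n * n) _))

-- Sums with small support

module _ {n} (f : Fin n → ℕ) where

  private
    without : Fin n → Fin n → ℕ
    without i j = if j == i then 0 else f j

    without-self : ∀ i → without i i ≡ 0
    without-self i rewrite ==-refl i = refl

    without-other : ∀ {i j} → j ≢ i → f j ≡ without i j
    without-other p rewrite not-true (≢-== p) = refl

    split : ∀ i → sum f ≡ f i + sum (without i)
    split i = sum-extract f (without i) i (without-self i) (λ j → without-other)

  ∑-none : (∀ j → f j ≡ 0) → sum f ≡ 0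
  ∑-none h = trans (sum-cong-≗ h) (sum-zero n)

  ∑-one-≥ : ∀ i → f i ≤ sum f
  ∑-one-≥ i = ≤-trans (m≤m+n _ _) (≤-reflexive (sym (split i)))

∑-one : ∀ {n} (f : Fin n → ℕ) i → (∀ j → j ≢ i → f j ≡ 0) → sum f ≡ f i
∑-one {n} f i h = trans (sum-extract f (λ _ → 0) i refl h) (trans (cong (f i +_) (sum-zero n)) (+-identityʳ _))

∑-two : ∀ {n} (f : Fin n → ℕ) i k → i ≢ k → (∀ j → j ≢ i → j ≢ k → f j ≡ 0) → sum f ≡ f i + f k
∑-two f i k ne h = trans (sum-extract f g i self (λ j p → sym (other′ p)))
  (cong (f i +_) (trans (∑-one g k zero-g) (other′ (ne ∘ sym))))
  where
  g = λ j → if j == i then 0 else f j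
  self : g i ≡ 0
  self rewrite ==-refl i = refl
  other′ : ∀ {j} → j ≢ i → g j ≡ f j
  other′ p rewrite not-true (≢-== p) = refl
  zero-g : ∀ j → j ≢ k → g j ≡ 0
  zero-g j p with j ≟′ i
  ... | inj₁ refl = self
  ... | inj₂ q = trans (other′ q) (h j q p)

∑-three : ∀ {n} (f : Fin n → ℕ) i k l → i ≢ k → i ≢ l → k ≢ l → (∀ j → j ≢ i → j ≢ k → j ≢ l → f j ≡ 0) → sum f ≡ f i + (f k + f l)
∑-three f i k l ik il kl h = trans (sum-extract f g i self (λ j p → sym (other′ p)))
  (cong (f i +_) (trans (∑-two g k l kl zero-g) (cong₂ _+_ (other′ (ik ∘ sym)) (other′ (il ∘ sym)))))
  where
  g = λ j → if j == i then 0 else f j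
  self : g i ≡ 0
  self rewrite ==-refl i = refl
  other′ : ∀ {j} → j ≢ i → g j ≡ f j
  other′ p rewrite not-true (≢-== p) = refl
  zero-g : ∀ j → j ≢ k → j ≢ l → g j ≡ 0
  zero-g j p r with j ≟′ i
  ... | inj₁ refl = self
  ... | inj₂ q = trans (other′ q) (h j q p r)

-- Arithmetic of the discharging

pay : Bool → Bool → ℕ
pay false true = 2
pay true false = 0
pay _ _ = 1

pay≤2 : ∀ d e → pay d e ≤ 2
pay≤2 true true = s≤s z≤n
pay≤2 true false = z≤n
pay≤2 false true = ≤-refl
pay≤2 false false = s≤s z≤n

pay-swap : ∀ d e → pay d e + pay e d ≡ 2
pay-swap true true = refl
pay-swap true false = refl
pay-swap false true = refl
pay-swap false false = refl

pay-true : ∀ e → pay true e ≤ 1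
pay-true true = ≤-refl
pay-true false = z≤n

-- Here `k` counts the U-neighbours. Together with (1, 3), the excluded pairs are exactly those with
-- h + s ≥ 3 in which paying 2 to every hard neighbour would overdraw. The pair (1, 3) has charge 0
-- and can afford no U-neighbour at all.
charge-suffices : ∀ h s → 3 ≤ h + s → (h ≡ 0 → s ≡ 3 → ⊥) → (h ≡ 0 → s ≡ 4 → ⊥) → (h ≡ 1 → s ≡ 2 → ⊥) →
  (h ≡ 2 → s ≡ 1 → ⊥) → (h ≡ 3 → s ≡ 0 → ⊥) → ∀ k → k ≤ h → (h ≡ 1 → s ≡ 3 → k ≡ 0) → 28 + 2 * k ≤ 10 * h + 6 * s
charge-suffices zero (suc (suc (suc zero))) m a b c d e k kh x = ⊥-elim (a refl refl)
charge-suffices zero (suc (suc (suc (suc zero)))) m a b c d e k kh x = ⊥-elim (b refl refl)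
charge-suffices zero (suc (suc (suc (suc (suc s))))) m a b c d e .zero z≤n x =
  ≤-trans (m≤m+n 28 (2 + 6 * s)) (≤-reflexive (eq s))
  where
  eq : ∀ s → 28 + (2 + 6 * s) ≡ 10 * 0 + 6 * (5 + s)
  eq = solve-∀
charge-suffices (suc zero) (suc zero) (s≤s (s≤s ())) a b c d e k kh x
charge-suffices (suc zero) zero (s≤s ()) a b c d e k kh x
charge-suffices zero (suc (suc zero)) (s≤s (s≤s ())) a b c d e k kh x
charge-suffices zero (suc zero) (s≤s ()) a b c d e k kh x
charge-suffices (suc zero) (suc (suc zero)) m a b c d e k kh x = ⊥-elim (c refl refl)
charge-suffices (suc zero) (suc (suc (suc zero))) m a b c d e k kh x rewrite x refl refl = ≤-refl
charge-suffices (suc zero) (suc (suc (suc (suc s)))) m a b c d e k kh x =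
  ≤-trans (+-monoʳ-≤ 28 (*-monoʳ-≤ 2 kh)) (≤-trans (m≤m+n 30 (4 + 6 * s)) (≤-reflexive (eq s)))
  where
  eq : ∀ s → 30 + (4 + 6 * s) ≡ 10 * 1 + 6 * (4 + s)
  eq = solve-∀
charge-suffices (suc (suc zero)) zero (s≤s (s≤s ())) a b c d e k kh x
charge-suffices (suc (suc zero)) (suc zero) m a b c d e k kh x = ⊥-elim (d refl refl)
charge-suffices (suc (suc zero)) (suc (suc s)) m a b c d e k kh x =
  ≤-trans (+-monoʳ-≤ 28 (*-monoʳ-≤ 2 kh)) (≤-trans (m≤m+n 32 (6 * s)) (≤-reflexive (eq s)))
  where
  eq : ∀ s → 32 + 6 * s ≡ 10 * 2 + 6 * (2 + s)
  eq = solve-∀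
charge-suffices (suc (suc (suc zero))) zero m a b c d e k kh x = ⊥-elim (e refl refl)
charge-suffices (suc (suc (suc zero))) (suc s) m a b c d e k kh x =
  ≤-trans (+-monoʳ-≤ 28 (*-monoʳ-≤ 2 kh)) (≤-trans (m≤m+n 34 (2 + 6 * s)) (≤-reflexive (eq s)))
  where
  eq : ∀ s → 34 + (2 + 6 * s) ≡ 10 * 3 + 6 * (1 + s)
  eq = solve-∀
charge-suffices (suc (suc (suc (suc h)))) s m a b c d e k kh x =
  ≤-trans (+-monoʳ-≤ 28 (*-monoʳ-≤ 2 kh)) (≤-trans (m≤m+n (28 + 2 * (4 + h)) (4 + 8 * h + 6 * s)) (≤-reflexive (eq h s)))
  where
  eq : ∀ h s → 28 + 2 * (4 + h) + (4 + 8 * h + 6 * s) ≡ 10 * (4 + h) + 6 * s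
  eq = solve-∀

b2n-∧ : ∀ x y → b2n (x ∧ y) ≡ b2n x * b2n y
b2n-∧ true  y = sym (+-identityʳ _)
b2n-∧ false y = refl

-- Partial colourings

ValidOn : (G : SignedGraph) → (Fin (n G) → Bool) → (Fin (n G) → Colour) → Set
ValidOn G S φ = ∀ a b s → S a ≡ true → S b ≡ true → sgn G a b ≡ just s → E s (φ a) (φ b) ≡ true

≡ᵇ-sound : ∀ {m k} → (m ≡ᵇ k) ≡ true → m ≡ k
≡ᵇ-sound {m} {k} e = ≡ᵇ⇒≡ m k (subst T (sym e) _)

≡ᵇ-complete : ∀ {m k} → m ≡ k → (m ≡ᵇ k) ≡ true
≡ᵇ-complete {zero} refl = refl
≡ᵇ-complete {suc m} refl = ≡ᵇ-complete {m} refl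

_[_≔_] : ∀ {N} → (Fin N → Colour) → Fin N → Colour → Fin N → Colour
(φ [ v ≔ x ]) t = if t == v then x else φ t

≔-same : ∀ {N} (φ : Fin N → Colour) v x → (φ [ v ≔ x ]) v ≡ x
≔-same φ v x rewrite ==-refl v = refl

≔-other : ∀ {N} (φ : Fin N → Colour) {v t} x → t ≢ v → (φ [ v ≔ x ]) t ≡ φ t
≔-other φ x p rewrite not-true (≢-== p) = refl

∉-∷ : ∀ {N} {a x : Fin N} {X} → a ≢ x → a ∉ X → a ∉ x ∷ X
∉-∷ p q (here e)  = p e
∉-∷ p q (there e) = q e

flip-≢ : ∀ s {k l} → k ≢ s · l → l ≢ s · k
flip-≢ s {k} {l} p q = p (trans (sym (·-invol s k)) (cong (s ·_) (sym q)))

signOf : Maybe Sign → Sign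
signOf (just s) = s
signOf nothing  = plus

isEdge-just : ∀ m → isEdge m ≡ true → m ≡ just (signOf m)
isEdge-just (just s) _ = refl

module Graph (G : SignedGraph) (S : Fin (n G) → Bool) where

  N : ℕ
  N = n G

  sg : Fin N → Fin N → Sign
  sg a b = signOf (sgn G a b)

  sg-sym : ∀ a b → sg a b ≡ sg b a
  sg-sym a b = cong signOf (symm G a b)

  opaque
    A : Fin N → Fin N → Bool
    A a b = S a ∧ S b ∧ isEdge (sgn G a b)

    A-sgn : ∀ {a b} → A a b ≡ true → sgn G a b ≡ just (sg a b)
    A-sgn {a} {b} h = isEdge-just _ (∧₂ {S b} (∧₂ {S a} h))

    A-S : ∀ {a b} → A a b ≡ true → S a ≡ true
    A-S {a} h = ∧₁ {S a} h

    sgn-A : ∀ {a b s} → S a ≡ true → S b ≡ true → sgn G a b ≡ just s → A a b ≡ true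
    sgn-A p q r rewrite p | q | r = refl

    A-sym : ∀ {a b} → A a b ≡ true → A b a ≡ true
    A-sym {a} {b} h = ∧ᵢ {S b} (∧₁ {S b} (∧₂ {S a} h)) (∧ᵢ {S a} (∧₁ {S a} h) (subst (λ m → isEdge m ≡ true) (symm G a b) (∧₂ {S b} (∧₂ {S a} h))))

  A-≢ : ∀ {a b} → A a b ≡ true → a ≢ b
  A-≢ {a} h refl with () ← trans (sym (A-sgn h)) (noLoop G a)

  -- Vertex types, hard and soft neighbourhoods

  deg : Fin N → ℕ
  deg a = # (A a)

  opaque
    isZ isV : Fin N → Bool
    isZ a = S a ∧ (deg a ≡ᵇ 2)
    isV a = S a ∧ (3 ≤ᵇ deg a)

    Z-deg : ∀ {a} → isZ a ≡ true → deg a ≡ 2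
    Z-deg {a} h = ≡ᵇ-sound (∧₂ {S a} h)

    Z-S : ∀ {a} → isZ a ≡ true → S a ≡ true
    Z-S {a} h = ∧₁ {S a} h

    V-S : ∀ {a} → isV a ≡ true → S a ≡ true
    V-S {a} h = ∧₁ {S a} h

    split-deg : ∀ a → S a ≡ true → 2 ≤ deg a → (isZ a ≡ true × isV a ≡ false) ⊎ (isV a ≡ true × isZ a ≡ false)
    split-deg a s m with deg a | m
    ... | suc zero | s≤s ()
    ... | suc (suc zero) | _ rewrite s = inj₁ (refl , refl)
    ... | suc (suc (suc k)) | _ rewrite s = inj₂ (refl , refl)

  opaque
    hard soft₀ : Fin N → Fin N → Bool
    hard a b = A a b ∧ isV b
    soft₀ a b = A a b ∧ isZ b

    hard-A : ∀ {a b} → hard a b ≡ true → A a b ≡ true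
    hard-A {a} {b} h = ∧₁ {A a b} h

    hard-V : ∀ {a b} → hard a b ≡ true → isV b ≡ true
    hard-V {a} {b} h = ∧₂ {A a b} h

    A-hard : ∀ {a b} → A a b ≡ true → isV b ≡ true → hard a b ≡ true
    A-hard {a} {b} = ∧ᵢ {A a b}

    soft₀-A : ∀ {a b} → soft₀ a b ≡ true → A a b ≡ true
    soft₀-A {a} {b} h = ∧₁ {A a b} h

    soft₀-Z : ∀ {a b} → soft₀ a b ≡ true → isZ b ≡ true
    soft₀-Z {a} {b} h = ∧₂ {A a b} h

    A-soft₀ : ∀ {a b} → A a b ≡ true → isZ b ≡ true → soft₀ a b ≡ true
    A-soft₀ {a} {b} = ∧ᵢ {A a b}

  hard-≢ : ∀ {a b} → hard a b ≡ true → a ≢ b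
  hard-≢ h = A-≢ (hard-A h)

  hard-sym : ∀ {a b} → isV a ≡ true → hard a b ≡ true → hard b a ≡ true
  hard-sym v h = A-hard (A-sym (hard-A h)) v

  opaque
    isU isW : Fin N → Bool
    isU a = isV a ∧ (# (hard a) ≡ᵇ 2) ∧ (# (soft₀ a) ≡ᵇ 1)
    isW a = isV a ∧ (# (hard a) ≡ᵇ 3) ∧ (# (soft₀ a) ≡ᵇ 0)

    U-V : ∀ {u} → isU u ≡ true → isV u ≡ true
    U-V {u} h = ∧₁ {isV u} h

    W-V : ∀ {w} → isW w ≡ true → isV w ≡ true
    W-V {u} h = ∧₁ {isV u} h

    U-hard : ∀ {u} → isU u ≡ true → # (hard u) ≡ 2
    U-hard {u} h = ≡ᵇ-sound {# (hard u)} (∧₁ {# (hard u) ≡ᵇ 2} (∧₂ {isV u} h))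

    U-soft : ∀ {u} → isU u ≡ true → # (soft₀ u) ≡ 1
    U-soft {u} h = ≡ᵇ-sound (∧₂ {# (hard u) ≡ᵇ 2} (∧₂ {isV u} h))

    W-hard : ∀ {u} → isW u ≡ true → # (hard u) ≡ 3
    W-hard {u} h = ≡ᵇ-sound {# (hard u)} (∧₁ {# (hard u) ≡ᵇ 3} (∧₂ {isV u} h))

    W-soft : ∀ {u} → isW u ≡ true → # (soft₀ u) ≡ 0
    W-soft {u} h = ≡ᵇ-sound (∧₂ {# (hard u) ≡ᵇ 3} (∧₂ {isV u} h))

    U-intro : ∀ {u} → isV u ≡ true → # (hard u) ≡ 2 → # (soft₀ u) ≡ 1 → isU u ≡ true
    U-intro {u} v h s = ∧ᵢ {isV u} v (∧ᵢ {# (hard u) ≡ᵇ 2} (≡ᵇ-complete h) (≡ᵇ-complete s))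

    W-intro : ∀ {u} → isV u ≡ true → # (hard u) ≡ 3 → # (soft₀ u) ≡ 0 → isW u ≡ true
    W-intro {u} v h s = ∧ᵢ {isV u} v (∧ᵢ {# (hard u) ≡ᵇ 3} (≡ᵇ-complete h) (≡ᵇ-complete s))

  -- For a U-vertex u: far u p is its hard neighbour other than p, and soft u its soft neighbour, across the Z-vertex
  -- mid u.  For other vertices these are junk.
  opaque
    far : Fin N → Fin N → Fin N
    far u p = find (hard u ∖ p) u

    far-def : ∀ u p → far u p ≡ find (hard u ∖ p) u
    far-def u p = refl

    mid soft : Fin N → Fin N
    mid u = find (soft₀ u) u
    soft u = find (A (mid u) ∖ u) u

    mid-def : ∀ u → mid u ≡ find (soft₀ u) u
    mid-def u = refl

    soft-def : ∀ u → soft u ≡ find (A (mid u) ∖ u) u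
    soft-def u = refl

  esg : Fin N → Sign
  esg u = neg (sg (mid u) u ⊗ sg (mid u) (soft u))

  -- The one class that the Z-vertex `mid u` forbids at `u` once `soft u` is coloured.
  kill : (Fin N → Colour) → Fin N → K
  kill φ u = esg u · cls (φ (soft u))

  U≢W : ∀ {u w} → isU u ≡ true → isW w ≡ true → u ≢ w
  U≢W p q refl with () ← trans (sym (U-hard p)) (W-hard q)

  record HU (u p w : Fin N) : Set where
    constructor mkHU
    field
      uU  : isU u ≡ true
      up  : hard u p ≡ true
      uw  : hard u w ≡ true
      p≢w : p ≢ w
      all : ∀ x → hard u x ≡ true → x ≡ p ⊎ x ≡ w

  HU-flip : ∀ {u p w} → HU u p w → HU u w p
  HU-flip d = mkHU uU uw up (p≢w ∘ sym) λ x h → case all x h of λ { (inj₁ e) → inj₂ e ; (inj₂ e) → inj₁ e }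
    where open HU d

  U-nbrs : ∀ {u} → isU u ≡ true → ∃₂ λ p w → HU u p w
  U-nbrs {u} h with #-two (hard u) (U-hard h)
  ... | p , w , hp , hw , ne , al = p , w , mkHU h hp hw ne al

  HU-far : ∀ {u p w} → HU u p w → far u p ≡ w
  HU-far {u} {p} {w} d = trans (far-def u p) (pick (∖-in {p = hard u} (find-sound (hard u ∖ p) u w (in-∖ {p = hard u} uw (p≢w ∘ sym)))))
    where
    open HU d
    pick : ∀ {x} → hard u x ≡ true × x ≢ p → x ≡ w
    pick {x} (h , ne) with all x h
    ... | inj₁ e = ⊥-elim (ne e)
    ... | inj₂ e = e

  U-orient : ∀ {u p} → isU u ≡ true → hard u p ≡ true → HU u p (far u p)
  U-orient {u} {p} h hp with U-nbrs h
  ... | a , b , d with HU.all d p hp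
  ... | inj₁ refl = subst (HU u p) (sym (HU-far d)) d
  ... | inj₂ refl = subst (HU u p) (sym (HU-far (HU-flip d))) (HU-flip d)

  record WD (w a b c : Fin N) : Set where
    constructor mkWD
    field
      wW  : isW w ≡ true
      wa  : hard w a ≡ true
      wb  : hard w b ≡ true
      wc  : hard w c ≡ true
      a≢b : a ≢ b
      a≢c : a ≢ c
      b≢c : b ≢ c
      all : ∀ x → hard w x ≡ true → x ≡ a ⊎ x ≡ b ⊎ x ≡ c

  WD-rot : ∀ {w a b c} → WD w a b c → WD w b c a
  WD-rot d = mkWD wW wb wc wa b≢c (a≢b ∘ sym) (a≢c ∘ sym)
    λ x h → case all x h of λ { (inj₁ e) → inj₂ (inj₂ e) ; (inj₂ (inj₁ e)) → inj₁ e ; (inj₂ (inj₂ e)) → inj₂ (inj₁ e) }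
    where open WD d

  WD-swap : ∀ {w a b c} → WD w a b c → WD w a c b
  WD-swap d = mkWD wW wa wc wb a≢c a≢b (b≢c ∘ sym)
    λ x h → case all x h of λ { (inj₁ e) → inj₁ e ; (inj₂ (inj₁ e)) → inj₂ (inj₂ e) ; (inj₂ (inj₂ e)) → inj₂ (inj₁ e) }
    where open WD d

  W-nbrs : ∀ {w} → isW w ≡ true → Σ (Fin N) λ a → Σ (Fin N) λ b → Σ (Fin N) λ c → WD w a b c
  W-nbrs {w} h = build (#-three (hard w) (W-hard h))
    where
    build : (∃₂ λ a b → ∃ λ c → Trio (hard w) a b c) → Σ (Fin N) λ a → Σ (Fin N) λ b → Σ (Fin N) λ c → WD w a b c
    build (a , b , c , ha , hb , hc , n₁ , n₂ , n₃ , al) = a , b , c , mkWD h ha hb hc n₁ n₂ n₃ al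

  -- φ is a colouring of the V-vertices outside X, leaving a colour for every Z-vertex between two of them.
  record Valid (X : List (Fin N)) (φ : Fin N → Colour) : Set where
    field
      hardV : ∀ a b → isV a ≡ true → hard a b ≡ true → a ∉ X → b ∉ X → E (sg a b) (φ a) (φ b) ≡ true
      softV : ∀ z a b → isZ z ≡ true → A z a ≡ true → A z b ≡ true → isV a ≡ true → isV b ≡ true → a ≢ b →
              a ∉ X → b ∉ X → cls (φ a) ≢ neg (sg z a ⊗ sg z b) · cls (φ b)
  open Valid public

  weaken : ∀ {X Y φ} → (∀ {a} → a ∈ X → a ∈ Y) → Valid X φ → Valid Y φ
  hardV (weaken s v) a b p q r t = hardV v a b p q (r ∘ s) (t ∘ s)
  softV (weaken s v) z a b p q r t u w x y = softV v z a b p q r t u w (x ∘ s) (y ∘ s)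

  SoftOK : List (Fin N) → (Fin N → Colour) → Fin N → K → Set
  SoftOK X φ v k = ∀ z b → isZ z ≡ true → A z v ≡ true → A z b ≡ true → isV b ≡ true → b ≢ v → b ∉ X →
    k ≢ neg (sg z v ⊗ sg z b) · cls (φ b)

  record Ext (X : List (Fin N)) (φ : Fin N → Colour) (v : Fin N) (k : K) : Set where
    constructor mkExt
    field
      ψ    : Fin N → Colour
      val  : Valid X ψ
      same : ∀ t → t ≢ v → ψ t ≡ φ t
      new  : cls (ψ v) ≡ k

  add : ∀ {X φ v k i} → isV v ≡ true → Valid (v ∷ X) φ →
        (∀ b → hard v b ≡ true → b ∉ X → E (sg v b) (k , i) (φ b) ≡ true) → SoftOK X φ v k → Ext X φ v k
  add {X} {φ} {v} {k} {i} vV val h s = mkExt ψ (record { hardV = hv ; softV = sv }) (λ t → ≔-other φ (k , i)) (cong cls (≔-same φ v (k , i)))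
    where
    ψ = φ [ v ≔ (k , i) ]
    hv : ∀ a b → isV a ≡ true → hard a b ≡ true → a ∉ X → b ∉ X → E (sg a b) (ψ a) (ψ b) ≡ true
    hv a b aV ab a∉ b∉ with a ≟′ v | b ≟′ v
    ... | inj₁ refl | inj₁ refl = ⊥-elim (hard-≢ ab refl)
    ... | inj₁ refl | inj₂ q rewrite ≔-same φ a (k , i) | ≔-other φ (k , i) q = h b ab b∉
    ... | inj₂ p | inj₁ refl rewrite ≔-same φ b (k , i) | ≔-other φ (k , i) p | sg-sym a b =
      E-sym (sg b a) (k , i) (φ a) (h a (hard-sym aV ab) a∉)
    ... | inj₂ p | inj₂ q rewrite ≔-other φ (k , i) p | ≔-other φ (k , i) q = hardV val a b aV ab (∉-∷ p a∉) (∉-∷ q b∉)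
    sv : ∀ z a b → isZ z ≡ true → A z a ≡ true → A z b ≡ true → isV a ≡ true → isV b ≡ true → a ≢ b →
         a ∉ X → b ∉ X → cls (ψ a) ≢ neg (sg z a ⊗ sg z b) · cls (ψ b)
    sv z a b zZ za zb aV bV ne a∉ b∉ with a ≟′ v | b ≟′ v
    ... | inj₁ refl | inj₁ refl = ⊥-elim (ne refl)
    ... | inj₁ refl | inj₂ q rewrite ≔-same φ a (k , i) | ≔-other φ (k , i) q = s z b zZ za zb bV q b∉
    ... | inj₂ p | inj₁ refl rewrite ≔-same φ b (k , i) | ≔-other φ (k , i) p | ⊗-comm (sg z a) (sg z b) =
      flip-≢ (neg (sg z b ⊗ sg z a)) (s z a zZ zb za aV p a∉)
    ... | inj₂ p | inj₂ q rewrite ≔-other φ (k , i) p | ≔-other φ (k , i) q =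
      softV val z a b zZ za zb aV bV ne (∉-∷ p a∉) (∉-∷ q b∉)

  add₀ : ∀ {X φ v} k → isV v ≡ true → Valid (v ∷ X) φ → (∀ b → hard v b ≡ true → b ∈ X) → SoftOK X φ v k → Ext X φ v k
  add₀ k vV val h s = add {i = true} vV val (λ b vb b∉ → ⊥-elim (b∉ (h b vb))) s

  add₁ : ∀ {X φ v} k c → isV v ≡ true → Valid (v ∷ X) φ → (∀ b → hard v b ≡ true → b ∈ X ⊎ b ≡ c) →
         H k (sg v c · cls (φ c)) → SoftOK X φ v k → Ext X φ v k
  add₁ {X} {φ} {v} k c vV val h e s with colour-H _ (proj₂ (φ c)) k e
  ... | i , q = add {i = i} vV val (λ b vb b∉ → case h b vb of λ { (inj₁ p) → ⊥-elim (b∉ p) ; (inj₂ refl) → q }) s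

  softOK-W : ∀ {X φ w k} → isW w ≡ true → SoftOK X φ w k
  softOK-W {w = w} wW z b zZ zw _ _ _ _ = λ _ → #-zero (soft₀ w) (W-soft wW) z (A-soft₀ (A-sym zw) zZ)

  record Half (v z o : Fin N) : Set where
    field
      zZ   : isZ z ≡ true
      zv   : A z v ≡ true
      zo   : A z o ≡ true
      o≢v  : o ≢ v
      ends : ∀ x → A z x ≡ true → x ≡ v ⊎ x ≡ o

  Z-half : ∀ {v z} → isZ z ≡ true → A z v ≡ true → Half v z (find (A z ∖ v) v)
  Z-half {v} {z} zZ zv with #-two (A z) (Z-deg zZ)
  ... | a , b , za , zb , ne , al = half (∖-in {p = A z} (find-sound (A z ∖ v) v (proj₁ other) (in-∖ {p = A z} (proj₁ (proj₂ other)) (proj₂ (proj₂ other)))))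
    where
    other : ∃ λ x → A z x ≡ true × x ≢ v
    other with a ≟′ v
    ... | inj₁ refl = b , zb , ne ∘ sym
    ... | inj₂ p = a , za , p
    half : ∀ {o} → A z o ≡ true × o ≢ v → Half v z o
    half {o} (zo , o≢v) = record { zZ = zZ ; zv = zv ; zo = zo ; o≢v = o≢v ; ends = ends }
      where
      ends : ∀ x → A z x ≡ true → x ≡ v ⊎ x ≡ o
      ends x zx with al x zx | al v zv | al o zo
      ... | inj₁ refl | inj₁ refl | _ = inj₁ refl
      ... | inj₁ refl | inj₂ refl | inj₁ e = inj₂ (sym e)
      ... | inj₁ refl | inj₂ refl | inj₂ e = ⊥-elim (o≢v e)
      ... | inj₂ refl | inj₂ refl | _ = inj₁ refl
      ... | inj₂ refl | inj₁ refl | inj₂ e = inj₂ (sym e)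
      ... | inj₂ refl | inj₁ refl | inj₁ e = ⊥-elim (o≢v e)

  -- Extending colourings when no two Z-vertices are adjacent

  module NoAdjacentZ (noZZ : ∀ a b → isZ a ≡ true → isZ b ≡ true → A a b ≡ true → ⊥)
                       (min2 : ∀ a → S a ≡ true → 2 ≤ deg a) where

    Z-or-V : ∀ a → S a ≡ true → isZ a ≡ true ⊎ isV a ≡ true
    Z-or-V a s with split-deg a s (min2 a s)
    ... | inj₁ (p , _) = inj₁ p
    ... | inj₂ (p , _) = inj₂ p

    Z-nbr : ∀ {z a} → isZ z ≡ true → A z a ≡ true → isV a ≡ true
    Z-nbr {z} {a} zZ za with Z-or-V a (A-S (A-sym za))
    ... | inj₁ p = ⊥-elim (noZZ z a zZ p za)
    ... | inj₂ p = p

    module _ {u} (uU : isU u ≡ true) where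
      private
        one : ∃ λ z → One (soft₀ u) z
        one = #-one (soft₀ u) (U-soft uU)
        mid-soft : soft₀ u (mid u) ≡ true
        mid-soft = subst (λ z → soft₀ u z ≡ true) (sym (mid-def u)) (find-sound (soft₀ u) u (proj₁ one) (proj₁ (proj₂ one)))

      mid-uniq : ∀ z → isZ z ≡ true → A z u ≡ true → z ≡ mid u
      mid-uniq z zZ zu = trans (proj₂ (proj₂ one) z (A-soft₀ (A-sym zu) zZ)) (sym (proj₂ (proj₂ one) (mid u) mid-soft))

      mid-half : Half u (mid u) (soft u)
      mid-half = subst (Half u (mid u)) (sym (soft-def u)) (Z-half (soft₀-Z mid-soft) (A-sym (soft₀-A mid-soft)))

      soft-≢ : soft u ≢ u
      soft-≢ = Half.o≢v mid-half

      softOK-U : ∀ {X φ k} → (soft u ∉ X → k ≢ kill φ u) → SoftOK X φ u k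
      softOK-U h z b zZ zu zb bV b≢u b∉ with mid-uniq z zZ zu
      ... | refl with Half.ends mid-half b zb
      ... | inj₁ e = ⊥-elim (b≢u e)
      ... | inj₂ refl = h b∉

    soft-¬W : ∀ {u} → isU u ≡ true → isW (soft u) ≡ true → ⊥
    soft-¬W {u} uU oW = softOK-W {[]} {λ _ → a⁺ , true} {k = neg (sg (mid u) (soft u) ⊗ sg (mid u) u) · a⁺} oW
      (mid u) u zZ zo zv (U-V uU) (o≢v ∘ sym) (λ ()) refl
      where open Half (mid-half uU)

    -- A U-vertex has a single Z-neighbour, so two U-vertices linked across a Z-vertex see the same
    -- `mid`. Thus `soft` is a partial matching on the U-vertices.
    soft-soft : ∀ {u} → isU u ≡ true → isU (soft u) ≡ true → soft (soft u) ≡ u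
    soft-soft {u} uU oU with mid-uniq oU (mid u) (Half.zZ (mid-half uU)) (Half.zo (mid-half uU))
    ... | e with Half.ends (mid-half uU) (soft (soft u)) (subst (λ z → A z (soft (soft u)) ≡ true) (sym e) (Half.zo (mid-half oU)))
    ... | inj₁ q = q
    ... | inj₂ q = ⊥-elim (soft-≢ oU q)

    soft-inj : ∀ {u u'} → isU u ≡ true → isU u' ≡ true → isU (soft u) ≡ true → soft u ≡ soft u' → u ≡ u'
    soft-inj uU uU' oU e = trans (sym (soft-soft uU oU)) (trans (cong soft e) (soft-soft uU' (subst (λ o → isU o ≡ true) e oU)))

    addU : ∀ {X φ u p w} k → HU u p w → Valid (u ∷ X) φ → Free (sg u p · cls (φ p)) (sg u w · cls (φ w)) k →
           (soft u ∉ X → k ≢ kill φ u) → Ext X φ u k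
    addU {X} {φ} {u} {p} {w} k d val g s with colour-fits _ (proj₂ (φ p)) _ (proj₂ (φ w)) k g
    ... | i , e , e' = add {i = i} (U-V (HU.uU d)) val
      (λ b ub _ → case HU.all d b ub of λ { (inj₁ refl) → e ; (inj₂ refl) → e' }) (softOK-U (HU.uU d) {X} {φ} s)

    addUh : ∀ {X φ u p w} k → HU u p w → w ∈ X → Valid (u ∷ X) φ → H k (sg u p · cls (φ p)) →
           (soft u ∉ X → k ≢ kill φ u) → Ext X φ u k
    addUh {X} {φ} {p = p} k d w∈ val e s = add₁ k p (U-V (HU.uU d)) val
      (λ b ub → case HU.all d b ub of λ { (inj₁ refl) → inj₂ refl ; (inj₂ refl) → inj₁ w∈ }) e (softOK-U (HU.uU d) {X} {φ} s)

    addW₁ : ∀ {X φ w a b c} k → WD w a b c → a ∈ X → b ∈ X → Valid (w ∷ X) φ → H k (sg w c · cls (φ c)) → Ext X φ w k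
    addW₁ {X} {φ} {c = c} k d a∈ b∈ val e = add₁ k c (W-V (WD.wW d)) val
      (λ x wx → case WD.all d x wx of λ { (inj₁ refl) → inj₁ a∈ ; (inj₂ (inj₁ refl)) → inj₁ b∈ ; (inj₂ (inj₂ refl)) → inj₂ refl })
      e (softOK-W {X} {φ} (WD.wW d))

    addW₀ : ∀ {X φ w a b c} k → WD w a b c → a ∈ X → b ∈ X → c ∈ X → Valid (w ∷ X) φ → Ext X φ w k
    addW₀ {X} {φ} k d a∈ b∈ c∈ val = add₀ k (W-V (WD.wW d)) val
      (λ x wx → case WD.all d x wx of λ { (inj₁ refl) → a∈ ; (inj₂ (inj₁ refl)) → b∈ ; (inj₂ (inj₂ refl)) → c∈ })
      (softOK-W {X} {φ} (WD.wW d))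

-- Reducible configurations in a minimal counterexample

module Critical (G : SignedGraph) (S : Fin (n G) → Bool)
  (noZZ : ∀ a b → Graph.isZ G S a ≡ true → Graph.isZ G S b ≡ true → Graph.A G S a b ≡ true → ⊥)
  (min2 : ∀ a → S a ≡ true → 2 ≤ Graph.deg G S a)
  (crit : ∀ v → Graph.isV G S v ≡ true → ∃ λ φ → Graph.Valid G S (v ∷ []) φ)
  (stuck : (∃ λ φ → Graph.Valid G S [] φ) → ⊥) where

  open Graph G S
  open NoAdjacentZ noZZ min2

  Full : Set
  Full = ∃ λ φ → Valid [] φ

  -- The colouring may be total junk on uncoloured vertices: satisfying a constraint towards them does no harm.
  addG : ∀ {X φ u p w a b q k} → HU u p w → Valid (u ∷ X) φ → cls (φ p) ≡ a → cls (φ w) ≡ b → cls (φ (soft u)) ≡ q →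
         Free (sg u p · a) (sg u w · b) k → k ≢ esg u · q → Ext X φ u k
  addG {k = k} d v refl refl refl g ne = addU k d v g λ _ → ne

  addGx : ∀ {X φ u p w a b k} → HU u p w → Valid (u ∷ X) φ → cls (φ p) ≡ a → cls (φ w) ≡ b → soft u ∈ X →
         Free (sg u p · a) (sg u w · b) k → Ext X φ u k
  addGx {k = k} d v refl refl o g = addU k d v g λ o∉ → ⊥-elim (o∉ o)

  addR : ∀ {X φ u p w a b q} → HU u p w → Valid (u ∷ X) φ → cls (φ p) ≡ a → cls (φ w) ≡ b → cls (φ (soft u)) ≡ q →
         R (sg u p · a) (sg u w · b) (esg u · q) → ∃ λ k → Ext X φ u k
  addR d v ea eb eq r with R-avail _ _ _ r
  ... | k , g , ne = k , addG d v ea eb eq g ne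

  addU₀ : ∀ {X φ u p w} k → HU u p w → p ∈ X → w ∈ X → Valid (u ∷ X) φ → (soft u ∉ X → k ≢ kill φ u) → Ext X φ u k
  addU₀ {X} {φ} k d p∈ w∈ val s = add₀ k (U-V (HU.uU d)) val
    (λ b ub → case HU.all d b ub of λ { (inj₁ refl) → p∈ ; (inj₂ refl) → w∈ }) (softOK-U (HU.uU d) {X} {φ} s)

  soft≢W : ∀ {u w} → isU u ≡ true → isW w ≡ true → soft u ≢ w
  soft≢W uU wW refl = soft-¬W uU wW

  soft-flip : ∀ {u v} → isU u ≡ true → isU v ≡ true → soft u ≡ v → soft v ≡ u
  soft-flip uU vU refl = soft-soft uU vU

  record K3 (w a b c : Fin N) : Set where
    constructor mkK3
    field
      wd : WD w a b c
      aU : isU a ≡ true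
      bU : isU b ≡ true
      cU : isU c ≡ true
    open WD wd public

  K3-rot : ∀ {w a b c} → K3 w a b c → K3 w b c a
  K3-rot (mkK3 d x y z) = mkK3 (WD-rot d) y z x

  K3-swap : ∀ {w a b c} → K3 w a b c → K3 w a c b
  K3-swap (mkK3 d x y z) = mkK3 (WD-swap d) x z y

  record K2 (w u u' c : Fin N) : Set where
    constructor mkK2
    field
      wd  : WD w u u' c
      uU  : isU u ≡ true
      u'U : isU u' ≡ true
      cN  : isU c ≡ true → ⊥
    open WD wd public renaming (a≢b to u≢u'; a≢c to u≢c; b≢c to u'≢c; wa to wu; wb to wu')

  W-two : ∀ {w a b} → isW w ≡ true → hard w a ≡ true → hard w b ≡ true → a ≢ b → ∃ λ c → WD w a b c
  W-two {a = a} {b} wW wa wb ne with W-nbrs wW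
  ... | x , y , z , d with WD.all d a wa | WD.all d b wb
  ... | inj₁ refl        | inj₁ refl        = ⊥-elim (ne refl)
  ... | inj₁ refl        | inj₂ (inj₁ refl) = _ , d
  ... | inj₁ refl        | inj₂ (inj₂ refl) = _ , WD-swap d
  ... | inj₂ (inj₁ refl) | inj₁ refl        = _ , WD-swap (WD-rot d)
  ... | inj₂ (inj₁ refl) | inj₂ (inj₁ refl) = ⊥-elim (ne refl)
  ... | inj₂ (inj₁ refl) | inj₂ (inj₂ refl) = _ , WD-rot d
  ... | inj₂ (inj₂ refl) | inj₁ refl        = _ , WD-rot (WD-rot d)
  ... | inj₂ (inj₂ refl) | inj₂ (inj₁ refl) = _ , WD-swap (WD-rot (WD-rot d))
  ... | inj₂ (inj₂ refl) | inj₂ (inj₂ refl) = ⊥-elim (ne refl)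

  U-two : ∀ {u a b} → isU u ≡ true → hard u a ≡ true → hard u b ≡ true → a ≢ b → HU u a b
  U-two {u} {a} uU ua ub ne with U-orient uU ua
  ... | d with HU.all d _ ub
  ... | inj₁ e = ⊥-elim (ne (sym e))
  ... | inj₂ e = subst (HU u a) (sym e) d

  -- Triangles with two U-vertices

  module _ {u p w : Fin N} (du : HU u w p) (dp : HU p w u) {φ c}
           (place : ∀ x → H x c → Ext (p ∷ u ∷ []) φ w x) where
    open HU dp using () renaming (uU to pU; up to pw)
    open HU du using (uU; uw) renaming (up to uw′)

    triangle-free : soft u ≢ p → soft p ≢ w → soft u ≢ w → Full
    triangle-free np nw nw' with triangle c (kill φ p) (kill φ u) (sg u p) (sg p w) (sg u w)
    ... | x , h , k , hk , kne , k' , g , kne' with place x h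
    ... | mkExt ψ₁ v₁ s₁ refl with addUh k dp z0 v₁ hk (λ _ → subst (λ α → k ≢ esg p · cls α) (sym (s₁ _ nw)) kne)
    ... | mkExt ψ₂ v₂ s₂ refl with addG du v₂ (cong cls (s₂ w (hard-≢ pw ∘ sym))) refl (cong cls (trans (s₂ _ np) (s₁ _ nw'))) g kne'
    ... | mkExt ψ₃ v₃ _ _ = ψ₃ , v₃

    -- The later of two linked vertices bears the constraint between them: `p` is coloured while
    -- `soft p` is still open, then `u` avoids the class forbidden by `p`. Other linked cases use
    -- the same order.
    triangle-soft : soft u ≡ p → Full
    triangle-soft e with triangle-linked c (esg u) (sg u p) (sg p w) (sg u w)
    ... | x , h , k , hk , k' , g , kne' with place x h
    ... | mkExt ψ₁ v₁ s₁ refl with addUh k dp z0 v₁ hk (λ o∉ → ⊥-elim (o∉ (subst (_∈ u ∷ []) (sym (soft-flip uU pU e)) z0)))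
    ... | mkExt ψ₂ v₂ s₂ refl with addG du v₂ (cong cls (s₂ w (hard-≢ pw ∘ sym))) refl (cong (cls ∘ ψ₂) e) g kne'
    ... | mkExt ψ₃ v₃ _ _ = ψ₃ , v₃

    triangle-apexed : soft u ≢ p → soft p ≡ w → soft u ≢ w → Full
    triangle-apexed np e nw' with triangle-apex c (esg p) (kill φ u) (sg u p) (sg p w) (sg u w)
    ... | x , h , k , hk , kne , k' , g , kne' with place x h
    ... | mkExt ψ₁ v₁ s₁ refl with addUh k dp z0 v₁ hk (λ _ → subst (λ o → k ≢ esg p · cls (ψ₁ o)) (sym e) kne)
    ... | mkExt ψ₂ v₂ s₂ refl with addG du v₂ (cong cls (s₂ w (hard-≢ pw ∘ sym))) refl (cong cls (trans (s₂ _ np) (s₁ _ nw'))) g kne'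
    ... | mkExt ψ₃ v₃ _ _ = ψ₃ , v₃

  noTri : ∀ {u p w} → isU u ≡ true → isU p ≡ true → hard u p ≡ true → hard u w ≡ true → hard p w ≡ true → isW w ≡ true → ⊥
  noTri {u} {p} {w} uU pU up uw pw wW with crit w (W-V wW)
  ... | φ , v with W-two wW (hard-sym (U-V uU) uw) (hard-sym (U-V pU) pw) (hard-≢ up)
  ... | c , wd = stuck (go (soft u ≟′ p))
    where
    du = U-two uU uw up (hard-≢ pw ∘ sym)
    dp = U-two pU pw (hard-sym (U-V uU) up) (hard-≢ uw ∘ sym)
    place : ∀ x → H x (sg w c · cls (φ c)) → Ext (p ∷ u ∷ []) φ w x
    place x h = addW₁ x wd z1 z0 (weaken (λ { z0 → z0 }) v) h
    go : soft u ≡ p ⊎ soft u ≢ p → Full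
    go (inj₁ e)  = triangle-soft du dp place e
    go (inj₂ ne) = triangle-free du dp place ne (soft≢W pU wW) (soft≢W uU wW)

  noTriU : ∀ {u p w} → isU u ≡ true → isU p ≡ true → isU w ≡ true → hard u p ≡ true → hard u w ≡ true → hard p w ≡ true → ⊥
  noTriU {u} {p} {w} uU pU wU up uw pw with crit w (U-V wU)
  ... | φ , v = stuck (go (soft u ≟′ p) (soft p ≟′ w) (soft u ≟′ w))
    where
    du = U-two uU uw up (hard-≢ pw ∘ sym)
    dp = U-two pU pw (hard-sym (U-V uU) up) (hard-≢ uw ∘ sym)
    dw = U-two wU (hard-sym (U-V uU) uw) (hard-sym (U-V pU) pw) (hard-≢ up)
    -- Both hard neighbours of `w` are open, so only its soft constraint binds. Compatibility with
    -- `kill φ w` is stronger, by `H-irrefl`, and puts this class in the role that a third hard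
    -- neighbour plays in `noTri`.
    place : ∀ {X} → p ∈ X → u ∈ X → Valid (w ∷ X) φ → ∀ x → H x (kill φ w) → Ext X φ w x
    place p∈ u∈ v x h = addU₀ x dw u∈ p∈ v (λ _ → H-irrefl x _ h)
    go : soft u ≡ p ⊎ soft u ≢ p → soft p ≡ w ⊎ soft p ≢ w → soft u ≡ w ⊎ soft u ≢ w → Full
    go (inj₁ e) _ _ = triangle-soft du dp (place z0 z1 (weaken (λ { z0 → z0 }) v)) e
    go (inj₂ n₁) (inj₂ n₂) (inj₂ n₃) = triangle-free du dp (place z0 z1 (weaken (λ { z0 → z0 }) v)) n₁ n₂ n₃
    go (inj₂ n₁) (inj₁ e) (inj₂ n₃) = triangle-apexed du dp (place z0 z1 (weaken (λ { z0 → z0 }) v)) n₁ e n₃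
    go (inj₂ n₁) (inj₂ n₂) (inj₁ e) = triangle-apexed dp du (place z1 z0 (weaken (λ { z0 → z0 }) v))
      (λ q → n₁ (soft-flip pU uU q)) e n₂
    go (inj₂ n₁) (inj₁ e) (inj₁ e') = ⊥-elim (hard-≢ up (trans (sym (soft-flip uU wU e')) (soft-flip pU wU e)))

  thread : ∀ {w a} → isW w ≡ true → hard w a ≡ true → isU a ≡ true → HU a (far a w) w
  thread wW wa aU = HU-flip (U-orient aU (hard-sym (W-V wW) wa))

  -- Equality would make `a`, `b`, `w` a triangle of the kind excluded by `noTri`.
  far≢ : ∀ {w a b} → isW w ≡ true → hard w a ≡ true → isU a ≡ true → hard w b ≡ true → isU b ≡ true → far a w ≢ b
  far≢ wW wa aU wb bU refl = noTri aU bU (HU.up d) (HU.uw d) (hard-sym (W-V wW) wb) wW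
    where d = thread wW wa aU

  far≢w : ∀ {w a} → isW w ≡ true → hard w a ≡ true → isU a ≡ true → far a w ≢ w
  far≢w wW wa aU = HU.p≢w (thread wW wa aU)

  -- Stars: W-vertices with three U-neighbours

  record Starred (w a b u : Fin N) (φ : Fin N → Colour) (y : K) : Set where
    constructor mkStarred
    field
      ψ    : Fin N → Colour
      val  : Valid (u ∷ []) ψ
      same : ∀ t → t ≢ w → t ≢ a → t ≢ b → ψ t ≡ φ t
      new  : cls (ψ w) ≡ y

  module _ {w u a b : Fin N} (k3 : K3 w u a b) where
    open K3 k3 renaming (wa to wu; wb to wa; wc to wb; aU to uU; bU to aU; cU to bU; a≢b to u≢a; a≢c to u≢b; b≢c to a≢b)

    da : HU a (far a w) w
    da = thread wW wa aU
    db : HU b (far b w) w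
    db = thread wW wb bU

    fa-val fb-val : (φ : Fin N → Colour) → K
    fa-val φ = sg a (far a w) · cls (φ (far a w))
    fb-val φ = sg b (far b w) · cls (φ (far b w))

    star-free : ∀ {φ} y → soft a ≢ b → Valid (w ∷ a ∷ b ∷ u ∷ []) φ →
      R (fa-val φ) (sg a w · y) (kill φ a) → R (fb-val φ) (sg b w · y) (kill φ b) → Starred w a b u φ y
    star-free {φ} y ne v ra rb with addW₀ y wd z2 z0 z1 v
    ... | mkExt ψ₁ v₁ s₁ n₁
      with addR da v₁ (cong cls (s₁ _ (far≢w wW wa aU))) n₁ (cong cls (s₁ _ (soft≢W aU wW))) ra
    ... | _ , mkExt ψ₂ v₂ s₂ n₂
      with addR db v₂ (cong cls (trans (s₂ _ (far≢ wW wb bU wa aU)) (s₁ _ (far≢w wW wb bU))))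
                  (trans (cong cls (s₂ w (hard-≢ wa))) n₁)
                  (cong cls (trans (s₂ _ (λ e → ne (soft-flip bU aU e))) (s₁ _ (soft≢W bU wW)))) rb
    ... | _ , mkExt ψ₃ v₃ s₃ n₃ = mkStarred ψ₃ v₃ (λ t tw ta tb → trans (s₃ t tb) (trans (s₂ t ta) (s₁ t tw)))
        (trans (cong cls (s₃ w (hard-≢ wb))) (trans (cong cls (s₂ w (hard-≢ wa))) n₁))

    star-linked : ∀ {φ} y → soft a ≡ b → Valid (w ∷ b ∷ a ∷ u ∷ []) φ →
      Pairs (fa-val φ) (sg a w · y) (fb-val φ) (sg b w · y) (esg a) → Starred w a b u φ y
    star-linked {φ} y e v (k , g , k' , g' , ne) with addW₀ y wd z2 z1 z0 v
    ... | mkExt ψ₁ v₁ s₁ n₁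
      with addGx db v₁ (cong cls (s₁ _ (far≢w wW wb bU))) n₁ (subst (_∈ a ∷ u ∷ []) (sym (soft-flip aU bU e)) z0) g'
    ... | mkExt ψ₂ v₂ s₂ n₂
      with addG da v₂ (cong cls (trans (s₂ _ (far≢ wW wa aU wb bU)) (s₁ _ (far≢w wW wa aU))))
                  (trans (cong cls (s₂ w (hard-≢ wb))) n₁) (trans (cong (cls ∘ ψ₂) e) n₂) g ne
    ... | mkExt ψ₃ v₃ s₃ n₃ = mkStarred ψ₃ v₃ (λ t tw ta tb → trans (s₃ t ta) (trans (s₂ t tb) (s₁ t tw)))
        (trans (cong cls (s₃ w (hard-≢ wa))) (trans (cong cls (s₂ w (hard-≢ wb))) n₁))

  -- Pushing a choice of two classes along a path

  data Origin (u p : Fin N) : List (Fin N) → Set where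
    fromU : isU p ≡ true → Origin u p []
    chain : ∀ {v c} → K2 p v u c → Origin u p (v ∷ [])
    star  : ∀ {a b} → K3 p u a b → Origin u p (a ∷ b ∷ [])

  -- Two colourings of everything except u, between which the far end p of u is free to change its class.
  record State (u p w : Fin N) : Set where
    field
      d      : HU u p w
      φ₁ φ₂  : Fin N → Colour
      v₁     : Valid (u ∷ []) φ₁
      v₂     : Valid (u ∷ []) φ₂
      diff   : cls (φ₁ p) ≢ cls (φ₂ p)
      B      : List (Fin N)
      origin : Origin u p B
      agree  : ∀ t → t ≢ p → t ∉ B → φ₁ t ≡ φ₂ t
      -- Hence the class forbidden at `u` is the same in both colourings, unless `soft u` is `p`;
      -- then it stays in the pair of the class of `p`, which `step-class-p` and `loose-p` exploit.
      soft∉  : soft u ∉ B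
      nadj   : hard p w ≡ true → ⊥
    open HU d public

    BU : ∀ {x} → x ∈ B → isU x ≡ true
    BU = go origin
      where
      go : ∀ {B x} → Origin u p B → x ∈ B → isU x ≡ true
      go (chain k) z0 = K2.uU k
      go (star k) z0 = K3.bU k
      go (star k) z1 = K3.cU k

  module _ {u p w : Fin N} (s : State u p w) where
    open State s

    data Which (φ : Fin N → Colour) : Set where
      first  : φ ≡ φ₁ → Which φ
      second : φ ≡ φ₂ → Which φ

    valid-of : ∀ {φ} → Which φ → Valid (u ∷ []) φ
    valid-of (first refl)  = v₁
    valid-of (second refl) = v₂

    agree-of : ∀ {φ} → Which φ → ∀ t → t ≢ p → t ∉ B → φ t ≡ φ₁ t
    agree-of (first refl)  t _ _ = refl
    agree-of (second refl) t tp tB = sym (agree t tp tB)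

    -- The choice at `p` is spent here. If `soft u` is `p`, one colouring suffices; otherwise `kill`
    -- agrees in both, and the two classes at `p` are what `step-class` asks for.
    two-step : ∀ c t → ∃ λ φ → Which φ × Two (λ y → H y c × R (sg u p · cls (φ p)) (t · y) (kill φ u))
    two-step c t with soft u ≟′ p
    ... | inj₁ e = φ₁ , first refl , subst (λ o → Two (λ y → H y c × R (sg u p · cls (φ₁ p)) (t · y) (esg u · cls (φ₁ o)))) (sym e)
                     (step-class-p (cls (φ₁ p)) c (sg u p) t (esg u))
    ... | inj₂ ne with step-class (sg u p · cls (φ₁ p)) (sg u p · cls (φ₂ p)) c (kill φ₁ u) t (·-≢ (sg u p) diff)
    ... | inj₁ x = φ₁ , first refl , x
    ... | inj₂ x = φ₂ , second refl , subst (λ α → Two (λ y → H y c × R (sg u p · cls (φ₂ p)) (t · y) (esg u · cls α))) (agree (soft u) ne soft∉) x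

    -- Of the two classes obtained for `w`, one survives the soft constraint of `w` itself. With
    -- `far w u` outside `B`, its other hard neighbour looks the same in both colourings.
    term-U : isU w ≡ true → far w u ∉ B → Full
    term-U wU f∉ = go (soft u ≟′ w)
      where
      o : Fin N
      o = far w u
      dw : HU w o u
      dw = HU-flip (U-orient wU (hard-sym (U-V uU) uw))
      o≢p : o ≢ p
      o≢p e = nadj (hard-sym (U-V wU) (subst (λ x → hard w x ≡ true) e (HU.up dw)))
      c : K
      c = sg w o · cls (φ₁ o)
      finish : ∀ {φ} → Which φ → ∀ {y q} → H y c → y ≢ kill φ w →
        (∀ {ψ : Fin N → Colour} → (∀ t → t ≢ w → ψ t ≡ φ t) → cls (ψ w) ≡ y → cls (ψ (soft u)) ≡ q) →
        R (sg u p · cls (φ p)) (sg u w · y) (esg u · q) → Full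
      finish {φ} wh {y} h ne hq r
        with addUh y dw z0 (weaken {Y = w ∷ u ∷ []} (λ { z0 → z1 }) (valid-of wh))
               (subst (λ α → H y (sg w o · cls α)) (sym (agree-of wh o o≢p f∉)) h) (λ _ → ne)
      ... | mkExt ψ v sm nw with addR d v (cong cls (sm p p≢w)) nw (hq sm nw) r
      ... | _ , mkExt χ v' _ _ = χ , v'
      go : soft u ≡ w ⊎ soft u ≢ w → Full
      go (inj₁ e) with avoid (step-class-w (cls (φ₁ p)) c (sg u p) (sg u w) (esg u)) (kill φ₁ w)
      ... | y , (h , r) , ne = finish (first refl) h ne (λ {ψ} sm nw → trans (cong (cls ∘ ψ) e) nw) r
      go (inj₂ o≢w) with two-step c (sg u w)
      ... | φ , wh , tw with avoid tw (kill φ w)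
      ... | y , (h , r) , ne = finish wh h ne (λ sm nw → cong cls (sm _ o≢w)) r

    module _ {a b : Fin N} (k3 : K3 w u a b) (fa≢p : far a w ≢ p) (fb≢p : far b w ≢ p) (fa∉B : far a w ∉ B) (fb∉B : far b w ∉ B) where
      open K3 k3 using (wd; wW; all) renaming (wa to wu; wb to wa; wc to wb; bU to aU; cU to bU; a≢b to u≢a; a≢c to u≢b; b≢c to a≢b)

      p≢a′ : p ≢ a
      p≢a′ refl = nadj (hard-sym (W-V wW) wa)
      p≢b′ : p ≢ b
      p≢b′ refl = nadj (hard-sym (W-V wW) wb)

      term-star-soft : soft u ≡ a → Full
      term-star-soft e
        with linked-three (sg u p · cls (φ₁ p)) (fa-val k3 φ₁) (fb-val k3 φ₁) (kill φ₁ b) (sg u w) (sg a w) (sg b w) (esg u)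
      ... | y , (k , g , k' , g' , ne) , r
        with addW₀ y wd z2 z0 z1 (weaken {Y = w ∷ a ∷ b ∷ u ∷ []} (λ { z0 → z3 }) v₁)
      ... | mkExt ψ₁ w₁ s₁ n₁
        with addGx (da k3) w₁ (cong cls (s₁ _ (far≢w wW wa aU))) n₁ (subst (_∈ b ∷ u ∷ []) (sym (soft-flip uU aU e)) z1) g'
      ... | mkExt ψ₂ w₂ s₂ n₂
        with addR (db k3) w₂ (cong cls (trans (s₂ _ (far≢ wW wb bU wa aU)) (s₁ _ (far≢w wW wb bU))))
               (trans (cong cls (s₂ w (hard-≢ wa))) n₁)
               (cong cls (trans (s₂ _ (λ e' → u≢b (trans (sym (soft-flip uU aU e)) (soft-flip bU aU e')))) (s₁ _ (soft≢W bU wW)))) r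
      ... | _ , mkExt ψ₃ w₃ s₃ n₃
        with addG d w₃ (cong cls (trans (s₃ p p≢b′) (trans (s₂ p p≢a′) (s₁ p p≢w))))
               (trans (cong cls (s₃ w (hard-≢ wb))) (trans (cong cls (s₂ w (hard-≢ wa))) n₁))
               (trans (cong (cls ∘ ψ₃) e) (trans (cong cls (s₃ a a≢b)) n₂)) g ne
      ... | mkExt χ w₄ _ _ = χ , w₄

    -- When the three arms are not linked to each other, a class at `w` good under both colourings
    -- is wanted. It exists by `common` if at most one of the forbidden classes at `a` and `b`
    -- varies. If both vary, the exclusions may reach six; this case is left to `crossing`.
    term-star : ∀ {a b} (k3 : K3 w u a b) → far a w ≢ p → far b w ≢ p → far a w ∉ B → far b w ∉ B →
      (kill φ₁ a ≢ kill φ₂ a → kill φ₁ b ≢ kill φ₂ b → Full) → Full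
    term-star {a} {b} k3 fa≢p fb≢p fa∉B fb∉B crossing = go (soft u ≟′ a) (soft u ≟′ b)
      where
      open K3 k3 using (wd; wW) renaming (wa to wu; wb to wa; wc to wb; bU to aU; cU to bU; a≢b to u≢a; a≢c to u≢b; b≢c to a≢b)
      p≢a : p ≢ a
      p≢a refl = nadj (hard-sym (W-V wW) wa)
      p≢b : p ≢ b
      p≢b refl = nadj (hard-sym (W-V wW) wb)
      close : ∀ {φ y} → Which φ → soft u ≢ a → soft u ≢ b → Starred w a b u φ y →
        R (sg u p · cls (φ p)) (sg u w · y) (kill φ u) → Full
      close {φ} wh na nb (mkStarred ψ v sm nw) r
        with addR d v (cong cls (sm p p≢w p≢a p≢b)) nw (cong cls (sm _ (soft≢W uU wW) na nb)) r
      ... | _ , mkExt χ v' _ _ = χ , v'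

      fa₂ : fa-val k3 φ₂ ≡ fa-val k3 φ₁
      fa₂ = cong (λ α → sg a (far a w) · cls α) (sym (agree _ fa≢p fa∉B))
      fb₂ : fb-val k3 φ₂ ≡ fb-val k3 φ₁
      fb₂ = cong (λ α → sg b (far b w) · cls α) (sym (agree _ fb≢p fb∉B))

      Open : (Fin N → Colour) → K → Set
      Open φ y = Starred w a b u φ y

      -- The class `y₀` suits `a` and `b` under both colourings, and each colouring has a further
      -- choice. By `exchange`, either `y₀` suits `u` under one colouring, or under one colouring
      -- `u` accepts everything but `y₀`.
      choose : soft u ≢ a → soft u ≢ b →
        ∀ y₀ → (∀ {φ} → Which φ → Open φ y₀) → (∀ {φ} → Which φ → ∀ r → ∃ λ y → Open φ y × y ≢ r) → Full
      choose na nb y₀ op₀ more with soft u ≟′ p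
      ... | inj₁ e with more (first refl) (sg u w · opp (sg u p · cls (φ₁ p)))
      ... | y , op , ne = close (first refl) na nb op
            (subst (λ o → R (sg u p · cls (φ₁ p)) (sg u w · y) (esg u · cls (φ₁ o))) (sym e)
              (loose-p (cls (φ₁ p)) (sg u p) (esg u) (sg u w · y)
                (λ e' → ne (trans (sym (·-invol (sg u w) y)) (cong (sg u w ·_) e')))))
      choose na nb y₀ op₀ more | inj₂ np
        with exchange (sg u p · cls (φ₁ p)) (sg u p · cls (φ₂ p)) (sg u w · y₀) (kill φ₁ u) (·-≢ (sg u p) diff)
      ... | inj₁ r = close (first refl) na nb (op₀ (first refl)) r
      ... | inj₂ (inj₁ r) = close (second refl) na nb (op₀ (second refl)) (subst (λ α → R (sg u p · cls (φ₂ p)) (sg u w · y₀) (esg u · cls α)) (agree _ np soft∉) r)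
      ... | inj₂ (inj₂ (inj₁ f)) with more (first refl) y₀
      ... | y , op , ne = close (first refl) na nb op (f _ (·-≢ (sg u w) ne))
      choose na nb y₀ op₀ more | inj₂ np | inj₂ (inj₂ (inj₂ f)) with more (second refl) y₀
      ... | y , op , ne = close (second refl) na nb op
            (subst (λ α → R (sg u p · cls (φ₂ p)) (sg u w · y) (esg u · cls α)) (agree _ np soft∉) (f _ (·-≢ (sg u w) ne)))

      go : soft u ≡ a ⊎ soft u ≢ a → soft u ≡ b ⊎ soft u ≢ b → Full
      go (inj₁ e) _ = term-star-soft k3 fa≢p fb≢p fa∉B fb∉B e
      go (inj₂ na) (inj₁ e) = term-star-soft (K3-swap k3) fb≢p fa≢p fb∉B fa∉B e
      go (inj₂ na) (inj₂ nb) with soft a ≟′ b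
      ... | inj₁ e = choose na nb (proj₁ tl) (λ wh → open-it wh (proj₁ (proj₂ tl)))
               (λ wh r → let y , op , ne = avoid tl r in y , open-it wh op , ne)
        where
        tl : Two (λ y → Pairs (fa-val k3 φ₁) (sg a w · y) (fb-val k3 φ₁) (sg b w · y) (esg a))
        tl = two-linked (fa-val k3 φ₁) (fb-val k3 φ₁) (sg a w) (sg b w) (esg a)
        open-it : ∀ {φ} → Which φ → ∀ {y} → Pairs (fa-val k3 φ₁) (sg a w · y) (fb-val k3 φ₁) (sg b w · y) (esg a) → Open φ y
        open-it wh@(first refl) {y} ps = star-linked k3 y e (weaken (λ { z0 → z3 }) (valid-of wh)) ps
        open-it wh@(second refl) {y} ps = star-linked k3 y e (weaken (λ { z0 → z3 }) (valid-of wh))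
          (subst (λ f → Pairs f (sg a w · y) (fb-val k3 φ₂) (sg b w · y) (esg a)) (sym fa₂)
            (subst (λ f → Pairs (fa-val k3 φ₁) (sg a w · y) f (sg b w · y) (esg a)) (sym fb₂) ps))
      ... | inj₂ nab with kill φ₁ b ≟K kill φ₂ b | kill φ₁ a ≟K kill φ₂ a
      ... | no kb | no ka = crossing ka kb
      ... | yes kb | _ = choose na nb (proj₁ cm) both more
        where
        cm = common (fa-val k3 φ₁) (fb-val k3 φ₁) (kill φ₁ a) (kill φ₂ a) (kill φ₁ b) (sg a w) (sg b w)
        fill : ∀ {φ} → Which φ → ∀ {y} → R (fa-val k3 φ) (sg a w · y) (kill φ a) → R (fb-val k3 φ) (sg b w · y) (kill φ b) → Open φ y
        fill wh {y} ra rb = star-free k3 y nab (weaken (λ { z0 → z3 }) (valid-of wh)) ra rb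
        both : ∀ {φ} → Which φ → Open φ (proj₁ cm)
        both (first refl) = fill (first refl) (proj₁ (proj₂ cm)) (proj₂ (proj₂ (proj₂ cm)))
        both (second refl) = fill (second refl)
          (subst (λ f → R f (sg a w · proj₁ cm) (kill φ₂ a)) (sym fa₂) (proj₁ (proj₂ (proj₂ cm))))
          (subst (λ f → R f (sg b w · proj₁ cm) (kill φ₂ b)) (sym fb₂)
            (subst (λ k → R (fb-val k3 φ₁) (sg b w · proj₁ cm) k) kb (proj₂ (proj₂ (proj₂ cm)))))
        more : ∀ {φ} → Which φ → ∀ r → ∃ λ y → Open φ y × y ≢ r
        more {φ} wh r with avoid (two-free (fa-val k3 φ) (fb-val k3 φ) (kill φ a) (kill φ b) (sg a w) (sg b w)) r
        ... | y , (ra , rb) , ne = y , fill wh ra rb , ne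
      ... | no kb | yes ka = choose na nb (proj₁ cm) both more
        where
        cm = common (fb-val k3 φ₁) (fa-val k3 φ₁) (kill φ₁ b) (kill φ₂ b) (kill φ₁ a) (sg b w) (sg a w)
        fill : ∀ {φ} → Which φ → ∀ {y} → R (fa-val k3 φ) (sg a w · y) (kill φ a) → R (fb-val k3 φ) (sg b w · y) (kill φ b) → Open φ y
        fill wh {y} ra rb = star-free k3 y nab (weaken (λ { z0 → z3 }) (valid-of wh)) ra rb
        both : ∀ {φ} → Which φ → Open φ (proj₁ cm)
        both (first refl) = fill (first refl) (proj₂ (proj₂ (proj₂ cm))) (proj₁ (proj₂ cm))
        both (second refl) = fill (second refl)
          (subst (λ f → R f (sg a w · proj₁ cm) (kill φ₂ a)) (sym fa₂)
            (subst (λ k → R (fa-val k3 φ₁) (sg a w · proj₁ cm) k) ka (proj₂ (proj₂ (proj₂ cm)))))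
          (subst (λ f → R f (sg b w · proj₁ cm) (kill φ₂ b)) (sym fb₂) (proj₁ (proj₂ (proj₂ cm))))
        more : ∀ {φ} → Which φ → ∀ r → ∃ λ y → Open φ y × y ≢ r
        more {φ} wh r with avoid (two-free (fa-val k3 φ) (fb-val k3 φ) (kill φ a) (kill φ b) (sg a w) (sg b w)) r
        ... | y , (ra , rb) , ne = y , fill wh ra rb , ne

    varies : ∀ {x} → kill φ₁ x ≢ kill φ₂ x → soft x ≡ p ⊎ soft x ∈ B
    varies {x} ne with soft x ≟′ p | _∈?_ _≟_ (soft x) B
    ... | inj₁ e | _ = inj₁ e
    ... | inj₂ _ | yes i = inj₂ i
    ... | inj₂ n | no i = ⊥-elim (ne (cong (λ α → esg x · cls α) (agree _ n i)))

    nbr≢p : ∀ {x} → isW w ≡ true → hard w x ≡ true → x ≢ p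
    nbr≢p wW wx refl = nadj (hard-sym (W-V wW) wx)

    term-linked : ∀ {u' c} → K2 w u u' c → soft u ≡ u' → far u' w ≢ p → far u' w ∉ B → Full
    term-linked {u'} {c} k2 e f≢p f∉B = go
      where
      open K2 k2 using (wd; wW; wu; wu'; wc; u≢u'; u'U; cN)
      d' : HU u' (far u' w) w
      d' = thread wW wu' u'U
      c̄ f̄ : K
      c̄ = sg w c · cls (φ₁ c)
      f̄ = sg u' (far u' w) · cls (φ₁ (far u' w))
      finish : ∀ {φ} → Which φ → ∀ {y} → H y c̄ → Pairs (sg u p · cls (φ p)) (sg u w · y) f̄ (sg u' w · y) (esg u) → Full
      finish {φ} wh {y} h (k , g , k' , g' , ne)
        with addW₁ {X = u' ∷ u ∷ []} y wd z1 z0 (weaken (λ { z0 → z2 }) (valid-of wh))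
               (subst (λ α → H y (sg w c · cls α)) (sym (agree-of wh c (nbr≢p wW wc) (λ i → cN (BU i)))) h)
      ... | mkExt ψ₁ w₁ s₁ n₁
        with addGx d' w₁ (cong cls (s₁ _ (far≢w wW wu' u'U))) n₁ (subst (_∈ u ∷ []) (sym (soft-flip uU u'U e)) z0)
               (subst (λ α → Free (sg u' (far u' w) · cls α) (sg u' w · y) k') (sym (agree-of wh _ f≢p f∉B)) g')
      ... | mkExt ψ₂ w₂ s₂ n₂
        with addG d w₂ (cong cls (trans (s₂ p (nbr≢p wW wu' ∘ sym)) (s₁ p p≢w))) (trans (cong cls (s₂ w (hard-≢ wu'))) n₁)
               (trans (cong (cls ∘ ψ₂) e) n₂) g ne
      ... | mkExt χ w₃ _ _ = χ , w₃
      go : Full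
      go with linked-step (sg u p · cls (φ₁ p)) (sg u p · cls (φ₂ p)) c̄ f̄ (sg u w) (sg u' w) (esg u) (·-≢ (sg u p) diff)
      ... | inj₁ (y , h , ps) = finish (first refl) h ps
      ... | inj₂ (y , h , ps) = finish (second refl) h ps

    -- Now `w` plays the role of `p`. Both of its new classes are placed over the same colouring, so
    -- the results differ only at `w` and `u`; since `u` and `u'` are not linked, the soft neighbour
    -- of `u'` is not the recoloured `u`.
    advance : ∀ {u' c} → K2 w u u' c → soft u ≢ u' → (hard w (far u' w) ≡ true → ⊥) → State u' w (far u' w)
    advance {u'} {c} k2 ne nadj' with two-step (sg w c · cls (φ₁ c)) (sg u w)
    ... | φ , wh , y , (h , r) , y' , (h' , r') , y≢y' = record
      { d = HU-flip (thread wW wu' u'U) ; φ₁ = ψ (x₁ h r) ; φ₂ = ψ (x₁ h' r') ; v₁ = val (x₁ h r) ; v₂ = val (x₁ h' r')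
      ; diff = λ e → y≢y' (trans (sym (new (x₁ h r))) (trans e (new (x₁ h' r'))))
      ; B = u ∷ [] ; origin = chain k2
      ; agree = λ t tw tu → trans (same (x₁ h r) t tw (tu ∘ (λ { refl → z0 }))) (sym (same (x₁ h' r') t tw (tu ∘ (λ { refl → z0 }))))
      ; soft∉ = λ { (here e) → ne (soft-flip u'U uU e) } ; nadj = nadj' }
      where
      open K2 k2 using (wd; wW; wu; wu'; wc; u≢u'; u'U; cN)
      record Move (y : K) : Set where
        field
          ψ    : Fin N → Colour
          val  : Valid (u' ∷ []) ψ
          same : ∀ t → t ≢ w → t ≢ u → ψ t ≡ φ t
          new  : cls (ψ w) ≡ y
      open Move
      x₁ : ∀ {y} → H y (sg w c · cls (φ₁ c)) → R (sg u p · cls (φ p)) (sg u w · y) (kill φ u) → Move y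
      x₁ {y} h r
        with addW₁ {X = u ∷ u' ∷ []} y wd z0 z1 (weaken (λ { z0 → z1 }) (valid-of wh))
               (subst (λ α → H y (sg w c · cls α)) (sym (agree-of wh c (nbr≢p wW wc) (λ i → cN (BU i)))) h)
      ... | mkExt ψ₁ w₁ s₁ n₁ with addR d w₁ (cong cls (s₁ p p≢w)) n₁ (cong cls (s₁ _ (soft≢W uU wW))) r
      ... | _ , mkExt ψ₂ w₂ s₂ n₂ = record { ψ = ψ₂ ; val = w₂ ; same = λ t tw tu → trans (s₂ t tu) (s₁ t tw)
                                           ; new = trans (cong cls (s₂ w (hard-≢ wu))) n₁ }

  -- With `v` opened as well, `v'` has one coloured hard neighbour, allowing three classes, and its
  -- soft constraint removes at most one of them.
  start-U : ∀ {v v' w} → HU v v' w → isU v' ≡ true → (hard v' w ≡ true → ⊥) → Σ (State v v' w) λ s → State.B s ≡ []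
  start-U {v} {v'} {w} d v'U na with crit v' (U-V v'U)
  ... | φ , val with two-hard (sg v' (far v' v) · cls (φ (far v' v))) (kill φ v')
  ... | y , (h , r) , y' , (h' , r') , ne = record
      { d = d ; φ₁ = Ext.ψ (x h r) ; φ₂ = Ext.ψ (x h' r') ; v₁ = Ext.val (x h r) ; v₂ = Ext.val (x h' r')
      ; diff = λ e → ne (trans (sym (Ext.new (x h r))) (trans e (Ext.new (x h' r'))))
      ; B = [] ; origin = fromU v'U ; agree = λ t tv _ → trans (Ext.same (x h r) t tv) (sym (Ext.same (x h' r') t tv))
      ; soft∉ = λ () ; nadj = na } , refl
    where
    d' : HU v' (far v' v) v
    d' = HU-flip (U-orient v'U (hard-sym (U-V (HU.uU d)) (HU.up d)))
    x : ∀ {y} → H y (sg v' (far v' v) · cls (φ (far v' v))) → y ≢ kill φ v' → Ext (v ∷ []) φ v' y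
    x {y} h r = addUh y d' z0 (weaken {Y = v' ∷ v ∷ []} (λ { z0 → z0 }) val) h (λ _ → r)

  no-three : ∀ {u a b} → HU u a b → isU a ≡ true → isU b ≡ true → ⊥
  no-three {u} {a} {b} d aU bU with start-U d aU (λ ab → noTriU (HU.uU d) aU bU (HU.up d) (HU.uw d) ab)
  ... | s , refl = stuck (term-U s bU (λ ()))

  -- The path starts at the adjacent pair and ends at the star. Both forbidden classes can vary only
  -- if `soft a` and `soft b` are `v'`, against `soft-inj`.
  no-pair-star : ∀ {v v' w a b} → HU v v' w → isU v' ≡ true → K3 w v a b → ⊥
  no-pair-star {v} {v'} {w} {a} {b} d v'U k3 with start-U d v'U (λ vw → noTri (HU.uU d) v'U (HU.up d) (HU.uw d) vw (K3.wW k3))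
  ... | s , refl = stuck (term-star s k3 (far≢v (K3.wb k3) bU (K3.a≢b k3)) (far≢v (K3.wc k3) cU (K3.a≢c k3)) (λ ()) (λ ()) crossing)
    where
    open K3 k3 using (wW; bU; cU; b≢c)
    far≢v : ∀ {x} → hard w x ≡ true → isU x ≡ true → v ≢ x → far x w ≢ v'
    far≢v wx xU ne refl = no-three (U-two v'U (hard-sym (U-V (HU.uU d)) (HU.up d)) (hard-sym (U-V xU) (HU.up (thread wW wx xU))) ne) (HU.uU d) xU
    crossing : kill (State.φ₁ s) a ≢ kill (State.φ₂ s) a → kill (State.φ₁ s) b ≢ kill (State.φ₂ s) b → Full
    crossing na nb with varies s na | varies s nb
    ... | inj₁ e | inj₁ e' = ⊥-elim (b≢c (soft-inj bU cU (subst (λ o → isU o ≡ true) (sym e) v'U) (trans e (sym e'))))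

  no-pair-linked : ∀ {v v' w u' c} → HU v v' w → isU v' ≡ true → K2 w v u' c → soft v ≡ u' → ⊥
  no-pair-linked {v} {v'} {w} {u'} d v'U k2 e with start-U d v'U (λ vw → noTri (HU.uU d) v'U (HU.up d) (HU.uw d) vw (K2.wW k2))
  ... | s , refl = stuck (term-linked s k2 e far≢v (λ ()))
    where
    open K2 k2 using (wW; wu'; u'U; u≢u')
    far≢v : far u' w ≢ v'
    far≢v e = no-three (U-two v'U (hard-sym (U-V (HU.uU d)) (HU.up d))
      (hard-sym (U-V u'U) (subst (λ x → hard u' x ≡ true) e (HU.up (thread wW wu' u'U)))) u≢u') (HU.uU d) u'U

  -- A partial matching on three vertices misses one of them.
  loner : ∀ {w a b c} → K3 w a b c → ∃₂ λ u x → Σ (Fin N) λ y → K3 w u x y × soft u ≢ x × soft u ≢ y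
  loner {w} {a} {b} {c} k = go (soft a ≟′ b) (soft a ≟′ c)
    where
    open K3 k using (aU; bU; cU; a≢b; a≢c; b≢c)
    go : soft a ≡ b ⊎ soft a ≢ b → soft a ≡ c ⊎ soft a ≢ c → ∃₂ λ u x → Σ (Fin N) λ y → K3 w u x y × soft u ≢ x × soft u ≢ y
    go (inj₂ p) (inj₂ q) = a , b , c , k , p , q
    go (inj₁ p) _ = c , a , b , K3-rot (K3-rot k) , (λ e → b≢c (trans (sym p) (soft-flip cU aU e)))
                  , (λ e → a≢c (trans (sym (soft-flip aU bU p)) (soft-flip cU bU e)))
    go (inj₂ _) (inj₁ p) = b , c , a , K3-rot k , (λ e → a≢b (trans (sym (soft-flip aU cU p)) (soft-flip bU cU e)))
                  , (λ e → b≢c (sym (trans (sym p) (soft-flip bU aU e))))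

  -- With centre and arms open, two classes at `p` still allow `a` and `b` to be coloured. The
  -- opened arm `u` must be linked to neither, so that its soft neighbour is not among the
  -- recoloured vertices.
  start-star : ∀ {p u a b} → K3 p u a b → soft u ≢ a → soft u ≢ b → State u p (far u p)
  start-star {p} {u} {a} {b} k3 na nb with crit p (W-V (K3.wW k3))
  ... | φ , v = build options
    where
    open K3 k3 using (wW; all) renaming (wa to wu; wb to wa; wc to wb; aU to uU; bU to aU; cU to bU; a≢b to u≢a; a≢c to u≢b)
    options : Two (Starred p a b u φ)
    options with soft a ≟′ b
    ... | inj₁ e with two-linked (fa-val k3 φ) (fb-val k3 φ) (sg a p) (sg b p) (esg a)
    ... | y , r , y' , r' , ne = y , star-linked k3 y e (weaken (λ { z0 → z0 }) v) r , y' , star-linked k3 y' e (weaken (λ { z0 → z0 }) v) r' , ne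
    options | inj₂ n with two-free (fa-val k3 φ) (fb-val k3 φ) (kill φ a) (kill φ b) (sg a p) (sg b p)
    ... | y , (r , q) , y' , (r' , q') , ne = y , star-free k3 y n (weaken (λ { z0 → z0 }) v) r q , y' , star-free k3 y' n (weaken (λ { z0 → z0 }) v) r' q' , ne
    build : Two (Starred p a b u φ) → State u p (far u p)
    build (y , s , y' , s' , ne) = record
      { d = U-orient uU (hard-sym (W-V wW) wu) ; φ₁ = Starred.ψ s ; φ₂ = Starred.ψ s' ; v₁ = Starred.val s ; v₂ = Starred.val s'
      ; diff = λ e → ne (trans (sym (Starred.new s)) (trans e (Starred.new s')))
      ; B = a ∷ b ∷ [] ; origin = star k3
      ; agree = λ t tp t∉ → trans (Starred.same s t tp (λ { refl → t∉ z0 }) (λ { refl → t∉ z1 }))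
                                  (sym (Starred.same s' t tp (λ { refl → t∉ z0 }) (λ { refl → t∉ z1 })))
      ; soft∉ = λ { (here e) → na e ; (there (here e)) → nb e }
      ; nadj = λ h → case all _ h of λ
          { (inj₁ e) → hard-≢ (HU.up (thread wW wu uU)) (sym e)
          ; (inj₂ (inj₁ e)) → far≢ wW wu uU wa aU e
          ; (inj₂ (inj₂ e)) → far≢ wW wu uU wb bU e } }

  -- Two or three threads between the same W-vertices

  module _ {w p u u' u''} (k : K3 w u u' u'') (pW : isW p ≡ true) (up : hard u p ≡ true) (u'p : hard u' p ≡ true) (p≢w : p ≢ w) where
    private
      open K3 k using (wd; wW; all) renaming (wa to wu; wb to wu'; wc to wu''; aU to uU; bU to u'U; cU to u''U; a≢b to u≢u'; a≢c to u≢u''; b≢c to u'≢u'')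
      f : Fin N
      f = far u'' w
      du : HU u w p
      du = U-two uU (hard-sym (W-V wW) wu) up (p≢w ∘ sym)
      du' : HU u' w p
      du' = U-two u'U (hard-sym (W-V wW) wu') u'p (p≢w ∘ sym)
      d'' : HU u'' f w
      d'' = thread wW wu'' u''U
      wp : hard w p ≡ true → ⊥
      wp h with all p h
      ... | inj₁ e = U≢W uU pW (sym e)
      ... | inj₂ (inj₁ e) = U≢W u'U pW (sym e)
      ... | inj₂ (inj₂ e) = U≢W u''U pW (sym e)

    module _ {t} (wp′ : WD p u u' t) (t≢u'' : t ≢ u'') {φ} (v : Valid (w ∷ []) φ) where
      private
        t≢w : t ≢ w
        t≢w refl = wp (hard-sym (W-V pW) (WD.wc wp′))

      double-free : soft u ≢ u' → soft u ≢ u'' → Full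
      double-free n₁ n₂ with double (sg u'' f · cls (φ f)) (kill φ u'') (kill φ u) (sg p t · cls (φ t))
                             (sg u'' w) (sg u w) (sg u p) (sg u' w) (sg u' p)
      ... | y , ry , next
        with addW₀ {X = u'' ∷ p ∷ u ∷ u' ∷ []} y wd z2 z3 z0 (weaken (λ { z0 → z0 }) v)
      ... | mkExt ψ₁ w₁ s₁ e₁
        with addR d'' w₁ (cong cls (s₁ f (HU.p≢w d''))) e₁ (cong cls (s₁ _ (soft≢W u''U wW))) ry
      -- The soft neighbour of `u'` may be `u''`, so the class forbidden at `u'` is settled only
      -- now.
      ... | _ , mkExt ψ₂ w₂ s₂ e₂ with next (kill ψ₂ u')
      ... | x , h , ru , ru'
        with addW₁ {X = u ∷ u' ∷ []} x wp′ z0 z1 w₂ (subst (λ α → H x (sg p t · cls α)) (sym (trans (s₂ t t≢u'') (s₁ t t≢w))) h)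
      ... | mkExt ψ₃ w₃ s₃ e₃
        with addR du w₃ (trans (cong cls (trans (s₃ w (p≢w ∘ sym)) (s₂ w (hard-≢ wu'')))) e₁) e₃
               (cong cls (trans (s₃ _ (soft≢W uU pW)) (trans (s₂ _ n₂) (s₁ _ (soft≢W uU wW))))) ru
      ... | _ , mkExt ψ₄ w₄ s₄ e₄
        with addR du' w₄ (trans (cong cls (trans (s₄ w (hard-≢ wu)) (trans (s₃ w (p≢w ∘ sym)) (s₂ w (hard-≢ wu''))))) e₁)
               (trans (cong cls (s₄ p (hard-≢ up ∘ sym))) e₃)
               (cong cls (trans (s₄ _ (λ q → n₁ (soft-flip u'U uU q))) (s₃ _ (soft≢W u'U pW)))) ru'
      ... | _ , mkExt ψ₅ w₅ _ _ = ψ₅ , w₅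

      double-soft : soft u ≡ u' → Full
      double-soft e with double-linked (sg u'' f · cls (φ f)) (kill φ u'') (sg p t · cls (φ t)) (esg u)
                             (sg u'' w) (sg u w) (sg u p) (sg u' w) (sg u' p)
      ... | y , ry , x , h , (k , g , k' , g' , ne)
        with addW₀ {X = u'' ∷ p ∷ u' ∷ u ∷ []} y wd z3 z2 z0 (weaken (λ { z0 → z0 }) v)
      ... | mkExt ψ₁ w₁ s₁ e₁
        with addR d'' w₁ (cong cls (s₁ f (HU.p≢w d''))) e₁ (cong cls (s₁ _ (soft≢W u''U wW))) ry
      ... | _ , mkExt ψ₂ w₂ s₂ e₂
        with addW₁ {X = u' ∷ u ∷ []} x wp′ z1 z0 w₂ (subst (λ α → H x (sg p t · cls α)) (sym (trans (s₂ t t≢u'') (s₁ t t≢w))) h)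
      ... | mkExt ψ₃ w₃ s₃ e₃
        with addGx du' w₃ (trans (cong cls (trans (s₃ w (p≢w ∘ sym)) (s₂ w (hard-≢ wu'')))) e₁) e₃
               (subst (_∈ u ∷ []) (sym (soft-flip uU u'U e)) z0) g'
      ... | mkExt ψ₄ w₄ s₄ e₄
        with addG du w₄ (trans (cong cls (trans (s₄ w (hard-≢ wu')) (trans (s₃ w (p≢w ∘ sym)) (s₂ w (hard-≢ wu''))))) e₁)
               (trans (cong cls (s₄ p (hard-≢ u'p ∘ sym))) e₃) (trans (cong (cls ∘ ψ₄) e) e₄) g ne
      ... | mkExt ψ₅ w₅ _ _ = ψ₅ , w₅

    module _ (u''p : hard u'' p ≡ true) (wp′ : WD p u u' u'') {φ} (v : Valid (w ∷ []) φ) where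
      private
        d₃ : HU u'' w p
        d₃ = U-two u''U (hard-sym (W-V wW) wu'') u''p (p≢w ∘ sym)

      triple-free : soft u ≢ u' → soft u ≢ u'' → soft u' ≢ u'' → Full
      triple-free n₁ n₂ n₃ with triple (kill φ u) (kill φ u') (kill φ u'') (sg u w) (sg u p) (sg u' w) (sg u' p) (sg u'' w) (sg u'' p)
      ... | y , x , r , r' , r''
        with addW₀ {X = p ∷ u ∷ u' ∷ u'' ∷ []} y wd z1 z2 z3 (weaken (λ { z0 → z0 }) v)
      ... | mkExt ψ₁ w₁ s₁ e₁ with addW₀ {X = u ∷ u' ∷ u'' ∷ []} x wp′ z0 z1 z2 w₁
      ... | mkExt ψ₂ w₂ s₂ e₂
        with addR du w₂ (trans (cong cls (s₂ w (p≢w ∘ sym))) e₁) e₂ (cong cls (trans (s₂ _ (soft≢W uU pW)) (s₁ _ (soft≢W uU wW)))) r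
      ... | _ , mkExt ψ₃ w₃ s₃ _
        with addR du' w₃ (trans (cong cls (trans (s₃ w (hard-≢ wu)) (s₂ w (p≢w ∘ sym)))) e₁)
               (trans (cong cls (s₃ p (hard-≢ up ∘ sym))) e₂)
               (cong cls (trans (s₃ _ (λ q → n₁ (soft-flip u'U uU q))) (trans (s₂ _ (soft≢W u'U pW)) (s₁ _ (soft≢W u'U wW))))) r'
      ... | _ , mkExt ψ₄ w₄ s₄ _
        with addR d₃ w₄ (trans (cong cls (trans (s₄ w (hard-≢ wu')) (trans (s₃ w (hard-≢ wu)) (s₂ w (p≢w ∘ sym))))) e₁)
               (trans (cong cls (trans (s₄ p (hard-≢ u'p ∘ sym)) (s₃ p (hard-≢ up ∘ sym)))) e₂)
               (cong cls (trans (s₄ _ (λ q → n₃ (soft-flip u''U u'U q))) (trans (s₃ _ (λ q → n₂ (soft-flip u''U uU q)))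
                 (trans (s₂ _ (soft≢W u''U pW)) (s₁ _ (soft≢W u''U wW)))))) r''
      ... | _ , mkExt ψ₅ w₅ _ _ = ψ₅ , w₅

      triple-soft : soft u ≢ u' → soft u ≢ u'' → soft u' ≡ u'' → Full
      triple-soft n₁ n₂ e with triple-linked (kill φ u) (esg u') (sg u w) (sg u p) (sg u' w) (sg u' p) (sg u'' w) (sg u'' p)
      ... | y , x , r , (k , g , k' , g' , ne)
        with addW₀ {X = p ∷ u ∷ u'' ∷ u' ∷ []} y wd z1 z3 z2 (weaken (λ { z0 → z0 }) v)
      ... | mkExt ψ₁ w₁ s₁ e₁ with addW₀ {X = u ∷ u'' ∷ u' ∷ []} x wp′ z0 z2 z1 w₁
      ... | mkExt ψ₂ w₂ s₂ e₂
        with addR du w₂ (trans (cong cls (s₂ w (p≢w ∘ sym))) e₁) e₂ (cong cls (trans (s₂ _ (soft≢W uU pW)) (s₁ _ (soft≢W uU wW)))) r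
      ... | _ , mkExt ψ₃ w₃ s₃ _
        with addGx d₃ w₃ (trans (cong cls (trans (s₃ w (hard-≢ wu)) (s₂ w (p≢w ∘ sym)))) e₁)
               (trans (cong cls (s₃ p (hard-≢ up ∘ sym))) e₂) (subst (_∈ u' ∷ []) (sym (soft-flip u'U u''U e)) z0) g'
      ... | mkExt ψ₄ w₄ s₄ e₄
        with addG du' w₄ (trans (cong cls (trans (s₄ w (hard-≢ wu'')) (trans (s₃ w (hard-≢ wu)) (s₂ w (p≢w ∘ sym))))) e₁)
               (trans (cong cls (trans (s₄ p (hard-≢ u''p ∘ sym)) (s₃ p (hard-≢ up ∘ sym)))) e₂)
               (trans (cong (cls ∘ ψ₄) e) e₄) g ne
      ... | mkExt ψ₅ w₅ _ _ = ψ₅ , w₅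

    triple-thread : hard u'' p ≡ true → soft u ≢ u' → soft u ≢ u'' → ⊥
    triple-thread u''p n₁ n₂ with W-two pW (hard-sym (U-V uU) up) (hard-sym (U-V u'U) u'p) u≢u'
    ... | t , wp′ with WD.all wp′ u'' (hard-sym (U-V u''U) u''p) | soft u' ≟′ u''
    ... | inj₁ e | _ = u≢u'' (sym e)
    ... | inj₂ (inj₁ e) | _ = u'≢u'' (sym e)
    ... | inj₂ (inj₂ refl) | inj₁ e = stuck (triple-soft u''p wp′ (proj₂ (crit w (W-V wW))) n₁ n₂ e)
    ... | inj₂ (inj₂ refl) | inj₂ n = stuck (triple-free u''p wp′ (proj₂ (crit w (W-V wW))) n₁ n₂ n)

  no-double-thread : ∀ {w p u u' u''} → K3 w u u' u'' → isW p ≡ true → hard u p ≡ true → hard u' p ≡ true → p ≢ w → ⊥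
  no-double-thread {w} {p} {u} {u'} {u''} k pW up u'p p≢w
    with W-two pW (hard-sym (U-V (K3.aU k)) up) (hard-sym (U-V (K3.bU k)) u'p) (K3.a≢b k)
  ... | t , wp′ with t ≟′ u''
  ... | inj₁ refl = all-three (loner k)
    where
    ends : ∀ x → hard w x ≡ true → hard x p ≡ true
    ends x h with K3.all k x h
    ... | inj₁ refl = up
    ... | inj₂ (inj₁ refl) = u'p
    ... | inj₂ (inj₂ refl) = hard-sym (W-V pW) (WD.wc wp′)
    all-three : (∃₂ λ a b → Σ (Fin N) λ c → K3 w a b c × soft a ≢ b × soft a ≢ c) → ⊥
    all-three (a , b , c , k' , n₁ , n₂) =
      triple-thread k' pW (ends a (K3.wa k')) (ends b (K3.wb k')) p≢w (ends c (K3.wc k')) n₁ n₂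
  ... | inj₂ ne with soft u ≟′ u' | soft u ≟′ u''
  ... | inj₁ e  | _       = stuck (double-soft k pW up u'p p≢w wp′ ne (proj₂ (crit w (W-V (K3.wW k)))) e)
  ... | inj₂ n₁ | inj₂ n₂ = stuck (double-free k pW up u'p p≢w wp′ ne (proj₂ (crit w (W-V (K3.wW k)))) n₁ n₂)
  -- Since `u` is linked to `u''`, the arm `u'` is linked to neither and takes over the role of `u`.
  ... | inj₂ n₁ | inj₁ e  = stuck (double-free (K3-swap (K3-rot k)) pW u'p up p≢w (WD-swap (WD-rot wp′)) ne (proj₂ (crit w (W-V (K3.wW k))))
    (λ q → n₁ (soft-flip (K3.bU k) (K3.aU k) q))
    (λ q → K3.a≢b k (soft-inj (K3.aU k) (K3.bU k) (subst (λ o → isU o ≡ true) (sym e) (K3.cU k)) (trans e (sym q)))))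

  far-¬U : ∀ {w a b c} → K3 w a b c → isU (far a w) ≡ true → ⊥
  far-¬U k fU = no-pair-star (thread (K3.wW k) (K3.wa k) (K3.aU k)) fU k

  far-≢U : ∀ {w a b c x} → K3 w a b c → isU x ≡ true → far a w ≢ x
  far-≢U k xU refl = far-¬U k xU

  far-≢W : ∀ {w u a b p} → K3 w u a b → isW p ≡ true → hard u p ≡ true → p ≢ w → far a w ≢ p
  far-≢W k pW up ne refl = no-double-thread k pW up (HU.up (thread (K3.wW k) (K3.wb k) (K3.bU k))) ne

  -- This is the case in which both forbidden classes at the end star vary: `a` and `b` are linked
  -- to the two arms recoloured at the start star. No choice at `p` is inherited; all seven vertices
  -- are opened, and `cross` picks the classes of `p` and `w` together.
  crossed : ∀ {p w u a b c d φ} → HU u p w → K3 w u a b → K3 p u c d → soft a ≡ c → soft b ≡ d → Valid (u ∷ []) φ → Full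
  crossed {p} {w} {u} {a} {b} {c} {d} {φ} du kw kp ac bd v = go
    where
    open HU du using (p≢w; uU; up; uw)
    open K3 kw using (wW) renaming (wd to dw; wa to wu; wb to wa; wc to wb; bU to aU; cU to bU; a≢b to u≢a; a≢c to u≢b; b≢c to a≢b)
    open K3 kp using () renaming (wd to dp; wW to pW; wa to pu; wb to pc; wc to pd; bU to cU; cU to dU; a≢b to u≢c; a≢c to u≢d; b≢c to c≢d)
    fa fb fc fd : Fin N
    fa = far a w
    fb = far b w
    fc = far c p
    fd = far d p
    ta = thread wW wa aU
    tb = thread wW wb bU
    tc = thread pW pc cU
    td = thread pW pd dU
    ca : soft c ≡ a
    ca = soft-flip aU cU ac
    tb′ : soft d ≡ b
    tb′ = soft-flip bU dU bd
    fb≢ : ∀ {x} → isU x ≡ true → fb ≢ x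
    fb≢ = far-≢U (K3-rot (K3-rot kw))
    fc≢ : ∀ {x} → isU x ≡ true → fc ≢ x
    fc≢ = far-≢U (K3-rot kp)
    fd≢ : ∀ {x} → isU x ≡ true → fd ≢ x
    fd≢ = far-≢U (K3-rot (K3-rot kp))
    fa≢p : fa ≢ p
    fa≢p = far-≢W kw pW up p≢w
    fb≢p : fb ≢ p
    fb≢p = far-≢W (K3-swap kw) pW up p≢w
    fc≢w : fc ≢ w
    fc≢w = far-≢W kp wW uw (p≢w ∘ sym)
    fd≢w : fd ≢ w
    fd≢w = far-≢W (K3-swap kp) wW uw (p≢w ∘ sym)
    -- u is linked to none of a, b, c, d, since a–c and b–d are linked.
    soft≢a : soft u ≢ a
    soft≢a e = u≢c (trans (sym (soft-flip uU aU e)) ac)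
    soft≢b : soft u ≢ b
    soft≢b e = u≢d (trans (sym (soft-flip uU bU e)) bd)
    soft≢c : soft u ≢ c
    soft≢c e = u≢a (trans (sym (soft-flip uU cU e)) ca)
    soft≢d : soft u ≢ d
    soft≢d e = u≢b (trans (sym (soft-flip uU dU e)) tb′)
    p≢U : ∀ {x} → isU x ≡ true → p ≢ x
    p≢U xU e = U≢W xU pW (sym e)
    w≢U : ∀ {x} → isU x ≡ true → w ≢ x
    w≢U xU e = U≢W xU wW (sym e)
    e₁ e₂ : Sign
    e₁ = (sg c p ⊗ sg u p) ⊗ (esg c ⊗ (sg a w ⊗ sg u w))
    e₂ = (sg d p ⊗ sg u p) ⊗ (esg d ⊗ (sg b w ⊗ sg u w))
    -- The classes of p and w are sg u p · x and sg u w · y, so that the signs at u disappear.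
    go : Full
    go with cross (kill φ u) ((sg c p ⊗ sg u p) · (sg c fc · cls (φ fc))) ((sg d p ⊗ sg u p) · (sg d fd · cls (φ fd)))
                  ((sg a w ⊗ sg u w) · (sg a fa · cls (φ fa))) ((sg b w ⊗ sg u w) · (sg b fb · cls (φ fb))) e₁ e₂
    ... | x , y , r , pac , pbd with Pairs-shift (sg c p) (sg u p) (sg a w) (sg u w) (esg c) _ x _ y pac
                                   | Pairs-shift (sg d p) (sg u p) (sg b w) (sg u w) (esg d) _ x _ y pbd
    ... | kc , gc , ka , ga , nac | kd , gd , kb , gb , nbd
      with addW₀ {X = w ∷ a ∷ c ∷ b ∷ d ∷ u ∷ []} (sg u p · x) dp z5 z2 z4 (weaken (λ { z0 → z6 }) v)
    ... | mkExt ψ₁ v₁ s₁ n₁ with addW₀ {X = a ∷ c ∷ b ∷ d ∷ u ∷ []} (sg u w · y) dw z4 z0 z2 v₁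
    ... | mkExt ψ₂ v₂ s₂ n₂
      with addGx ta v₂ (cong cls (trans (s₂ fa (far≢w wW wa aU)) (s₁ fa fa≢p))) n₂ (subst (_∈ c ∷ b ∷ d ∷ u ∷ []) (sym ac) z0) ga
    ... | mkExt ψ₃ v₃ s₃ n₃
      with addG tc v₃ (cong cls (trans (s₃ fc (fc≢ aU)) (trans (s₂ fc fc≢w) (s₁ fc (far≢w pW pc cU)))))
             (trans (cong cls (trans (s₃ p (p≢U aU)) (s₂ p p≢w))) n₁) (trans (cong (cls ∘ ψ₃) ca) n₃) gc nac
    ... | mkExt ψ₄ v₄ s₄ n₄
      with addGx tb v₄ (cong cls (trans (s₄ fb (fb≢ cU)) (trans (s₃ fb (fb≢ aU)) (trans (s₂ fb (far≢w wW wb bU)) (s₁ fb fb≢p)))))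
             (trans (cong cls (trans (s₄ w (w≢U cU)) (s₃ w (w≢U aU)))) n₂) (subst (_∈ d ∷ u ∷ []) (sym bd) z0) gb
    ... | mkExt ψ₅ v₅ s₅ n₅
      with addG td v₅ (cong cls (trans (s₅ fd (fd≢ bU)) (trans (s₄ fd (fd≢ cU)) (trans (s₃ fd (fd≢ aU)) (trans (s₂ fd fd≢w) (s₁ fd (far≢w pW pd dU)))))))
             (trans (cong cls (trans (s₅ p (p≢U bU)) (trans (s₄ p (p≢U cU)) (trans (s₃ p (p≢U aU)) (s₂ p p≢w))))) n₁)
             (trans (cong (cls ∘ ψ₅) tb′) n₅) gd nbd
    ... | mkExt ψ₆ v₆ s₆ n₆
      with addR du v₆
             (trans (cong cls (trans (s₆ p (p≢U dU)) (trans (s₅ p (p≢U bU)) (trans (s₄ p (p≢U cU)) (trans (s₃ p (p≢U aU)) (s₂ p p≢w)))))) n₁)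
             (trans (cong cls (trans (s₆ w (w≢U dU)) (trans (s₅ w (w≢U bU)) (trans (s₄ w (w≢U cU)) (s₃ w (w≢U aU)))))) n₂)
             (cong cls (trans (s₆ _ soft≢d) (trans (s₅ _ soft≢b) (trans (s₄ _ soft≢c) (trans (s₃ _ soft≢a)
               (trans (s₂ _ (soft≢W uU wW)) (s₁ _ (soft≢W uU pW))))))))
             (subst (λ α → R α (sg u w · sg u w · y) (kill φ u)) (sym (·-invol (sg u p) x))
               (subst (λ β → R x β (kill φ u)) (sym (·-invol (sg u w) y)) r))
    ... | _ , mkExt χ v₇ _ _ = χ , v₇

  K2-swap : ∀ {w u u' c} → K2 w u u' c → K2 w u' u c
  K2-swap (mkK2 d uU u'U cN) = mkK2 (WD-swap (WD-rot d)) u'U uU cN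

  -- The third neighbour c of w is the far end of u', so that w, u', c is a triangle; recolour w and c together.
  module Chord {p w u u' u'' c : Fin N} (s : State u p w) (kw : K2 w u u' c) (kc : K2 c u' u'' w) (ne : soft u ≢ u') where
    open State s using (φ₁; v₁; p≢w; nadj; uU; up; uw) renaming (d to du; all to allu)
    open K2 kw using (wW; wu; wu'; wc; u≢u'; u'U; cN) renaming (wd to dw; all to allw)
    open K2 kc using () renaming (wd to dc; wW to cW; wu to cu'; wu' to cu''; wc to cw; u≢u' to u'≢u''; u'U to u''U; all to allc)

    private
      d' : HU u' w c
      d' = U-two u'U (hard-sym (W-V wW) wu') (hard-sym (W-V cW) cu') (hard-≢ wc)

      u''≢u : u'' ≢ u
      u''≢u refl with allu c (hard-sym (W-V cW) cu'')
      ... | inj₁ refl = nadj cw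
      ... | inj₂ e = hard-≢ wc (sym e)

      far≢w′ : far u'' c ≢ w
      far≢w′ e with allw u'' (hard-sym (U-V u''U) (subst (λ x → hard u'' x ≡ true) e (HU.up (thread cW cu'' u''U))))
      ... | inj₁ q = u''≢u q
      ... | inj₂ (inj₁ q) = u'≢u'' (sym q)
      ... | inj₂ (inj₂ q) = U≢W u''U cW q

      begin : ∀ {X} {Y : Set} x → R (sg u p · cls (φ₁ p)) (sg u w · x) (kill φ₁ u) → u ∈ u ∷ c ∷ X → u' ∈ X → Valid (w ∷ u ∷ c ∷ X) φ₁ →
        (∀ {ψ} → Valid (c ∷ X) ψ → (∀ t → t ≢ w → t ≢ u → ψ t ≡ φ₁ t) → cls (ψ w) ≡ x → Y) → Y
      begin {X} x r u∈ u'∈ v k with addW₀ {X = u ∷ c ∷ X} x dw u∈ (there (there u'∈)) (there z0) v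
      ... | mkExt ψ₁ v₁ s₁ e₁ with addR du v₁ (cong cls (s₁ p p≢w)) e₁ (cong cls (s₁ _ (soft≢W uU wW))) r
      ... | _ , mkExt ψ₂ v₂ s₂ e₂ = k v₂ (λ t tw tu → trans (s₂ t tu) (s₁ t tw)) (trans (cong cls (s₂ w (hard-≢ wu))) e₁)

    -- `w` gets one class that suits `u` and leaves `c` two classes suiting `u'`. The choice jumps
    -- over the triangle to `c`, with `u''` as the next open vertex.
    chord-state : soft u' ≢ u'' → State u'' c (far u'' c)
    chord-state ne' with chord (sg u p · cls (φ₁ p)) (kill φ₁ u) (kill φ₁ u') (sg c w) (sg u w) (sg u' w) (sg u' c)
    ... | x , r , y , (h , q) , y' , (h' , q') , y≢y' =
      begin {X = u' ∷ u'' ∷ []} x r z0 z0 (weaken (λ { z0 → z1 }) v₁) build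
      where
      build : ∀ {ψ} → Valid (c ∷ u' ∷ u'' ∷ []) ψ → (∀ t → t ≢ w → t ≢ u → ψ t ≡ φ₁ t) → cls (ψ w) ≡ x → State u'' c (far u'' c)
      build {ψ} v sm e = record
        { d = HU-flip (thread cW cu'' u''U) ; φ₁ = Move.χ (move h q) ; φ₂ = Move.χ (move h' q')
        ; v₁ = Move.val (move h q) ; v₂ = Move.val (move h' q')
        ; diff = λ e → y≢y' (trans (sym (Move.new (move h q))) (trans e (Move.new (move h' q'))))
        ; B = u' ∷ [] ; origin = chain kc
        ; agree = λ t tc tB → trans (Move.same (move h q) t tc (λ { refl → tB z0 })) (sym (Move.same (move h' q') t tc (λ { refl → tB z0 })))
        ; soft∉ = λ { (here e) → ne' (soft-flip u''U u'U e) }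
        ; nadj = λ h → case allc _ h of λ
            { (inj₁ e) → far≢ cW cu'' u''U cu' u'U e
            ; (inj₂ (inj₁ e)) → hard-≢ (HU.up (thread cW cu'' u''U)) (sym e)
            ; (inj₂ (inj₂ e)) → far≢w′ e } }
        where
        record Move (z : K) : Set where
          field
            χ    : Fin N → Colour
            val  : Valid (u'' ∷ []) χ
            same : ∀ t → t ≢ c → t ≢ u' → χ t ≡ ψ t
            new  : cls (χ c) ≡ z
        move : ∀ {z} → H z (sg c w · x) → R (sg u' w · x) (sg u' c · z) (kill φ₁ u') → Move z
        move {z} h q with addW₁ {X = u' ∷ u'' ∷ []} z dc z0 z1 v (subst (λ κ → H z (sg c w · κ)) (sym e) h)
        ... | mkExt χ₁ w₁ s₁ e₁
          with addR d' w₁ (trans (cong cls (s₁ w (hard-≢ wc))) e) e₁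
                 (cong cls (trans (s₁ _ (soft≢W u'U cW)) (sm _ (soft≢W u'U wW) (λ o → ne (soft-flip u'U uU o))))) q
        ... | _ , mkExt χ₂ w₂ s₂ _ = record { χ = χ₂ ; val = w₂ ; same = λ t tc tu → trans (s₂ t tu) (s₁ t tc)
                                            ; new = trans (cong cls (s₂ c (hard-≢ cu'))) e₁ }

    chord-full : soft u' ≡ u'' → Full
    chord-full e₀ with chord-linked (sg u p · cls (φ₁ p)) (kill φ₁ u) (sg u'' (far u'' c) · cls (φ₁ (far u'' c)))
                              (sg c w) (sg u w) (sg u' w) (sg u' c) (sg u'' c) (esg u')
    ... | x , r , y , h , (k , g , k' , g' , nk) =
      begin {X = u'' ∷ u' ∷ []} x r z0 z1 (weaken (λ { z0 → z1 }) v₁) build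
      where
      d'' : HU u'' (far u'' c) c
      d'' = thread cW cu'' u''U
      far≢u : far u'' c ≢ u
      far≢u e with allu u'' (hard-sym (U-V u''U) (subst (λ x → hard u'' x ≡ true) e (HU.up d'')))
      ... | inj₂ q = U≢W u''U wW q
      ... | inj₁ refl = no-pair-linked (U-two u''U (hard-sym (U-V uU) up) (hard-sym (W-V cW) cu'') λ { refl → U≢W uU cW refl })
                          uU (K2-swap kc) (soft-flip u'U u''U e₀)
      build : ∀ {ψ} → Valid (c ∷ u'' ∷ u' ∷ []) ψ → (∀ t → t ≢ w → t ≢ u → ψ t ≡ φ₁ t) → cls (ψ w) ≡ x → Full
      build {ψ} v sm e with addW₁ {X = u'' ∷ u' ∷ []} y dc z1 z0 v (subst (λ κ → H y (sg c w · κ)) (sym e) h)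
      ... | mkExt χ₁ w₁ s₁ e₁
        with addGx d'' w₁ (cong cls (trans (s₁ _ (far≢w cW cu'' u''U)) (sm _ far≢w′ far≢u))) e₁
               (subst (_∈ u' ∷ []) (sym (soft-flip u'U u''U e₀)) z0) g'
      ... | mkExt χ₂ w₂ s₂ e₂
        with addG d' w₂ (trans (cong cls (trans (s₂ w (λ q → U≢W u''U wW (sym q))) (s₁ w (hard-≢ wc)))) e)
               (trans (cong cls (s₂ c (hard-≢ cu''))) e₁) (trans (cong (cls ∘ χ₂) e₀) e₂) g nk
      ... | mkExt χ₃ w₃ _ _ = χ₃ , w₃

  -- Walks and the ends they reach

  opaque
    hardU : Fin N → Fin N → Bool
    hardU w x = hard w x ∧ isU x

    hardU-h : ∀ {w x} → hardU w x ≡ true → hard w x ≡ true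
    hardU-h {w} {x} h = ∧₁ {hard w x} h

    hardU-U : ∀ {w x} → hardU w x ≡ true → isU x ≡ true
    hardU-U {w} {x} h = ∧₂ {hard w x} h

    hardU-intro : ∀ {w x} → hard w x ≡ true → isU x ≡ true → hardU w x ≡ true
    hardU-intro {w} {x} = ∧ᵢ {hard w x}

    other : Fin N → Fin N → Fin N
    other w u = find (hardU w ∖ u) w

    other-spec : ∀ {w u u'} → Duo (hardU w) u u' → other w u ≡ u'
    other-spec {w} {u} {u'} (hu , hu' , ne , al) with ∖-in {p = hardU w} (find-sound (hardU w ∖ u) w u' (in-∖ {p = hardU w} hu' (ne ∘ sym)))
    ... | h , n with al _ h
    ... | inj₁ e = ⊥-elim (n e)
    ... | inj₂ e = e

  Trio-K3 : ∀ {w a b c} → isW w ≡ true → Trio (hardU w) a b c → K3 w a b c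
  Trio-K3 {w} wW (ha , hb , hc , ab , ac , bc , _) with W-two wW (hardU-h ha) (hardU-h hb) ab
  ... | x , d with WD.all d _ (hardU-h hc)
  ... | inj₁ e = ⊥-elim (ac (sym e))
  ... | inj₂ (inj₁ e) = ⊥-elim (bc (sym e))
  ... | inj₂ (inj₂ refl) = mkK3 d (hardU-U ha) (hardU-U hb) (hardU-U hc)

  star-at : ∀ {w u} → isW w ≡ true → # (hardU w) ≡ 3 → hard w u ≡ true → isU u ≡ true → ∃₂ λ a b → K3 w u a b
  star-at {w} {u} wW e wu uU with #-three (hardU w) e
  ... | a , b , c , t with proj₂ (proj₂ (proj₂ (proj₂ (proj₂ (proj₂ t))))) u (hardU-intro wu uU)
  ... | inj₁ refl = b , c , Trio-K3 wW t
  ... | inj₂ (inj₁ refl) = c , a , K3-rot (Trio-K3 wW t)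
  ... | inj₂ (inj₂ refl) = a , b , K3-rot (K3-rot (Trio-K3 wW t))

  duo-at : ∀ {w u} → # (hardU w) ≡ 2 → hard w u ≡ true → isU u ≡ true → Duo (hardU w) u (other w u)
  duo-at {w} {u} e wu uU with #-two (hardU w) e
  ... | a , b , t@(ha , hb , ne , al) with al u (hardU-intro wu uU)
  ... | inj₁ refl = subst (Duo (hardU w) u) (sym (other-spec t)) t
  ... | inj₂ refl = subst (Duo (hardU w) u) (sym (other-spec t')) t'
    where t' = hb , ha , ne ∘ sym , λ x h → case al x h of λ { (inj₁ q) → inj₂ q ; (inj₂ q) → inj₁ q }

  link-at : ∀ {w u} → isW w ≡ true → # (hardU w) ≡ 2 → hard w u ≡ true → isU u ≡ true → ∃ λ c → K2 w u (other w u) c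
  link-at {w} {u} wW e wu uU with duo-at e wu uU
  ... | hu , ho , ne , al with W-two wW wu (hardU-h ho) ne
  ... | c , d = c , mkK2 d uU (hardU-U ho) λ cU → case al c (hardU-intro (WD.wc d) cU) of λ
        { (inj₁ q) → WD.a≢c d (sym q) ; (inj₂ q) → WD.b≢c d (sym q) }

  -- Within k steps, the walk that enters w from u and leaves a vertex by its other U-neighbour reaches an end
  -- where a colouring with two choices at the start can always be completed.
  reach : ℕ → Fin N → Fin N → Bool
  reach zero    u w = false
  reach (suc k) u w = isU w ∨ (isW w ∧ ((# (hardU w) ≡ᵇ 3) ∨
    ((# (hardU w) ≡ᵇ 2) ∧ ((soft u == other w u) ∨ reach k (other w u) (far (other w u) w)))))

  data Reach (k : ℕ) (u w : Fin N) : Set where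
    atU    : isU w ≡ true → Reach k u w
    atStar : ∀ {a b} → K3 w u a b → Reach k u w
    linked : ∀ {c} → K2 w u (other w u) c → soft u ≡ other w u → Reach k u w
    onward : ∀ {c} → K2 w u (other w u) c → reach k (other w u) (far (other w u) w) ≡ true → Reach k u w

  reach-view : ∀ k {u w} → isU u ≡ true → hard w u ≡ true → reach (suc k) u w ≡ true → Reach k u w
  reach-view k {u} {w} uU wu h with isU w in eU | isW w in eW | # (hardU w) ≡ᵇ 3 in e3 | # (hardU w) ≡ᵇ 2 in e2 | soft u == other w u in es
  ... | true | _ | _ | _ | _ = atU eU
  ... | false | true | true | _ | _ = atStar (proj₂ (proj₂ (star-at eW (≡ᵇ-sound e3) wu uU)))
  ... | false | true | false | true | true = linked (proj₂ (link-at eW (≡ᵇ-sound e2) wu uU)) (==-sound es)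
  ... | false | true | false | true | false = onward (proj₂ (link-at eW (≡ᵇ-sound e2) wu uU)) h

  origin-p : ∀ {u p w} (s : State u p w) → isU p ≡ true ⊎ isW p ≡ true
  origin-p s with State.B s | State.origin s
  ... | _ | fromU pU = inj₁ pU
  ... | _ | chain k  = inj₂ (K2.wW k)
  ... | _ | star k   = inj₂ (K3.wW k)

  run-star : ∀ {u p w a b} → State u p w → K3 w u a b → Full
  run-star {u} {p} {w} {a} {b} s k = term-star s k (f≢p k) (f≢p (K3-swap k)) (f∉B k) (f∉B (K3-swap k)) (crossing s)
    where
    open State s
    f≢p : ∀ {a b} → K3 w u a b → far a w ≢ p
    f≢p k with origin-p s
    ... | inj₁ pU = far-≢U (K3-rot k) pU
    ... | inj₂ pW = far-≢W k pW up p≢w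
    f∉B : ∀ {a b} → K3 w u a b → far a w ∉ State.B s
    f∉B k i = far-¬U (K3-rot k) (BU i)
    aU = K3.bU k
    bU = K3.cU k
    same-soft : soft a ≡ soft b → isU (soft a) ≡ true → ⊥
    same-soft e oU = K3.b≢c k (soft-inj aU bU oU e)
    crossing : (s : State u p w) → kill (State.φ₁ s) a ≢ kill (State.φ₂ s) a → kill (State.φ₁ s) b ≢ kill (State.φ₂ s) b → Full
    crossing s na nb = go (State.origin s) (varies s na) (varies s nb)
      where
      go : ∀ {B} → Origin u p B → soft a ≡ p ⊎ soft a ∈ B → soft b ≡ p ⊎ soft b ∈ B → Full
      go (fromU pU) (inj₁ e) (inj₁ e') = ⊥-elim (same-soft (trans e (sym e')) (subst (λ o → isU o ≡ true) (sym e) pU))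
      go (chain k₂) (inj₁ e) _ = ⊥-elim (soft≢W aU (K2.wW k₂) e)
      go (chain k₂) (inj₂ _) (inj₁ e) = ⊥-elim (soft≢W bU (K2.wW k₂) e)
      go (chain k₂) (inj₂ (here e)) (inj₂ (here e')) = ⊥-elim (same-soft (trans e (sym e')) (subst (λ o → isU o ≡ true) (sym e) (K2.uU k₂)))
      go (star k₃) (inj₁ e) _ = ⊥-elim (soft≢W aU (K3.wW k₃) e)
      go (star k₃) (inj₂ _) (inj₁ e) = ⊥-elim (soft≢W bU (K3.wW k₃) e)
      go (star k₃) (inj₂ (here e)) (inj₂ (here e')) = ⊥-elim (same-soft (trans e (sym e')) (subst (λ o → isU o ≡ true) (sym e) (K3.bU k₃)))
      go (star k₃) (inj₂ (there (here e))) (inj₂ (there (here e'))) = ⊥-elim (same-soft (trans e (sym e')) (subst (λ o → isU o ≡ true) (sym e) (K3.cU k₃)))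
      go (star k₃) (inj₂ (here e)) (inj₂ (there (here e'))) = crossed d k k₃ e e' v₁
      go (star k₃) (inj₂ (there (here e))) (inj₂ (here e')) = crossed d (K3-swap k) k₃ e' e v₁

  run-linked : ∀ {u p w u' c} → State u p w → K2 w u u' c → soft u ≡ u' → Full
  run-linked {u} {p} {w} {u'} s k e = term-linked s k e (f≢p (State.origin s) soft∉) f∉B
    where
    open State s
    u'U = K2.u'U k
    d' = thread (K2.wW k) (K2.wu' k) u'U
    f∉B : far u' w ∉ State.B s
    f∉B i = no-pair-linked d' (BU i) (K2-swap k) (soft-flip uU u'U e)
    f≢p : ∀ {B} → Origin u p B → soft u ∉ B → far u' w ≢ p
    f≢p o so refl = go o so (hard-sym (U-V u'U) (HU.up d'))
      where
      go : ∀ {B} → Origin u p B → soft u ∉ B → hard p u' ≡ true → ⊥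
      go (fromU pU) _ pu' = no-three (U-two pU (hard-sym (U-V uU) up) pu' (K2.u≢u' k)) uU u'U
      go (chain k₂) so pu' with K2.all k₂ u' pu'
      ... | inj₁ q = so (subst (_∈ _ ∷ []) (sym (trans e q)) z0)
      ... | inj₂ (inj₁ q) = K2.u≢u' k (sym q)
      ... | inj₂ (inj₂ q) = K2.cN k₂ (subst (λ o → isU o ≡ true) q u'U)
      go (star k₃) so pu' with K3.all k₃ u' pu'
      ... | inj₁ q = K2.u≢u' k (sym q)
      ... | inj₂ (inj₁ q) = so (subst (_∈ _ ∷ _ ∷ []) (sym (trans e q)) z0)
      ... | inj₂ (inj₂ q) = so (subst (_∈ _ ∷ _ ∷ []) (sym (trans e q)) z1)

  -- Induction on the length of the walk. `advance` requires that `w` is not adjacent to the next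
  -- vertex; if it is, that vertex is the third neighbour of `w`, and `Chord` takes two steps at
  -- once or completes the colouring.
  run : ∀ k {u p w} → State u p w → reach k u w ≡ true → Full
  run zero s ()
  run (suc k) {u} {p} {w} s h with reach-view k (State.uU s) (hard-sym (U-V (State.uU s)) (State.uw s)) h
  ... | atU wU = term-U s wU λ i → no-three (U-orient wU wu) uU (BU i)
    where
    open State s
    wu = hard-sym (U-V uU) uw
  ... | atStar k₃ = run-star s k₃
  ... | linked k₂ e = run-linked s k₂ e
  ... | onward {c} k₂ h' with soft u ≟′ other w u | hard w (far (other w u) w) in adj
  ... | inj₁ e | _ = run-linked s k₂ e
  ... | inj₂ ne | false = run k (advance s k₂ ne (λ q → t≢f q adj)) h'
  ... | inj₂ ne | true with K2.all k₂ _ adj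
  ... | inj₁ e = ⊥-elim (far≢ (K2.wW k₂) (K2.wu' k₂) (K2.u'U k₂) (K2.wu k₂) (K2.uU k₂) e)
  ... | inj₂ (inj₁ e) = ⊥-elim (hard-≢ (HU.up (thread (K2.wW k₂) (K2.wu' k₂) (K2.u'U k₂))) (sym e))
  ... | inj₂ (inj₂ e) = chording k h'
    where
    u' = other w u
    u'U = K2.u'U k₂
    wW = K2.wW k₂
    dc : HU u' c w
    dc = subst (λ x → HU u' x w) e (thread wW (K2.wu' k₂) u'U)
    third-is-w : ∀ {x} → K2 c u' (other c u') x → K2 c u' (other c u') w
    third-is-w kc with K2.all kc w (hard-sym (W-V wW) (K2.wc k₂))
    ... | inj₁ q = ⊥-elim (U≢W u'U wW (sym q))
    ... | inj₂ (inj₁ q) = ⊥-elim (U≢W (K2.u'U kc) wW (sym q))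
    ... | inj₂ (inj₂ refl) = kc
    chording : ∀ k → reach k u' (far u' w) ≡ true → Full
    chording zero ()
    chording (suc k) r with reach-view k u'U (hard-sym (U-V u'U) (HU.up dc)) (subst (λ x → reach (suc k) u' x ≡ true) e r)
    ... | atU cU = ⊥-elim (K2.cN k₂ cU)
    ... | atStar k₃ = ⊥-elim (not-star (K3.all k₃ w (hard-sym (W-V wW) (K2.wc k₂))))
      where
      not-star : w ≡ u' ⊎ w ≡ _ ⊎ w ≡ _ → ⊥
      not-star (inj₁ q) = U≢W u'U wW (sym q)
      not-star (inj₂ (inj₁ q)) = U≢W (K3.bU k₃) wW (sym q)
      not-star (inj₂ (inj₂ q)) = U≢W (K3.cU k₃) wW (sym q)
    ... | linked kc e' = Chord.chord-full s k₂ (third-is-w kc) ne e'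
    ... | onward kc r' with soft u' ≟′ other c u'
    ... | inj₁ e' = Chord.chord-full s k₂ (third-is-w kc) ne e'
    ... | inj₂ ne' = run k (Chord.chord-state s k₂ (third-is-w kc) ne ne') r'

  pair-reach : ∀ k {v v' w} → HU v v' w → isU v' ≡ true → reach k v w ≡ true → ⊥
  pair-reach k {v} {v'} {w} d v'U h = stuck (run k (proj₁ (start-U d v'U (apart k h))) h)
    where
    vU = HU.uU d
    wv = hard-sym (U-V vU) (HU.uw d)
    apart : ∀ k → reach k v w ≡ true → hard v' w ≡ true → ⊥
    apart zero ()
    apart (suc k) r v'w with reach-view k vU wv r
    ... | atU wU = noTriU vU v'U wU (HU.up d) (HU.uw d) v'w
    ... | atStar k₃ = noTri vU v'U (HU.up d) (HU.uw d) v'w (K3.wW k₃)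
    ... | linked k₂ _ = noTri vU v'U (HU.up d) (HU.uw d) v'w (K2.wW k₂)
    ... | onward k₂ _ = noTri vU v'U (HU.up d) (HU.uw d) v'w (K2.wW k₂)

  -- The start needs an arm linked to neither of the others, and any of the three may be the only
  -- such arm; hence the assumption on all three walks.
  star-reach : ∀ k {w a b c} → K3 w a b c → reach k a (far a w) ≡ true → reach k b (far b w) ≡ true → reach k c (far c w) ≡ true → ⊥
  star-reach k {w} k₃ ra rb rc with loner k₃
  ... | u , x , y , k' , n₁ , n₂ = stuck (run k (start-star k' n₁ n₂) (all u (K3.wa k')))
    where
    all : ∀ u → hard w u ≡ true → reach k u (far u w) ≡ true
    all u h with K3.all k₃ u h
    ... | inj₁ refl = ra
    ... | inj₂ (inj₁ refl) = rb
    ... | inj₂ (inj₂ refl) = rc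

  -- Vertices with at most one hard neighbour

  end : Fin N → Fin N → Fin N
  end v z = find (A z ∖ v) v

  block : (Fin N → Colour) → Fin N → Fin N → K
  block φ v z = neg (sg z v ⊗ sg z (end v z)) · cls (φ (end v z))

  softOK-block : ∀ {X φ v k} → (∀ z → soft₀ v z ≡ true → k ≢ block φ v z) → SoftOK X φ v k
  softOK-block {v = v} h z b zZ zv zb bV b≢v b∉ with Half.ends (Z-half zZ zv) b zb
  ... | inj₁ e = ⊥-elim (b≢v e)
  ... | inj₂ refl = h z (A-soft₀ (A-sym zv) zZ)

  no-hard : ∀ {v} → # (hard v) ≡ 0 → ∀ {X : List (Fin N)} b → hard v b ≡ true → b ∈ X
  no-hard {v} e b h = ⊥-elim (#-zero (hard v) e b h)

  no-03 : ∀ {v} → isV v ≡ true → # (hard v) ≡ 0 → # (soft₀ v) ≡ 3 → ⊥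
  no-03 {v} vV h s with crit v vV | #-three (soft₀ v) s
  ... | φ , val | x , y , z , _ , _ , _ , _ , _ , _ , al with four-soft (block φ v x) (block φ v y) (block φ v z) (block φ v z)
  ... | k , n₁ , n₂ , n₃ , _ with add₀ k vV val (no-hard h) (softOK-block {[]} {φ} ok)
    where
    ok : ∀ t → soft₀ v t ≡ true → k ≢ block φ v t
    ok t st with al t st
    ... | inj₁ refl = n₁
    ... | inj₂ (inj₁ refl) = n₂
    ... | inj₂ (inj₂ refl) = n₃
  ... | mkExt ψ w _ _ = stuck (ψ , w)

  no-04 : ∀ {v} → isV v ≡ true → # (hard v) ≡ 0 → # (soft₀ v) ≡ 4 → ⊥
  no-04 {v} vV h s with crit v vV | #-pos (soft₀ v) s
  ... | φ , val | t₀ , _ , s' with #-three (soft₀ v ∖ t₀) s'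
  ... | x , y , z , _ , _ , _ , _ , _ , _ , al with four-soft (block φ v x) (block φ v y) (block φ v z) (block φ v t₀)
  ... | k , n₁ , n₂ , n₃ , n₄ with add₀ k vV val (no-hard h) (softOK-block {[]} {φ} ok)
    where
    ok : ∀ t → soft₀ v t ≡ true → k ≢ block φ v t
    ok t st with t ≟′ t₀
    ... | inj₁ refl = n₄
    ... | inj₂ ne with al t (in-∖ {p = soft₀ v} st ne)
    ... | inj₁ refl = n₁
    ... | inj₂ (inj₁ refl) = n₂
    ... | inj₂ (inj₂ refl) = n₃
  ... | mkExt ψ w _ _ = stuck (ψ , w)

  no-12 : ∀ {v} → isV v ≡ true → # (hard v) ≡ 1 → # (soft₀ v) ≡ 2 → ⊥
  no-12 {v} vV h s with crit v vV | #-one (hard v) h | #-two (soft₀ v) s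
  ... | φ , val | c , _ , only | x , y , _ , _ , _ , al with one-hard (sg v c · cls (φ c)) (block φ v x) (block φ v y)
  ... | k , hk , n₁ , n₂ with add₁ k c vV val (λ b hb → inj₂ (only b hb)) hk (softOK-block {[]} {φ} ok)
    where
    ok : ∀ t → soft₀ v t ≡ true → k ≢ block φ v t
    ok t st with al t st
    ... | inj₁ refl = n₁
    ... | inj₂ refl = n₂
  ... | mkExt ψ w _ _ = stuck (ψ , w)

  -- Deleting `v` alone leaves three compatible classes against three forbidden ones. Reopening `u`
  -- as well gives `u` at least two classes, with different triples of compatible classes at `v`.
  -- One of the Z-vertices may join `v` to `u` itself, but only one, since `u` has a single
  -- Z-neighbour.
  no-13 : ∀ {v u} → isV v ≡ true → # (hard v) ≡ 1 → # (soft₀ v) ≡ 3 → hard v u ≡ true → isU u ≡ true → ⊥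
  no-13 {v} {u} vV h s vu uU with crit v vV | #-one (hard v) h | #-three (soft₀ v) s
  ... | φ , val | c , _ , only | x , y , z , tr = stuck (go (end v x ≟′ u) (end v y ≟′ u) (end v z ≟′ u))
    where
    d : HU u (far u v) v
    d = HU-flip (U-orient uU (hard-sym vV vu))
    c̄ : K
    c̄ = sg u (far u v) · cls (φ (far u v))
    finish : ∀ x k → H x c̄ → x ≢ kill φ u → H k (sg v u · x) →
      (∀ {ψ : Fin N → Colour} → (∀ t → t ≢ u → ψ t ≡ φ t) → cls (ψ u) ≡ x → ∀ t → soft₀ v t ≡ true → k ≢ block ψ v t) → Full
    finish x k hx nx hk ok with addUh {X = v ∷ []} x d z0 (weaken (λ { z0 → z1 }) val) hx (λ _ → nx)
    ... | mkExt ψ w sm refl with add₁ k u vV w (λ b hb → inj₂ (trans (only b hb) (sym (only u vu)))) hk (softOK-block {[]} {ψ} (ok sm refl))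
    ... | mkExt χ w' _ _ = χ , w'
    same-block : ∀ {ψ : Fin N → Colour} → (∀ t → t ≢ u → ψ t ≡ φ t) → ∀ {t} → end v t ≢ u → block φ v t ≡ block ψ v t
    same-block sm {t} ne = cong (λ α → neg (sg t v ⊗ sg t (end v t)) · cls α) (sym (sm _ ne))
    unique : ∀ {s t} → soft₀ v s ≡ true → soft₀ v t ≡ true → end v s ≡ u → end v t ≡ u → s ≡ t
    unique {s} {t} hs ht es et = trans (m hs es) (sym (m ht et))
      where
      m : ∀ {t} → soft₀ v t ≡ true → end v t ≡ u → t ≡ mid u
      m {t} ht et = mid-uniq uU t (soft₀-Z ht)
        (subst (λ o → A t o ≡ true) et (Half.zo (Z-half (soft₀-Z ht) (A-sym (soft₀-A ht)))))
    via : ∀ {x y z} → Trio (soft₀ v) x y z → end v x ≡ u → end v y ≢ u → end v z ≢ u → Full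
    via {x} {y} {z} (_ , _ , _ , _ , _ , _ , al) e n₁ n₂
      with three-two-linked c̄ (kill φ u) (sg v u) (neg (sg x v ⊗ sg x (end v x))) (block φ v y) (block φ v z)
    ... | κ , (hx , nx) , k , hk , m₁ , m₂ , m₃ = finish κ k hx nx hk ok
      where
      ok : ∀ {ψ : Fin N → Colour} → (∀ t → t ≢ u → ψ t ≡ φ t) → cls (ψ u) ≡ κ → ∀ t → soft₀ v t ≡ true → k ≢ block ψ v t
      ok {ψ} sm q t st with al t st
      ... | inj₁ refl = λ eq → m₁ (trans eq (cong (λ κ' → neg (sg x v ⊗ sg x (end v x)) · κ') (trans (cong (cls ∘ ψ) e) q)))
      ... | inj₂ (inj₁ refl) = subst (k ≢_) (same-block sm n₁) m₂
      ... | inj₂ (inj₂ refl) = subst (k ≢_) (same-block sm n₂) m₃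
    rot : ∀ {x y z} → Trio (soft₀ v) x y z → Trio (soft₀ v) y z x
    rot (a , b , c , ab , ac , bc , al) = b , c , a , bc , ab ∘ sym , ac ∘ sym ,
      λ l h → case al l h of λ { (inj₁ e) → inj₂ (inj₂ e) ; (inj₂ (inj₁ e)) → inj₁ e ; (inj₂ (inj₂ e)) → inj₂ (inj₁ e) }
    hx = proj₁ tr
    hy = proj₁ (proj₂ tr)
    hz = proj₁ (proj₂ (proj₂ tr))
    x≢y = proj₁ (proj₂ (proj₂ (proj₂ tr)))
    x≢z = proj₁ (proj₂ (proj₂ (proj₂ (proj₂ tr))))
    y≢z = proj₁ (proj₂ (proj₂ (proj₂ (proj₂ (proj₂ tr)))))
    go : end v x ≡ u ⊎ end v x ≢ u → end v y ≡ u ⊎ end v y ≢ u → end v z ≡ u ⊎ end v z ≢ u → Full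
    go (inj₁ e) _ _ = via tr e (λ e' → x≢y (unique hx hy e e')) (λ e' → x≢z (unique hx hz e e'))
    go (inj₂ _) (inj₁ e) _ = via (rot tr) e (λ e' → y≢z (unique hy hz e e')) (λ e' → x≢y (unique hx hy e' e))
    go (inj₂ _) (inj₂ _) (inj₁ e) = via (rot (rot tr)) e (λ e' → x≢z (unique hx hz e' e)) (λ e' → y≢z (unique hy hz e' e))
    go (inj₂ n₁) (inj₂ n₂) (inj₂ n₃) with three-two c̄ (kill φ u) (sg v u) (block φ v x) (block φ v y) (block φ v z)
    ... | κ , (hx , nx) , k , hk , m₁ , m₂ , m₃ = finish κ k hx nx hk ok
      where
      ok : ∀ {ψ : Fin N → Colour} → (∀ t → t ≢ u → ψ t ≡ φ t) → cls (ψ u) ≡ κ → ∀ t → soft₀ v t ≡ true → k ≢ block ψ v t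
      ok sm q t st with proj₂ (proj₂ (proj₂ (proj₂ (proj₂ (proj₂ tr))))) t st
      ... | inj₁ refl = subst (k ≢_) (same-block sm n₁) m₁
      ... | inj₂ (inj₁ refl) = subst (k ≢_) (same-block sm n₂) m₂
      ... | inj₂ (inj₂ refl) = subst (k ≢_) (same-block sm n₃) m₃

-- Discharging

  private
    step : Bool → Bool → Bool → Bool → Bool → Bool → Bool
    step a b c d e r = a ∨ (b ∧ (c ∨ (d ∧ (e ∨ r))))

    step-mono : ∀ a b c d e {r r'} → (r ≡ true → r' ≡ true) → step a b c d e r ≡ true → step a b c d e r' ≡ true
    step-mono true  _ _ _ _ f h = refl
    step-mono false true true _ _ f h = refl
    step-mono false true false true true f h = refl
    step-mono false true false true false f h = f h

  reach-mono : ∀ k u w → reach k u w ≡ true → reach (suc k) u w ≡ true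
  reach-mono (suc k) u w h = step-mono (isU w) (isW w) (# (hardU w) ≡ᵇ 3) (# (hardU w) ≡ᵇ 2) (soft u == other w u) (reach-mono k _ _) h

  opaque
    level : ℕ
    level = proj₁ (stabilises reach reach-mono)

    level-stable : ∀ u w → reach (suc level) u w ≡ reach level u w
    level-stable = proj₂ (stabilises reach reach-mono)

    D : Fin N → Fin N → Bool
    D = reach level

    D-reach : ∀ u w → D u w ≡ reach level u w
    D-reach u w = refl

  D-step : ∀ u w → D u w ≡ reach (suc level) u w
  D-step u w = trans (D-reach u w) (sym (level-stable u w))

  isU-false : ∀ {w} → isW w ≡ true → isU w ≡ false
  isU-false {w} wW with isU w in e
  ... | false = refl
  ... | true = ⊥-elim (U≢W e wW refl)

  D-atU : ∀ {u w} → isU w ≡ true → D u w ≡ true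
  D-atU {u} {w} wU = trans (D-step u w) (eval wU)
    where
    eval : isU w ≡ true → reach (suc level) u w ≡ true
    eval p rewrite p = refl

  D-atStar : ∀ {u w} → isW w ≡ true → # (hardU w) ≡ 3 → D u w ≡ true
  D-atStar {u} {w} wW e = trans (D-step u w) eval
    where
    eval : reach (suc level) u w ≡ true
    eval rewrite isU-false wW | wW | e = refl

  D-link : ∀ {u w} → isW w ≡ true → # (hardU w) ≡ 2 → D u w ≡ (soft u == other w u) ∨ D (other w u) (far (other w u) w)
  D-link {u} {w} wW e = trans (D-step u w) (trans eval (cong ((soft u == other w u) ∨_) (sym (D-reach _ _))))
    where
    eval : reach (suc level) u w ≡ (soft u == other w u) ∨ reach level (other w u) (far (other w u) w)
    eval rewrite isU-false wW | wW | e = refl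

  opaque
    payer : Fin N → Fin N → Bool
    payer w u = isV w ∧ not (isU w) ∧ hardU w u

    payer-intro : ∀ {w u} → isV w ≡ true → isU w ≡ false → hardU w u ≡ true → payer w u ≡ true
    payer-intro {w} v e h rewrite v | e = h

    payer-hardU : ∀ {w u} → payer w u ≡ true → hardU w u ≡ true
    payer-hardU {w} {u} h = ∧₂ {not (isU w)} (∧₂ {isV w} h)

    payer-¬U : ∀ {w u} → payer w u ≡ true → isU w ≡ false
    payer-¬U {w} {u} h = not-true (∧₁ {not (isU w)} (∧₂ {isV w} h))

    payer-V : ∀ {w u} → payer w u ≡ true → isV w ≡ true
    payer-V {w} {u} h = ∧₁ {isV w} h

  charge : Fin N → Fin N → ℕ
  charge w u = if payer w u then pay (D u w) (D u (far u w)) else 0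

  charge-true : ∀ {w u} → payer w u ≡ true → charge w u ≡ pay (D u w) (D u (far u w))
  charge-true p rewrite p = refl

  charge-zero : ∀ {w u} → (payer w u ≡ true → ⊥) → charge w u ≡ 0
  charge-zero {w} {u} h with payer w u
  ... | true  = ⊥-elim (h refl)
  ... | false = refl

  charge≤ : ∀ w u → charge w u ≤ 2 * b2n (hardU w u)
  charge≤ w u with payer w u in e
  ... | false = z≤n
  ... | true rewrite payer-hardU e = pay≤2 (D u w) (D u (far u w))

  paid received : Fin N → ℕ
  paid v = sum (charge v)
  received v = sum λ w → charge w v

  paid≤ : ∀ v → paid v ≤ 2 * # (hardU v)
  paid≤ v = ≤-trans (sum-mono (charge≤ v)) (≤-reflexive (sum-*ˡ 2 (λ u → b2n (hardU v u))))

  #hardU≤ : ∀ v → # (hardU v) ≤ # (hard v)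
  #hardU≤ v = sum-mono λ x → le x
    where
    le : ∀ x → b2n (hardU v x) ≤ b2n (hard v x)
    le x with hardU v x in e
    ... | false = z≤n
    ... | true rewrite hardU-h {v} {x} e = ≤-refl

  -- Two neighbours outside U pay `pay d e` and `pay e d`. If one neighbour is a U-vertex, the walk
  -- towards it ends at once and, by `pair-reach`, the other walk reaches no end; so the other
  -- neighbour pays 2.
  received-U : ∀ {v} → isU v ≡ true → 2 ≤ received v
  received-U {v} vU with U-nbrs vU
  ... | p , w , d with isU p in eP | isU w in eW
  ... | true | true = ⊥-elim (no-three d eP eW)
  ... | false | false = ≤-trans (≤-reflexive total) (≤-reflexive (sym (∑-two (λ x → charge x v) p w p≢w none)))
    where
    open HU d
    payP : payer p v ≡ true
    payP = payer-intro (hard-V up) eP (hardU-intro (hard-sym (U-V vU) up) vU)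
    payW : payer w v ≡ true
    payW = payer-intro (hard-V uw) eW (hardU-intro (hard-sym (U-V vU) uw) vU)
    total : 2 ≡ charge p v + charge w v
    total = sym (trans (cong₂ _+_ (trans (charge-true payP) (cong (λ x → pay (D v p) (D v x)) (HU-far d)))
                                  (trans (charge-true payW) (cong (λ x → pay (D v w) (D v x)) (HU-far (HU-flip d)))))
                       (pay-swap (D v p) (D v w)))
    none : ∀ x → x ≢ p → x ≢ w → charge x v ≡ 0
    none x np nw = charge-zero λ h → case all x (hard-sym (payer-V h) (hardU-h (payer-hardU h))) of
      λ { (inj₁ e) → np e ; (inj₂ e) → nw e }
  ... | true | false = ≤-trans (≤-reflexive (sym eq)) (∑-one-≥ (λ x → charge x v) w)
    where
    open HU d
    away : D v w ≡ false
    away with D v w in e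
    ... | false = refl
    ... | true = ⊥-elim (pair-reach level d eP (trans (sym (D-reach v w)) e))
    eq : charge w v ≡ 2
    eq = trans (charge-true (payer-intro (hard-V uw) eW (hardU-intro (hard-sym (U-V vU) uw) vU)))
           (cong₂ pay away (trans (cong (D v) (HU-far (HU-flip d))) (D-atU eP)))
  ... | false | true = ≤-trans (≤-reflexive (sym eq)) (∑-one-≥ (λ x → charge x v) p)
    where
    open HU d
    away : D v p ≡ false
    away with D v p in e
    ... | false = refl
    ... | true = ⊥-elim (pair-reach level (HU-flip d) eW (trans (sym (D-reach v p)) e))
    eq : charge p v ≡ 2
    eq = trans (charge-true (payer-intro (hard-V up) eP (hardU-intro (hard-sym (U-V vU) up) vU)))
           (cong₂ pay away (trans (cong (D v) (HU-far d)) (D-atU eW)))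

  charge-pay : ∀ {w u} → isW w ≡ true → hardU w u ≡ true → charge w u ≡ pay (D u w) (D u (far u w))
  charge-pay wW h = charge-true (payer-intro (W-V wW) (isU-false wW) h)

  -- A W-vertex has charge 30 - 28 = 2. With two U-neighbours, a walk entering from one leaves
  -- through the other: unlinked they cost `pay q p` and `pay p q`, linked at most 1 each. With
  -- three, an arm costs 1 only if its outward walk reaches an end, and by `star-reach` some arm's
  -- does not.
  paid-W : ∀ {w} → isW w ≡ true → paid w ≤ 2
  paid-W {w} wW with # (hardU w) in e | #hardU≤ w
  ... | zero | _ = ≤-trans (paid≤ w) (≤-trans (≤-reflexive (cong (2 *_) e)) z≤n)
  ... | suc zero | _ = ≤-trans (paid≤ w) (≤-reflexive (cong (2 *_) e))
  ... | suc (suc zero) | _ = pair (#-two (hardU w) e)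
    where
    pair : (∃₂ λ a b → Duo (hardU w) a b) → paid w ≤ 2
    pair (a , b , t@(ha , hb , ne , al)) = ≤-trans (≤-reflexive (∑-two (charge w) a b ne none)) both
      where
      none : ∀ x → x ≢ a → x ≢ b → charge w x ≡ 0
      none x na nb = charge-zero λ h → case al x (payer-hardU h) of λ { (inj₁ q) → na q ; (inj₂ q) → nb q }
      ob : other w a ≡ b
      ob = other-spec t
      oa : other w b ≡ a
      oa = other-spec (hb , ha , ne ∘ sym , λ x h → case al x h of λ { (inj₁ q) → inj₂ q ; (inj₂ q) → inj₁ q })
      Da : D a w ≡ (soft a == b) ∨ D b (far b w)
      Da = trans (D-link wW e) (cong (λ x → (soft a == x) ∨ D x (far x w)) ob)
      Db : D b w ≡ (soft b == a) ∨ D a (far a w)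
      Db = trans (D-link wW e) (cong (λ x → (soft b == x) ∨ D x (far x w)) oa)
      flip-== : ∀ {x y} → isU x ≡ true → isU y ≡ true → (soft x == y) ≡ true → (soft y == x) ≡ true
      flip-== {x} {y} xU yU h = subst (λ z → (z == x) ≡ true) (sym (soft-flip xU yU (==-sound h))) (==-refl x)
      sums : ∀ {x y p q} → D a w ≡ x ∨ q → D b w ≡ y ∨ p → (x ≡ true → y ≡ true) → (y ≡ true → x ≡ true) →
             pay (D a w) p + pay (D b w) q ≤ 2
      sums {true} {y} {p} {q} ea eb f g with f refl
      ... | refl rewrite ea | eb = +-mono-≤ (pay-true p) (pay-true q)
      sums {false} {true} ea eb f g with () ← g refl
      sums {false} {false} {p} {q} ea eb f g rewrite ea | eb = ≤-reflexive (pay-swap q p)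
      both : charge w a + charge w b ≤ 2
      both = ≤-trans (≤-reflexive (cong₂ _+_ (charge-pay wW ha) (charge-pay wW hb)))
               (sums Da Db (flip-== (hardU-U ha) (hardU-U hb)) (flip-== (hardU-U hb) (hardU-U ha)))
  ... | suc (suc (suc zero)) | _ = star₃ (#-three (hardU w) e)
    where
    star₃ : (∃₂ λ a b → ∃ λ c → Trio (hardU w) a b c) → paid w ≤ 2
    star₃ (a , b , c , t@(ha , hb , hc , ab , ac , bc , al)) =
      ≤-trans (≤-reflexive (trans (∑-three (charge w) a b c ab ac bc none) (cong₂ _+_ (val ha) (cong₂ _+_ (val hb) (val hc))))) bound
      where
      none : ∀ x → x ≢ a → x ≢ b → x ≢ c → charge w x ≡ 0
      none x na nb nc = charge-zero λ h → case al x (payer-hardU h) of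
        λ { (inj₁ q) → na q ; (inj₂ (inj₁ q)) → nb q ; (inj₂ (inj₂ q)) → nc q }
      val : ∀ {u} → hardU w u ≡ true → charge w u ≡ pay true (D u (far u w))
      val {u} h = trans (charge-pay wW h) (cong (λ d → pay d (D u (far u w))) (D-atStar wW e))
      bound : pay true (D a (far a w)) + (pay true (D b (far b w)) + pay true (D c (far c w))) ≤ 2
      bound with D a (far a w) in ea | D b (far b w) in eb | D c (far c w) in ec
      ... | false | y | z = +-mono-≤ (pay-true y) (pay-true z)
      ... | true | false | z = s≤s (pay-true z)
      ... | true | true | false = ≤-refl
      ... | true | true | true = ⊥-elim (star-reach level (Trio-K3 wW t) (r ea) (r eb) (r ec))
        where
        r : ∀ {x y} → D x y ≡ true → reach level x y ≡ true
        r {x} {y} h = trans (sym (D-reach x y)) h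
  ... | suc (suc (suc (suc k))) | m with W-hard wW
  ... | q rewrite q with s≤s (s≤s (s≤s ())) ← m

  deg-split : ∀ v → deg v ≡ # (hard v) + # (soft₀ v)
  deg-split v = trans (sum-cong-≗ each) (∑-distrib-+ (λ x → b2n (hard v x)) (λ x → b2n (soft₀ v x)))
    where
    each : ∀ x → b2n (A v x) ≡ b2n (hard v x) + b2n (soft₀ v x)
    each x = go (A v x) refl
      where
      no-hard′ : A v x ≡ false → hard v x ≡ false
      no-hard′ e with hard v x in h
      ... | false = refl
      ... | true = ⊥-elim (t≢f (hard-A h) e)
      no-soft′ : A v x ≡ false → soft₀ v x ≡ false
      no-soft′ e with soft₀ v x in h
      ... | false = refl
      ... | true = ⊥-elim (t≢f (soft₀-A h) e)
      ¬V : isV x ≡ false → hard v x ≡ false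
      ¬V e with hard v x in h
      ... | false = refl
      ... | true = ⊥-elim (t≢f (hard-V h) e)
      ¬Z : isZ x ≡ false → soft₀ v x ≡ false
      ¬Z e with soft₀ v x in h
      ... | false = refl
      ... | true = ⊥-elim (t≢f (soft₀-Z h) e)
      go : ∀ b → A v x ≡ b → b2n (A v x) ≡ b2n (hard v x) + b2n (soft₀ v x)
      go false e = trans (cong b2n e) (sym (cong₂ (λ p q → b2n p + b2n q) (no-hard′ e) (no-soft′ e)))
      go true e with split-deg x (A-S (A-sym e)) (min2 x (A-S (A-sym e)))
      ... | inj₁ (z , nv) = trans (cong b2n e) (sym (cong₂ (λ p q → b2n p + b2n q) (¬V nv) (A-soft₀ e z)))
      ... | inj₂ (v' , nz) = trans (cong b2n e) (sym (cong₂ (λ p q → b2n p + b2n q) (A-hard e v') (¬Z nz)))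

  opaque
    unfolding isV
    V-deg : ∀ {v} → isV v ≡ true → 3 ≤ deg v
    V-deg {v} h = ≤ᵇ⇒≤ 3 (deg v) (subst T (sym (∧₂ {S v} h)) _)

  balance : ∀ v → isV v ≡ true → 28 + paid v ≤ 10 * # (hard v) + 6 * # (soft₀ v) + received v
  balance v vV with isU v in eU | isW v in eW
  -- 26 is the weight 10 * 2 + 6 * 1 of a U-vertex, so the 2 received make up the deficit.
  ... | true | _ = ≤-trans (≤-reflexive (trans (cong (28 +_) none) refl))
        (≤-trans (+-monoʳ-≤ 26 (received-U eU)) (≤-reflexive (cong₂ (λ h s → 10 * h + 6 * s + received v) (sym (U-hard eU)) (sym (U-soft eU)))))
    where
    none : paid v ≡ 0
    none = ∑-none (charge v) λ u → charge-zero {v} {u} λ h → t≢f eU (payer-¬U h)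
  ... | false | true = ≤-trans (+-monoʳ-≤ 28 (paid-W eW)) (≤-trans (m≤m+n 30 (received v))
        (≤-reflexive (cong₂ (λ h s → 10 * h + 6 * s + received v) (sym (W-hard eW)) (sym (W-soft eW)))))
  ... | false | false = ≤-trans (+-monoʳ-≤ 28 (paid≤ v)) (≤-trans
        (charge-suffices (# (hard v)) (# (soft₀ v)) (≤-trans (V-deg vV) (≤-reflexive (deg-split v)))
          (no-03 vV) (no-04 vV) (no-12 vV) (λ h s → t≢f (U-intro vV h s) eU) (λ h s → t≢f (W-intro vV h s) eW)
          (# (hardU v)) (#hardU≤ v) no-U)
        (m≤m+n _ (received v)))
    where
    no-U : # (hard v) ≡ 1 → # (soft₀ v) ≡ 3 → # (hardU v) ≡ 0
    no-U h s with # (hardU v) in e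
    ... | zero = refl
    ... | suc k with #-pos (hardU v) e
    ... | u , hu , _ = ⊥-elim (no-13 vV h s (hardU-h hu) (hardU-U hu))

  -- Double counting over the whole vertex set

  private
    v̂ ẑ : Fin N → ℕ
    v̂ v = b2n (isV v)
    ẑ v = b2n (isZ v)

    #V #Z H-hard H-soft : ℕ
    #V = # isV
    #Z = # isZ
    H-hard = sum λ v → v̂ v * # (hard v)
    H-soft = sum λ v → v̂ v * # (soft₀ v)

    weighted : ∀ v → 28 * v̂ v + paid v ≤ 10 * (v̂ v * # (hard v)) + 6 * (v̂ v * # (soft₀ v)) + received v
    weighted v with isV v in e
    ... | true = subst (λ x → 28 + paid v ≤ x + received v)
                   (cong₂ (λ h s → 10 * h + 6 * s) (sym (+-identityʳ (# (hard v)))) (sym (+-identityʳ (# (soft₀ v))))) (balance v e)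
    ... | false = ≤-trans (≤-reflexive (∑-none (charge v) λ u → charge-zero {v} {u} λ h → t≢f (payer-V h) e)) z≤n

    total : 28 * #V ≤ 10 * H-hard + 6 * H-soft
    total = +-cancelʳ-≤ (sum paid) _ _ (begin
      28 * #V + sum paid                       ≡⟨ cong (_+ sum paid) (sym (sum-*ˡ 28 v̂)) ⟩
      sum (λ v → 28 * v̂ v) + sum paid          ≡⟨ sym (∑-distrib-+ (λ v → 28 * v̂ v) paid) ⟩
      sum (λ v → 28 * v̂ v + paid v)            ≤⟨ sum-mono weighted ⟩
      sum (λ v → h v + s v + received v)       ≡⟨ ∑-distrib-+ (λ v → h v + s v) received ⟩
      sum (λ v → h v + s v) + sum received     ≡⟨ cong₂ _+_ (∑-distrib-+ h s) (sym (∑-comm charge)) ⟩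
      sum h + sum s + sum paid                 ≡⟨ cong₂ (λ x y → x + y + sum paid) (sum-*ˡ 10 (λ v → v̂ v * # (hard v))) (sum-*ˡ 6 (λ v → v̂ v * # (soft₀ v))) ⟩
      10 * H-hard + 6 * H-soft + sum paid      ∎)
      where
      open ≤-Reasoning
      h s : Fin N → ℕ
      h v = 10 * (v̂ v * # (hard v))
      s v = 6 * (v̂ v * # (soft₀ v))

    soft-double : ∀ v z → v̂ v * b2n (soft₀ v z) ≡ ẑ z * b2n (A z v)
    soft-double v z = trans (sym (b2n-∧ (isV v) _)) (trans (cong b2n (same _ _ to from)) (b2n-∧ (isZ z) _))
      where
      same : ∀ x y → (x ≡ true → y ≡ true) → (y ≡ true → x ≡ true) → x ≡ y
      same true  y f g = sym (f refl)
      same false true f g = g refl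
      same false false f g = refl
      to : isV v ∧ soft₀ v z ≡ true → isZ z ∧ A z v ≡ true
      to h = ∧ᵢ {isZ z} (soft₀-Z q) (A-sym (soft₀-A q))
        where q = ∧₂ {isV v} h
      from : isZ z ∧ A z v ≡ true → isV v ∧ soft₀ v z ≡ true
      from h = ∧ᵢ {isV v} (Z-nbr (∧₁ {isZ z} h) a) (A-soft₀ (A-sym a) (∧₁ {isZ z} h))
        where a = ∧₂ {isZ z} h

    Z-weight : ∀ z → ẑ z * deg z ≡ 2 * ẑ z
    Z-weight z with isZ z in e
    ... | true rewrite Z-deg e = refl
    ... | false = refl

    -- The edges between V and Z are counted from Z: both neighbours of a Z-vertex lie in V, as no
    -- two Z-vertices are adjacent.
    H-soft≡ : H-soft ≡ 2 * #Z
    H-soft≡ = begin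
      sum (λ v → v̂ v * # (soft₀ v))                        ≡⟨ sum-cong-≗ (λ v → sym (sum-*ˡ (v̂ v) (λ z → b2n (soft₀ v z)))) ⟩
      sum (λ v → sum λ z → v̂ v * b2n (soft₀ v z))          ≡⟨ sum-cong-≗ (λ v → sum-cong-≗ (soft-double v)) ⟩
      sum (λ v → sum λ z → ẑ z * b2n (A z v))              ≡⟨ ∑-comm (λ v z → ẑ z * b2n (A z v)) ⟩
      sum (λ z → sum λ v → ẑ z * b2n (A z v))              ≡⟨ sum-cong-≗ (λ z → sum-*ˡ (ẑ z) (λ v → b2n (A z v))) ⟩
      sum (λ z → ẑ z * deg z)                              ≡⟨ sum-cong-≗ Z-weight ⟩
      sum (λ z → 2 * ẑ z)                                  ≡⟨ sum-*ˡ 2 ẑ ⟩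
      2 * #Z ∎
      where open ≡-Reasoning

    S-split : ∀ v → b2n (S v) ≡ v̂ v + ẑ v × deg v ≡ v̂ v * # (hard v) + v̂ v * # (soft₀ v) + 2 * ẑ v
    S-split v with S v in e
    ... | true with split-deg v e (min2 v e)
    ...   | inj₁ (z , nv) rewrite z | nv = refl , Z-deg z
    ...   | inj₂ (w , nz) rewrite w | nz = refl , trans (deg-split v) (sym (trans (+-identityʳ _) (cong₂ _+_ (+-identityʳ (# (hard v))) (+-identityʳ (# (soft₀ v))))))
    S-split v | false = sym (cong₂ (λ x y → b2n x + b2n y) nV nZ) ,
      trans (∑-none (λ x → b2n (A v x)) (λ x → cong b2n (nA x))) (sym (cong₂ (λ x y → b2n x * # (hard v) + b2n x * # (soft₀ v) + 2 * b2n y) nV nZ))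
      where
      outside : ∀ {b} → (b ≡ true → S v ≡ true) → b ≡ false
      outside {true}  f = ⊥-elim (t≢f (f refl) e)
      outside {false} f = refl
      nV = outside {isV v} V-S
      nZ = outside {isZ v} Z-S
      nA : ∀ x → A v x ≡ false
      nA x = outside {A v x} A-S

  -- Each Z-vertex has two edges, that is four edge-ends worth 10 each: 28 pay for the vertex, and 6
  -- are credited to each of its two neighbours. The factor 2 matches the doubled weights.
  dense : 14 * # S ≤ 5 * sum deg
  dense = *-cancelˡ-≤ 2 (begin
    2 * (14 * # S)                                  ≡⟨ cong (λ x → 2 * (14 * x)) (trans (sum-cong-≗ (proj₁ ∘ S-split)) (∑-distrib-+ v̂ ẑ)) ⟩
    2 * (14 * (#V + #Z))                            ≡⟨ e₁ #V #Z ⟩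
    28 * #V + 28 * #Z                               ≤⟨ +-monoˡ-≤ (28 * #Z) total ⟩
    10 * H-hard + 6 * H-soft + 28 * #Z              ≡⟨ cong (λ s → 10 * H-hard + 6 * s + 28 * #Z) H-soft≡ ⟩
    10 * H-hard + 6 * (2 * #Z) + 28 * #Z            ≡⟨ e₂ H-hard #Z ⟩
    2 * (5 * (H-hard + 2 * #Z + 2 * #Z))            ≡⟨ cong (λ s → 2 * (5 * (H-hard + s + 2 * #Z))) (sym H-soft≡) ⟩
    2 * (5 * (H-hard + H-soft + 2 * #Z))            ≡⟨ cong (λ x → 2 * (5 * x)) (sym degrees) ⟩
    2 * (5 * sum deg) ∎)
    where
    open ≤-Reasoning
    e₁ : ∀ v z → 2 * (14 * (v + z)) ≡ 28 * v + 28 * z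
    e₁ = solve-∀
    e₂ : ∀ h z → 10 * h + 6 * (2 * z) + 28 * z ≡ 2 * (5 * (h + 2 * z + 2 * z))
    e₂ = solve-∀
    degrees : sum deg ≡ H-hard + H-soft + 2 * #Z
    degrees = trans (sum-cong-≗ (proj₂ ∘ S-split))
      (trans (∑-distrib-+ (λ v → v̂ v * # (hard v) + v̂ v * # (soft₀ v)) (λ v → 2 * ẑ v))
        (cong₂ _+_ (∑-distrib-+ (λ v → v̂ v * # (hard v)) (λ v → v̂ v * # (soft₀ v))) (sum-*ˡ 2 ẑ)))

-- The minimal counterexample

<ᵇ-true : ∀ {m k} → m < k → (m <ᵇ k) ≡ true
<ᵇ-true {m} {k} p with m <ᵇ k | <⇒<ᵇ p
... | true | _ = refl

<ᵇ-false : ∀ {m k} → ¬ m < k → (m <ᵇ k) ≡ false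
<ᵇ-false {m} {k} p with m <ᵇ k in e
... | false = refl
... | true = ⊥-elim (p (<ᵇ⇒< m k (subst T (sym e) _)))

module _ (G : SignedGraph) (S : Fin (n G) → Bool) where
  open Graph G S

  induced : Subgraph G
  induced = record { S = S ; keep = λ _ _ → true }

  private
    core edge : Fin N → Fin N → Bool
    core u v = isEdge (sgn G u v) ∧ S u ∧ S v ∧ true
    edge u v = (toℕ u <ᵇ toℕ v) ∧ core u v

    core-A : ∀ u v → core u v ≡ A u v
    core-A u v with core u v in e
    ... | true = sym (sgn-A (∧₁ {S u} q) (∧₁ {S v} (∧₂ {S u} q)) (isEdge-just _ (∧₁ {isEdge (sgn G u v)} e)))
      where q = ∧₂ {isEdge (sgn G u v)} e
    ... | false with A u v in h
    ... | false = refl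
    ... | true with () ← trans (sym e) (∧ᵢ {isEdge (sgn G u v)} (cong isEdge (A-sgn h)) (∧ᵢ {S u} (A-S h) (∧ᵢ {S v} (A-S (A-sym h)) refl)))

    A-comm : ∀ u v → A u v ≡ A v u
    A-comm u v with A u v in e | A v u in f
    ... | true  | true  = refl
    ... | false | false = refl
    ... | true  | false = trans (sym (A-sym e)) f
    ... | false | true  = trans (sym e) (A-sym f)

    orient : ∀ u v → b2n (A u v) ≡ b2n (edge u v) + b2n (edge v u)
    orient u v rewrite core-A u v | core-A v u | A-comm v u with <-cmp (toℕ u) (toℕ v)
    ... | tri< l _ g rewrite <ᵇ-true l | <ᵇ-false g = sym (+-identityʳ _)
    ... | tri> g _ l rewrite <ᵇ-true l | <ᵇ-false g = refl
    ... | tri≈ a e b rewrite <ᵇ-false a | <ᵇ-false b with A u v in h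
    ...   | false = refl
    ...   | true = ⊥-elim (A-≢ h (toℕ-injective e))

    eH-sum : eH induced ≡ sum λ u → # (edge u)
    eH-sum = trans (cong sumL (map-cong (λ u → count-# (edge u)) (allFin N))) (sumL-allFin (λ u → # (edge u)))

  handshake : sum deg ≡ 2 * eH induced
  handshake = begin
    sum (λ u → # (A u))                                        ≡⟨ sum-cong-≗ (λ u → sum-cong-≗ (orient u)) ⟩
    sum (λ u → sum λ v → b2n (edge u v) + b2n (edge v u))       ≡⟨ sum-cong-≗ (λ u → ∑-distrib-+ (λ v → b2n (edge u v)) (λ v → b2n (edge v u))) ⟩
    sum (λ u → # (edge u) + # (λ v → edge v u))                 ≡⟨ ∑-distrib-+ (λ u → # (edge u)) (λ u → # (λ v → edge v u)) ⟩
    E₁ + sum (λ u → # (λ v → edge v u))                         ≡⟨ cong (E₁ +_) (∑-comm (λ u v → b2n (edge v u))) ⟩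
    E₁ + E₁                                                     ≡⟨ cong (E₁ +_) (sym (+-identityʳ E₁)) ⟩
    2 * E₁                                                      ≡⟨ cong (2 *_) (sym eH-sum) ⟩
    2 * eH induced ∎
    where
    open ≡-Reasoning
    E₁ = sum λ u → # (edge u)

-- Deciding whether a vertex set is colourable

cons : ∀ {m} → Colour → (Fin m → Colour) → Fin (suc m) → Colour
cons α f f0     = α
cons α f (fs i) = f i

anyC? : {P : Colour → Set} → (∀ α → Dec (P α)) → Dec (∃ P)
anyC? d = map′ (λ { (k , i , p) → (k , i) , p }) (λ { ((k , i) , p) → k , i , p }) (anyK? λ k → anyB? λ i → d (k , i))

-- A colouring is recovered from its first value and the rest only pointwise, hence the invariance
-- asked of `P`.
any-colouring? : ∀ {m} {P : (Fin m → Colour) → Set} → (∀ {f g} → (∀ i → f i ≡ g i) → P f → P g) →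
  (∀ f → Dec (P f)) → Dec (∃ P)
any-colouring? {zero} ext d = map′ (λ p → none , p) (λ { (f , p) → ext (λ ()) p }) (d none)
  where
  none : Fin 0 → Colour
  none ()
any-colouring? {suc m} ext d = map′
  (λ { (α , f , p) → cons α f , p })
  (λ { (f , p) → f f0 , f ∘ fs , ext (λ { f0 → refl ; (fs i) → refl }) p })
  (anyC? λ α → any-colouring? (λ h → ext λ { f0 → refl ; (fs i) → h i }) λ f → d (cons α f))

just? : ∀ m s → Dec (m ≡ just s)
just? m s = map′ (eqSign-sound s m) (λ { refl → same s }) (is? (eqSign s m))
  where
  same : ∀ s → eqSign s (just s) ≡ true
  same plus  = refl
  same minus = refl

valid? : ∀ G S φ → Dec (ValidOn G S φ)
valid? G S φ = all? λ a → all? λ b → allS? λ s → is? (S a) →-dec (is? (S b) →-dec (just? (sgn G a b) s →-dec is? (E s (φ a) (φ b))))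

colourable? : ∀ G S → Dec (∃ (ValidOn G S))
colourable? G S = any-colouring?
  (λ {f} {g} h v a b s p q r → subst (λ α → E s α (g b) ≡ true) (h a) (subst (λ β → E s (f a) β ≡ true) (h b) (v a b s p q r)))
  (valid? G S)

extend : ∀ G S φ v x → ValidOn G (S ∖ v) φ → (∀ t s → S t ≡ true → t ≢ v → sgn G v t ≡ just s → E s x (φ t) ≡ true) →
  ValidOn G S (φ [ v ≔ x ])
extend G S φ v x val h a b s Sa Sb e with a ≟′ v | b ≟′ v
... | inj₁ refl | inj₁ refl with () ← trans (sym e) (noLoop G a)
... | inj₁ refl | inj₂ q rewrite ≔-same φ a x | ≔-other φ x q = h b s Sb q e
... | inj₂ p | inj₁ refl rewrite ≔-same φ b x | ≔-other φ x p = E-sym s x (φ a) (h a s Sa p (trans (symm G b a) e))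
... | inj₂ p | inj₂ q rewrite ≔-other φ x p | ≔-other φ x q = val a b s (in-∖ {p = S} Sa p) (in-∖ {p = S} Sb q) e

abstract
  hc-opp : ∀ k → H (opp k) k
  hc-opp = by (allK? λ k → H? (opp k) k) refl

-- Properties of a minimal uncolourable vertex set

module Minimal (G : SignedGraph) (S : Fin (n G) → Bool) (uncolourable : ∃ (ValidOn G S) → ⊥)
               (minimal : ∀ v → S v ≡ true → ∃ (ValidOn G (S ∖ v))) where
  open Graph G S

  private
    sign≡ : ∀ {a b s} → A a b ≡ true → sgn G a b ≡ just s → s ≡ sg a b
    sign≡ h e with trans (sym e) (A-sgn h)
    ... | refl = refl

  min2 : ∀ a → S a ≡ true → 2 ≤ deg a
  min2 a Sa with minimal a Sa | deg a in e
  ... | _ | suc (suc k) = s≤s (s≤s z≤n)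
  ... | φ , v | zero = ⊥-elim (uncolourable (φ [ a ≔ (a⁺ , true) ] , extend G S φ a (a⁺ , true) v λ t s St _ at → ⊥-elim (#-zero (A a) e t (sgn-A Sa St at))))
  ... | φ , v | suc zero with #-one (A a) e
  ... | b , ab , only with colour-H _ (proj₂ (φ b)) (opp (sg a b · cls (φ b))) (hc-opp (sg a b · cls (φ b)))
  ... | i , p = ⊥-elim (uncolourable (φ [ a ≔ (opp (sg a b · cls (φ b)) , i) ] , extend G S φ a (opp (sg a b · cls (φ b)) , i) v λ t s St _ at → colour t s (sgn-A Sa St at) at))
    where
    colour : ∀ t s → A a t ≡ true → sgn G a t ≡ just s → E s (opp (sg a b · cls (φ b)) , i) (φ t) ≡ true
    colour t s h at with only t h | sign≡ h at
    ... | refl | refl = p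

  -- With `a` deleted, `b` is recoloured too: it has one coloured neighbour left, and `two-path`
  -- picks its class so that something fits at `a`.
  noZZ : ∀ a b → isZ a ≡ true → isZ b ≡ true → A a b ≡ true → ⊥
  noZZ a b aZ bZ ab with minimal a (Z-S aZ)
  ... | φ , val with two-path (sg b (find (A b ∖ a) a) · cls (φ (find (A b ∖ a) a))) (sg a (find (A a ∖ b) b) · cls (φ (find (A a ∖ b) b))) (sg a b)
  ... | k , h , k' , g with colour-H _ (proj₂ (φ (find (A b ∖ a) a))) k h
  ... | i , p with colour-fits (sg a b · k) i _ (proj₂ (φ (find (A a ∖ b) b))) k' g
  ... | j , q , r = uncolourable ((φ [ b ≔ (k , i) ]) [ a ≔ (k' , j) ] , extend G S (φ [ b ≔ (k , i) ]) a (k' , j) (extend G (S ∖ a) φ b (k , i) below at-b) at-a)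
    where
    open Half
    hb : Half b a _
    hb = Z-half aZ ab
    below : ValidOn G ((S ∖ a) ∖ b) φ
    below x y s Sx Sy = val x y s (proj₁ (∖-in {p = S ∖ a} Sx)) (proj₁ (∖-in {p = S ∖ a} Sy))
    at-b : ∀ t s → (S ∖ a) t ≡ true → t ≢ b → sgn G b t ≡ just s → E s (k , i) (φ t) ≡ true
    at-b t s St _ bt with ∖-in {p = S} St
    ... | St' , t≢a = go (sgn-A (A-S (A-sym ab)) St' bt)
      where
      go : A b t ≡ true → E s (k , i) (φ t) ≡ true
      go h with ends (Z-half bZ (A-sym ab)) t h | sign≡ h bt
      ... | inj₁ e | _ = ⊥-elim (t≢a e)
      ... | inj₂ refl | refl = p
    at-a : ∀ t s → S t ≡ true → t ≢ a → sgn G a t ≡ just s → E s (k' , j) ((φ [ b ≔ (k , i) ]) t) ≡ true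
    at-a t s St _ at = go (sgn-A (A-S ab) St at)
      where
      go : A a t ≡ true → E s (k' , j) ((φ [ b ≔ (k , i) ]) t) ≡ true
      go h with ends hb t h | sign≡ h at
      ... | inj₁ refl | refl rewrite ≔-same φ t (k , i) = q
      ... | inj₂ refl | refl rewrite ≔-other φ (k , i) (o≢v hb) = r

  open NoAdjacentZ noZZ min2

  Z≢V : ∀ {z v} → isZ z ≡ true → isV v ≡ true → z ≢ v
  Z≢V {z} zZ zV refl with split-deg z (Z-S zZ) (min2 z (Z-S zZ))
  ... | inj₁ (_ , e) = t≢f zV e
  ... | inj₂ (_ , e) = t≢f zZ e

  crit : ∀ v → isV v ≡ true → ∃ λ φ → Valid (v ∷ []) φ
  crit v vV with minimal v (V-S vV)
  ... | φ , val = φ , record { hardV = hv ; softV = sv }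
    where
    inside : ∀ {t} → S t ≡ true → t ≢ v → (S ∖ v) t ≡ true
    inside = in-∖ {p = S}
    edge : ∀ {a b} → A a b ≡ true → a ≢ v → b ≢ v → E (sg a b) (φ a) (φ b) ≡ true
    edge {a} {b} h p q = val a b (sg a b) (inside (A-S h) p) (inside (A-S (A-sym h)) q) (A-sgn h)
    hv : ∀ a b → isV a ≡ true → hard a b ≡ true → a ∉ v ∷ [] → b ∉ v ∷ [] → E (sg a b) (φ a) (φ b) ≡ true
    hv a b _ h p q = edge (hard-A h) (p ∘ here) (q ∘ here)
    sv : ∀ z a b → isZ z ≡ true → A z a ≡ true → A z b ≡ true → isV a ≡ true → isV b ≡ true → a ≢ b →
         a ∉ v ∷ [] → b ∉ v ∷ [] → cls (φ a) ≢ neg (sg z a ⊗ sg z b) · cls (φ b)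
    sv z a b zZ za zb _ _ _ p q = subst (λ s → cls (φ a) ≢ neg s · cls (φ b)) (⊗-comm (sg z b) (sg z a))
      (colour-two (sg z b) (sg z a) (φ b) (φ a) (φ z) (edge zb (Z≢V zZ vV) (q ∘ here)) (edge za (Z≢V zZ vV) (p ∘ here)))

  stuck : (∃ λ φ → Valid [] φ) → ⊥
  stuck (φ , val) = uncolourable (ψ , ok)
    where
    Fits : Fin N → Colour → Set
    Fits z γ = ∀ t → A z t ≡ true → E (sg z t) γ (φ t) ≡ true
    fit : ∀ z → isZ z ≡ true → ∃ (Fits z)
    fit z zZ with #-two (A z) (Z-deg zZ)
    ... | a , b , za , zb , ne , al
      with two-colour (sg z b) (sg z a) (φ b) (φ a)
        (subst (λ s → cls (φ a) ≢ neg s · cls (φ b)) (⊗-comm (sg z a) (sg z b))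
          (softV val z a b zZ za zb (Z-nbr zZ za) (Z-nbr zZ zb) ne (λ ()) (λ ())))
    ... | γ , p , q = γ , λ t h → case al t h of λ { (inj₁ refl) → q ; (inj₂ refl) → p }
    choose : ∀ z b → isZ z ≡ b → Colour
    choose z true  e = proj₁ (fit z e)
    choose z false e = φ z
    ψ : Fin N → Colour
    ψ z = choose z (isZ z) refl
    ψ-Z : ∀ z → isZ z ≡ true → Fits z (ψ z)
    ψ-Z z zZ = go (isZ z) refl
      where
      go : ∀ b (e : isZ z ≡ b) → Fits z (choose z b e)
      go true  e = proj₂ (fit z e)
      go false e = ⊥-elim (t≢f zZ e)
    ψ-V : ∀ v → isV v ≡ true → ψ v ≡ φ v
    ψ-V v vV = go (isZ v) refl
      where
      go : ∀ b (e : isZ v ≡ b) → choose v b e ≡ φ v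
      go true  e = ⊥-elim (Z≢V e vV refl)
      go false e = refl
    ok : ValidOn G S ψ
    ok a b s Sa Sb ab with sgn-A Sa Sb ab
    ... | h with sign≡ h ab
    ... | refl with Z-or-V a Sa | Z-or-V b Sb
    ... | inj₁ aZ | inj₁ bZ = ⊥-elim (noZZ a b aZ bZ h)
    ... | inj₁ aZ | inj₂ bV rewrite ψ-V b bV = ψ-Z a aZ b h
    ... | inj₂ aV | inj₁ bZ rewrite ψ-V a aV | sg-sym a b = E-sym (sg b a) (ψ b) (φ a) (ψ-Z b bZ a (A-sym h))
    ... | inj₂ aV | inj₂ bV rewrite ψ-V a aV | ψ-V b bV = hardV val a b aV (A-hard h bV) (λ ()) (λ ())

  dense : 14 * # S ≤ 5 * sum deg
  dense = Critical.dense G S noZZ min2 crit stuck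

-- Induction on a bound for the size of `S`. If `S` is not colourable, every `S ∖ v` is, so `S` is
-- minimal and too dense for its induced subgraph to satisfy the hypothesis on `mad`.
colourable : ∀ G → madLt14/5 G → ∀ m S → # S ≤ m → ∃ (ValidOn G S)
colourable G mad m S le with # S in e
... | zero = (λ _ → a⁺ , true) , λ a b s Sa → ⊥-elim (#-zero S e a Sa)
colourable G mad (suc m) S (s≤s le) | suc k with colourable? G S
... | yes φ = φ
... | no none = ⊥-elim (<⇒≱ sparse (Minimal.dense G S none minimal))
  where
  minimal : ∀ v → S v ≡ true → ∃ (ValidOn G (S ∖ v))
  minimal v Sv = colourable G mad m (S ∖ v) (≤-trans (≤-reflexive (suc-injective (trans (sym (#-remove S v Sv)) e))) le)
  sparse : 5 * sum (Graph.deg G S) < 14 * # S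
  sparse = subst (λ x → 5 * x < 14 * # S) (sym (handshake G S))
    (subst (λ x → 5 * (2 * eH (induced G S)) < 14 * x) (count-# S)
      (mad (induced G S) (≤-trans (s≤s z≤n) (≤-reflexive (sym (trans (count-# S) e))))))

theorem5p1 : (G : SignedGraph) → madLt14/5 G → HasHomToDSG G
theorem5p1 G mad with colourable G mad (n G) (λ _ → true) (#≤n (λ _ → true))
... | φ , val = (vertex ∘ φ) , λ u v s e → E-vertex s (φ u) (φ v) (val u v s refl refl e)
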